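{- The problem $1||(\sum w_jC_j,er)$ (given jobs $J$ with processing times $p_j$ and weights $w_j$ and a subset $J^r\subseteq J$, find the sequences in the Pareto front with respect to simultaneous minimization of $\sum_{j\in J}w_jC_j$ and the length $er$ of the renting period) can be solved in $\mathrm{O}(nP^2)$ time, where $n=|J|$ and $P=\sum_{j\in J}p_j$.
   Context: An instance has a finite set $J$ of $n$ jobs; job $j$ has a positive integer processing time $p_j$ and a non-negative integer weight $w_j$. A non-empty subset $J^r\subseteq J$ (the r-jobs) requires an external resource. A sequence is a permutation of $J$; the jobs are processed one at a time on a single machine in this order, non-preemptively, from time $0$ without idle time. $C_j$ is the completion time of job $j$. The resource is rented once, without interruption, from the start of the first r-job to the completion of the last r-job, so $er=\max_{j\in J^r} C_j-\min_{j\in J^r}(C_j-p_j)$. Finding the Pareto front means finding, for every Pareto-optimal (non-dominated) pair of values $(\sum w_jC_j,er)$, a sequence attaining it. Running times count elementary (unit-cost) arithmetic operations and comparisons. -}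

module Defs where

open import Data.Bool.Base using (Bool; true; false; if_then_else_)
open import Data.Fin.Base using (Fin; zero; suc; toℕ)
open import Data.Fin.Properties using (_≟_)
open import Data.Fin.Subset using (Subset; Nonempty)
open import Data.Fin.Subset.Properties using (_∈?_)
open import Data.List.Base
  using (List; []; _∷_; map; allFin; filter; applyUpTo)
open import Data.List.Extrema.Nat using (max; min)
open import Data.List.Membership.Propositional using (_∈_)
open import Data.List.Relation.Binary.Permutation.Propositional using (_↭_)
open import Data.List.Relation.Unary.Unique.Propositional using (Unique)
open import Data.Nat.Base
  using (ℕ; zero; suc; _+_; _*_; _∸_; _≤_; _<_; _≤ᵇ_; _<ᵇ_; _≡ᵇ_)
open import Data.Nat.ListAction using (sum)
open import Data.Product.Base using (Σ; _×_; _,_; proj₁; ∃-syntax)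
open import Data.Sum.Base using (_⊎_)
open import Function.Bundles using (_⇔_)
open import Relation.Binary.PropositionalEquality.Core using (_≡_)
open import Relation.Nullary.Decidable.Core using (does)
open import Relation.Nullary.Negation.Core using (¬_)

record Instance : Set where
  field
    n              : ℕ
    p              : Fin n → ℕ
    p-positive     : ∀ j → 0 < p j
    w              : Fin n → ℕ
    rJobs          : Subset n
    rJobs-nonempty : Nonempty rJobs

  P : ℕ
  P = sum (map p (allFin n))

  -- The k-th entry of the list is the k-th job processed.
  Sequence : Set
  Sequence = Σ (List (Fin n)) (λ js → js ↭ allFin n)

  jobs : Sequence → List (Fin n)
  jobs = proj₁

  -- The total processing time of the entries up to and including j.
  completionIn : List (Fin n) → Fin n → ℕ
  completionIn []       j = 0
  completionIn (i ∷ is) j =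
    p i + (if does (i ≟ j) then 0 else completionIn is j)

  C : Sequence → Fin n → ℕ
  C σ = completionIn (jobs σ)

  ∑wC : Sequence → ℕ
  ∑wC σ = sum (map (λ j → w j * C σ j) (allFin n))

  rJobList : List (Fin n)
  rJobList = filter (_∈? rJobs) (allFin n)

  -- `max` and `min` take a value for the empty list as first argument.  It
  -- does not affect the result here: there is an r-job, all completion times
  -- are at least 0 and all start times are at most P.
  er : Sequence → ℕ
  er σ = max 0 (map (C σ) rJobList) ∸ min P (map (λ j → C σ j ∸ p j) rJobList)

  value : Sequence → ℕ × ℕ
  value σ = ∑wC σ , er σ

_dominates_ : ℕ × ℕ → ℕ × ℕ → Set
(f , e) dominates (f′ , e′) = f ≤ f′ × e ≤ e′ × (f < f′ ⊎ e < e′)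

module _ (I : Instance) where
  open Instance I

  ParetoOptimal : ℕ × ℕ → Set
  ParetoOptimal v =
    (∃[ σ ] value σ ≡ v) × (∀ σ → ¬ (value σ dominates v))

  -- Exactly one sequence for each Pareto-optimal pair, and no others.
  IsParetoFront : List Sequence → Set
  IsParetoFront σs =
    Unique (map value σs) × (∀ v → v ∈ map value σs ⇔ ParetoOptimal v)

-- Programs run on a unit-cost random access machine.  The memory consists of
-- arrays of natural numbers.  Array names are constants of the program,
-- whereas indices are computed at run time.  A scalar variable is an array
-- used at a single index.

ArrayName : Set
ArrayName = ℕ

Memory : Set
Memory = ArrayName → ℕ → ℕ

_[_][_]≔_ : Memory → ArrayName → ℕ → ℕ → Memory
(m [ a ][ i ]≔ v) b k =
  if a ≡ᵇ b then (if i ≡ᵇ k then v else m b k) else m b k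

data Expr : Set where
  lit         : ℕ → Expr
  _[_]        : ArrayName → Expr → Expr
  _⊕_ _⊖_ _⊗_ : Expr → Expr → Expr

data Test : Set where
  _≤ᵗ_ _<ᵗ_ _≡ᵗ_ : Expr → Expr → Test

data Program : Set where
  skip          : Program
  _[_]:=_       : ArrayName → Expr → Expr → Program
  _⨾_           : Program → Program → Program
  IF_THEN_ELSE_ : Test → Program → Program → Program
  WHILE_DO_     : Test → Program → Program

infixl 7 _⊗_
infixl 6 _⊕_ _⊖_
infix  4 _≤ᵗ_ _<ᵗ_ _≡ᵗ_
infix  3 _[_]:=_
infixr 2 _⨾_

⟦_⟧ : Expr → Memory → ℕ
⟦ lit k   ⟧ m = k
⟦ a [ e ] ⟧ m = m a (⟦ e ⟧ m)
⟦ e ⊕ f   ⟧ m = ⟦ e ⟧ m + ⟦ f ⟧ m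
⟦ e ⊖ f   ⟧ m = ⟦ e ⟧ m ∸ ⟦ f ⟧ m
⟦ e ⊗ f   ⟧ m = ⟦ e ⟧ m * ⟦ f ⟧ m

⟦_⟧ᵗ : Test → Memory → Bool
⟦ e ≤ᵗ f ⟧ᵗ m = ⟦ e ⟧ m ≤ᵇ ⟦ f ⟧ m
⟦ e <ᵗ f ⟧ᵗ m = ⟦ e ⟧ m <ᵇ ⟦ f ⟧ m
⟦ e ≡ᵗ f ⟧ᵗ m = ⟦ e ⟧ m ≡ᵇ ⟦ f ⟧ m

costᵉ : Expr → ℕ
costᵉ (lit k)   = 1
costᵉ (a [ e ]) = 1 + costᵉ e
costᵉ (e ⊕ f)   = 1 + (costᵉ e + costᵉ f)
costᵉ (e ⊖ f)   = 1 + (costᵉ e + costᵉ f)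
costᵉ (e ⊗ f)   = 1 + (costᵉ e + costᵉ f)

costᵗ : Test → ℕ
costᵗ (e ≤ᵗ f) = 1 + (costᵉ e + costᵉ f)
costᵗ (e <ᵗ f) = 1 + (costᵉ e + costᵉ f)
costᵗ (e ≡ᵗ f) = 1 + (costᵉ e + costᵉ f)

-- c ∶ m ⇓[ t ] m′ : started in memory m, the program c halts in memory m′
-- after t elementary steps.
infix 1 _∶_⇓[_]_

data _∶_⇓[_]_ : Program → Memory → ℕ → Memory → Set where
  ⇓-skip : ∀ {m} → skip ∶ m ⇓[ 1 ] m

  ⇓-assign : ∀ {a e f m} →
    (a [ e ]:= f) ∶ m ⇓[ 1 + (costᵉ e + costᵉ f) ] (m [ a ][ ⟦ e ⟧ m ]≔ ⟦ f ⟧ m)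

  ⇓-seq : ∀ {c d m m′ m″ t u} →
    c ∶ m ⇓[ t ] m′ → d ∶ m′ ⇓[ u ] m″ → (c ⨾ d) ∶ m ⇓[ t + u ] m″

  ⇓-if-true : ∀ {b c d m m′ t} →
    ⟦ b ⟧ᵗ m ≡ true → c ∶ m ⇓[ t ] m′ →
    (IF b THEN c ELSE d) ∶ m ⇓[ costᵗ b + t ] m′

  ⇓-if-false : ∀ {b c d m m′ t} →
    ⟦ b ⟧ᵗ m ≡ false → d ∶ m ⇓[ t ] m′ →
    (IF b THEN c ELSE d) ∶ m ⇓[ costᵗ b + t ] m′

  ⇓-while-true : ∀ {b c m m′ m″ t u} →
    ⟦ b ⟧ᵗ m ≡ true → c ∶ m ⇓[ t ] m′ → (WHILE b DO c) ∶ m′ ⇓[ u ] m″ →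
    (WHILE b DO c) ∶ m ⇓[ costᵗ b + (t + u) ] m″

  ⇓-while-false : ∀ {b c m} →
    ⟦ b ⟧ᵗ m ≡ false → (WHILE b DO c) ∶ m ⇓[ costᵗ b ] m

pattern sizeᴬ      = 0
pattern pᴬ         = 1
pattern wᴬ         = 2
pattern rᴬ         = 3
pattern countᴬ     = 4
pattern sequencesᴬ = 5

padded : ∀ {n} → (Fin n → ℕ) → ℕ → ℕ
padded {zero}  f i       = 0
padded {suc n} f zero    = f zero
padded {suc n} f (suc i) = padded (λ j → f (suc j)) i

input : Instance → Memory
input I = λ where
    sizeᴬ zero → n
    pᴬ    i    → padded p i
    wᴬ    i    → padded w i
    rᴬ    i    → padded (λ j → if does (j ∈? rJobs) then 1 else 0) i
    _     _    → 0
  where open Instance I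

-- The output is a number of rows of length n, stored one after the other.
outputRows : ℕ → Memory → List (List ℕ)
outputRows n m =
  applyUpTo (λ k → applyUpTo (λ i → m sequencesᴬ (k * n + i)) n) (m countᴬ 0)

Outputs : (I : Instance) → Memory → List (Instance.Sequence I) → Set
Outputs I m σs = outputRows n m ≡ map (λ σ → map toℕ (jobs σ)) σs
  where open Instance I

{-# OPTIONS --safe #-}

-- Fix the jobs in Smith's order, i.e. by non-increasing w / p.  A sequence
-- splits into the jobs before, in and after the renting period, and er is the
-- total time of those in it.  Regarding the renting period as one composite
-- job, Smith's exchange argument shows that each of the three parts may be
-- assumed to be in Smith's order, and that Smith's order splits into a front
-- and a back such that the jobs before the renting period come from the front
-- and the jobs after it from the back.  If the front takes time Q and the jobs
-- before the renting period take time a, then the front is processed on two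
-- "machines", from 0 to a and from a to Q, and the back on two machines that
-- start at Q and at a + er, the latter stopping at P.  So front and back do not
-- interact, and each is solved by a dynamic program over a position in
-- Smith's order and two machine times, with O(n P²) entries.  For every er,
-- the best pair of a split and a is found in O(n P) further steps.  Going
-- through er = 0, ..., P, a sequence is output whenever the cost strictly
-- decreases.

module Submission where

open import Defs
open import Data.Bool.Base using (Bool; true; false; T; not; _∧_; _∨_; if_then_else_)
open import Data.Fin.Base using (Fin; zero; suc; toℕ)
import Data.Fin.Properties as Fin
open import Data.Fin.Subset using () renaming (_∈_ to _∈ˢ_)
open import Data.Fin.Subset.Properties using (_∈?_)
open import Data.List.Base
  using (List; []; _∷_; _++_; _∷ʳ_; map; reverse; length; allFin; filter; applyUpTo; concat; take; drop; tabulate)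
open import Data.List.Extrema.Nat using (max; min; max≤v⁺; v≤min⁺; xs≤max; min≤xs)
open import Data.List.Membership.Propositional using (_∈_; _∉_)
open import Data.List.Membership.Propositional.Properties
  using (∈-∃++; ∈-++⁺ˡ; ∈-++⁺ʳ; ∈-++⁻; ∈-filter⁺; ∈-filter⁻; ∈-allFin; ∈-map⁻)
import Data.List.Properties as List
open import Data.List.Relation.Binary.Permutation.Propositional
  using (_↭_; ↭-refl; ↭-sym; ↭-trans; ↭-reflexive; prep; ↭⇒↭ₛ)
import Data.List.Relation.Binary.Permutation.Propositional.Properties as Perm
open import Data.List.Relation.Binary.Permutation.Setoid.Properties using (Unique-resp-↭)
open import Data.List.Relation.Unary.All as All using (All; []; _∷_)
import Data.List.Relation.Unary.All.Properties as All
open import Data.List.Relation.Unary.AllPairs as AllPairs using (AllPairs; []; _∷_)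
import Data.List.Relation.Unary.AllPairs.Properties as AllPairs
open import Data.List.Relation.Unary.Any using (here; there)
open import Data.List.Relation.Unary.Unique.Propositional using (Unique)
open import Data.List.Relation.Unary.Unique.Propositional.Properties using (allFin⁺)
open import Data.Maybe.Base using (Maybe; just; nothing; maybe′)
open import Data.Nat.Base
open import Data.Nat.ListAction using (sum)
open import Data.Nat.ListAction.Properties using (sum-++; sum-↭)
open import Data.Nat.Properties
open import Data.Nat.Tactic.RingSolver using (solve-∀)
open import Data.Product.Base using (_×_; _,_; proj₁; proj₂; ∃-syntax)
open import Data.Sum.Base using (_⊎_; inj₁; inj₂; [_,_]′)
open import Function.Base using (id; case_of_)
open import Function.Bundles using (mk⇔)
open import Relation.Binary.Definitions using (DecidableEquality; tri<; tri≈; tri>)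
open import Relation.Binary.PropositionalEquality
  using (_≡_; _≢_; refl; sym; trans; cong; cong₂; subst; subst₂; module ≡-Reasoning)
open import Relation.Binary.PropositionalEquality.Properties using (setoid)
open import Relation.Nullary using (¬_; Dec; yes; no; does; contradiction)

-- Structured programs and their running time

-- Front and back are separated by the ratio of the block of jobs in the renting period, which is
-- unknown in advance; hence every prefix of Smith's order is tried as front. Both tables are
-- indexed by the times at which the machines stand before the remaining jobs, so one pair of tables
-- answers the queries for all splits, all `a` and all `er`. For the front the known times are the
-- ends `Q` and `a`, whence the reversal of time in the backward table.
--
-- At the end of a table it suffices to check that the machine outside the block stops at `P`; the
-- end of the other one follows from the total processing time. Overruns and r-jobs outside the
-- block cost multiples of `∞`, which exceeds the cost of every sequence, so a value below `∞`
-- proves its assignment feasible.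
--
-- For each `e` the search is over blocks of length exactly `e`. A block may begin or end with jobs
-- that do not need the resource, so the sequence found may have `er` below `e`. But then an earlier
-- round has already reached its cost, and there is no strict decrease; hence every sequence that is
-- output has `er` equal to `e`.

data Range : Set where
  eachJob eachSplit eachTime : Range

pattern totalᴬ = 6

-- Splits and times range over `0, ..., n` and `0, ..., P` inclusive, hence the additional `lit 1`.
limit : Range → Expr
limit eachJob   = sizeᴬ [ lit 0 ]
limit eachSplit = sizeᴬ [ lit 0 ] ⊕ lit 1
limit eachTime  = totalᴬ [ lit 0 ] ⊕ lit 1

infix  3 _[_]≔_
infixr 2 _⨟_

-- In a loop UP ρ v c, the scalar v counts from its current value up to the
-- limit of ρ.
data Code : Set where
  skip          : Code
  _[_]≔_        : ArrayName → Expr → Expr → Code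
  _⨟_           : Code → Code → Code
  IF_THEN_ELSE_ : Test → Code → Code → Code
  UP            : Range → ArrayName → Code → Code

iter : ℕ → (Memory → Memory) → Memory → Memory
iter zero    f m = m
iter (suc k) f m = iter k f (f m)

next : ArrayName → Memory → Memory
next v m = m [ v ][ 0 ]≔ (m v 0 + 1)

-- The number of iterations of a loop is fixed on entry. That this agrees with the compiled `WHILE`
-- loop rests on `wellFormed`: the body changes neither the counter nor the limit.
run : Code → Memory → Memory
run skip                   m = m
run (a [ e ]≔ f)           m = m [ a ][ ⟦ e ⟧ m ]≔ ⟦ f ⟧ m
run (c ⨟ d)                m = run d (run c m)
run (IF b THEN c ELSE d)   m = if ⟦ b ⟧ᵗ m then run c m else run d m
run (UP ρ v c)             m = iter (⟦ limit ρ ⟧ m ∸ m v 0) (λ m′ → next v (run c m′)) m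

compile : Code → Program
compile skip                 = skip
compile (a [ e ]≔ f)         = a [ e ]:= f
compile (c ⨟ d)              = compile c ⨾ compile d
compile (IF b THEN c ELSE d) = IF b THEN compile c ELSE compile d
compile (UP ρ v c)           =
  WHILE v [ lit 0 ] <ᵗ limit ρ DO (compile c ⨾ v [ lit 0 ]:= v [ lit 0 ] ⊕ lit 1)

writes : ArrayName → Code → Bool
writes a skip                 = false
writes a (b [ e ]≔ f)         = b ≡ᵇ a
writes a (c ⨟ d)              = writes a c ∨ writes a d
writes a (IF b THEN c ELSE d) = writes a c ∨ writes a d
writes a (UP ρ v c)           = (v ≡ᵇ a) ∨ writes a c

-- These are the arrays that `limit` reads. Since `totalᴬ` must first be computed, its assignment
-- stands in `program` between compiled pieces, outside `Code`.
readOnly : ArrayName → Bool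
readOnly a = (a ≡ᵇ sizeᴬ) ∨ (a ≡ᵇ totalᴬ)

wellFormed : Code → Bool
wellFormed skip                 = true
wellFormed (a [ e ]≔ f)         = not (readOnly a)
wellFormed (c ⨟ d)              = wellFormed c ∧ wellFormed d
wellFormed (IF b THEN c ELSE d) = wellFormed c ∧ wellFormed d
wellFormed (UP ρ v c)           = not (readOnly v) ∧ not (writes v c) ∧ wellFormed c

∧-split : ∀ {a b} → a ∧ b ≡ true → a ≡ true × b ≡ true
∧-split {true} {true} _ = refl , refl

∨-split : ∀ {a b} → a ∨ b ≡ false → a ≡ false × b ≡ false
∨-split {false} {false} _ = refl , refl

not-true : ∀ {a} → not a ≡ true → a ≡ false
not-true {false} _ = refl

frame : ∀ c {a} m → writes a c ≡ false → ∀ i → run c m a i ≡ m a i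
frame-iter : ∀ v c {a} k m → (v ≡ᵇ a) ≡ false → writes a c ≡ false →
  ∀ i → iter k (λ m′ → next v (run c m′)) m a i ≡ m a i

frame skip                 m h i = refl
frame (b [ e ]≔ f)         m h i rewrite h = refl
frame (c ⨟ d)              m h i =
  let hc , hd = ∨-split h in trans (frame d (run c m) hd i) (frame c m hc i)
frame (IF b THEN c ELSE d) m h i with ⟦ b ⟧ᵗ m
... | true  = frame c m (proj₁ (∨-split h)) i
... | false = frame d m (proj₂ (∨-split h)) i
frame (UP ρ v c)           m h i =
  let hv , hc = ∨-split h in frame-iter v c (⟦ limit ρ ⟧ m ∸ m v 0) m hv hc i

frame-iter v c zero    m hv hc i = refl
frame-iter v c {a} (suc k) m hv hc i =
  trans (frame-iter v c k (next v (run c m)) hv hc i) step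
  where
  step : next v (run c m) a i ≡ m a i
  step rewrite hv = frame c m hc i

≡ᵇ-≢ : ∀ {a b} → a ≢ b → (a ≡ᵇ b) ≡ false
≡ᵇ-≢ {a} {b} a≢b with a ≡ᵇ b in eq
... | false = refl
... | true  = contradiction (≡ᵇ⇒≡ a b (subst T (sym eq) _)) a≢b

≡ᵇ-refl : ∀ a → (a ≡ᵇ a) ≡ true
≡ᵇ-refl zero    = refl
≡ᵇ-refl (suc a) = ≡ᵇ-refl a

next-counter : ∀ v m → next v m v 0 ≡ suc (m v 0)
next-counter v m rewrite ≡ᵇ-refl v = +-comm (m v 0) 1

readOnly-≢ : ∀ {a} b → readOnly a ≡ true → readOnly b ≡ false → (b ≡ᵇ a) ≡ false
readOnly-≢ {a} b ha hb with b ≡ᵇ a in eq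
... | false = refl
... | true  with refl ← ≡ᵇ⇒≡ b a (subst T (sym eq) _) = contradiction (trans (sym ha) hb) (λ ())

wellFormed-readOnly : ∀ {a} c → readOnly a ≡ true → wellFormed c ≡ true → writes a c ≡ false
wellFormed-readOnly skip                 ha h = refl
wellFormed-readOnly (b [ e ]≔ f)         ha h = readOnly-≢ b ha (not-true h)
wellFormed-readOnly (c ⨟ d)              ha h = let hc , hd = ∧-split h in
  cong₂ _∨_ (wellFormed-readOnly c ha hc) (wellFormed-readOnly d ha hd)
wellFormed-readOnly (IF b THEN c ELSE d) ha h = let hc , hd = ∧-split h in
  cong₂ _∨_ (wellFormed-readOnly c ha hc) (wellFormed-readOnly d ha hd)
wellFormed-readOnly (UP ρ v c)           ha h = let hv , hc = ∧-split {not (readOnly v)} h in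
  cong₂ _∨_ (readOnly-≢ v ha (not-true hv))
    (wellFormed-readOnly c ha (proj₂ (∧-split {not (writes v c)} hc)))

limit-cong : ∀ ρ {m m′} → m′ sizeᴬ 0 ≡ m sizeᴬ 0 → m′ totalᴬ 0 ≡ m totalᴬ 0 →
  ⟦ limit ρ ⟧ m′ ≡ ⟦ limit ρ ⟧ m
limit-cong eachJob   s t = s
limit-cong eachSplit s t = cong (_+ 1) s
limit-cong eachTime  s t = cong (_+ 1) t

limit-frame : ∀ ρ c m → wellFormed c ≡ true → ⟦ limit ρ ⟧ (run c m) ≡ ⟦ limit ρ ⟧ m
limit-frame ρ c m h = limit-cong ρ {m} {run c m}
  (frame c m (wellFormed-readOnly c refl h) 0) (frame c m (wellFormed-readOnly c refl h) 0)

limit-next : ∀ ρ v m → readOnly v ≡ false → ⟦ limit ρ ⟧ (next v m) ≡ ⟦ limit ρ ⟧ m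
limit-next ρ v m h with v ≡ᵇ sizeᴬ in p | v ≡ᵇ totalᴬ in q
limit-next ρ v m h | false | false = limit-cong ρ {m} {next v m}
  (cong (λ b → if b then m v 0 + 1 else m sizeᴬ 0) p)
  (cong (λ b → if b then m v 0 + 1 else m totalᴬ 0) q)

-- Up to constants, the running time is bounded by a monomial in the two
-- numbers that bound the ranges of the loops; these are its exponents.
degreeᴺ degreeˢ : Code → ℕ
degreeᴺ skip                 = 0
degreeᴺ (a [ e ]≔ f)         = 0
degreeᴺ (c ⨟ d)              = degreeᴺ c ⊔ degreeᴺ d
degreeᴺ (IF b THEN c ELSE d) = degreeᴺ c ⊔ degreeᴺ d
degreeᴺ (UP eachJob   v c)      = suc (degreeᴺ c)
degreeᴺ (UP eachSplit v c)      = suc (degreeᴺ c)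
degreeᴺ (UP eachTime  v c)      = degreeᴺ c
degreeˢ skip                 = 0
degreeˢ (a [ e ]≔ f)         = 0
degreeˢ (c ⨟ d)              = degreeˢ c ⊔ degreeˢ d
degreeˢ (IF b THEN c ELSE d) = degreeˢ c ⊔ degreeˢ d
degreeˢ (UP eachJob   v c)      = degreeˢ c
degreeˢ (UP eachSplit v c)      = degreeˢ c
degreeˢ (UP eachTime  v c)      = suc (degreeˢ c)

coefficient : Code → ℕ
coefficient skip                 = 1
coefficient (a [ e ]≔ f)         = 1 + (costᵉ e + costᵉ f)
coefficient (c ⨟ d)              = coefficient c + coefficient d
coefficient (IF b THEN c ELSE d) = costᵗ b + (coefficient c + coefficient d)
-- The 20 consists of 7 for the final test and 13 per iteration, namely 7 for the test and 6 for
-- incrementing the counter.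
coefficient (UP ρ v c)           = 20 + coefficient c

costᵗ-limit : ∀ ρ v → costᵗ (v [ lit 0 ] <ᵗ limit ρ) ≤ 7
costᵗ-limit eachJob   v = s≤s (s≤s (s≤s (s≤s (s≤s z≤n))))
costᵗ-limit eachSplit v = ≤-refl
costᵗ-limit eachTime  v = ≤-refl

<ᵇ-true : ∀ a b → a < b → (a <ᵇ b) ≡ true
<ᵇ-true a b h with a <ᵇ b in eq
... | true  = refl
... | false = contradiction (subst T eq (<⇒<ᵇ h)) (λ ())

<ᵇ-false : ∀ a b → b ≤ a → (a <ᵇ b) ≡ false
<ᵇ-false a b h with a <ᵇ b in eq
... | false = refl
... | true  = contradiction (<ᵇ⇒< a b (subst T (sym eq) _)) (≤⇒≯ h)

module Timing (N S : ℕ) (0<N : 0 < N) (0<S : 0 < S) where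

  monomial : ℕ → ℕ → ℕ
  monomial a b = N ^ a * S ^ b

  private instance
    N≢0 : NonZero N
    N≢0 = >-nonZero 0<N
    S≢0 : NonZero S
    S≢0 = >-nonZero 0<S

  monomial-mono : ∀ {a a′ b b′} → a ≤ a′ → b ≤ b′ → monomial a b ≤ monomial a′ b′
  monomial-mono p q = *-mono-≤ (^-monoʳ-≤ N p) (^-monoʳ-≤ S q)

  budget : Code → ℕ
  budget c = monomial (degreeᴺ c) (degreeˢ c)

  1≤budget : ∀ c → 1 ≤ budget c
  1≤budget c = monomial-mono {0} {degreeᴺ c} {0} {degreeˢ c} z≤n z≤n

  value : Range → ℕ
  value eachJob   = N
  value eachSplit = N
  value eachTime  = S

  budget-UP : ∀ ρ v c → value ρ * budget c ≡ budget (UP ρ v c)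
  budget-UP eachJob   v c = sym (*-assoc N (N ^ degreeᴺ c) (S ^ degreeˢ c))
  budget-UP eachSplit v c = sym (*-assoc N (N ^ degreeᴺ c) (S ^ degreeˢ c))
  budget-UP eachTime  v c = swap S (N ^ degreeᴺ c) (S ^ degreeˢ c)
    where
    swap : ∀ x y z → x * (y * z) ≡ y * (x * z)
    swap = solve-∀

  -- The bounds are strict so that limits exceeding the stored numbers by one are still at most `N`
  -- and `S`.
  Small : Memory → Set
  Small m = m sizeᴬ 0 < N × m totalᴬ 0 < S

  limit-value : ∀ ρ m → Small m → ⟦ limit ρ ⟧ m ≤ value ρ
  limit-value eachJob   m (p , q) = <⇒≤ p
  limit-value eachSplit m (p , q) = ≤-trans (≤-reflexive (+-comm _ 1)) p
  limit-value eachTime  m (p , q) = ≤-trans (≤-reflexive (+-comm _ 1)) q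

  Small-run : ∀ c m → wellFormed c ≡ true → Small m → Small (run c m)
  Small-run c m h (p , q) =
    subst (_< N) (sym (frame c m (wellFormed-readOnly c refl h) 0)) p ,
    subst (_< S) (sym (frame c m (wellFormed-readOnly c refl h) 0)) q

  Small-next : ∀ v m → readOnly v ≡ false → Small m → Small (next v m)
  Small-next v m h sm with v ≡ᵇ sizeᴬ | v ≡ᵇ totalᴬ
  Small-next v m h sm | false | false = sm

  -- Every part is charged to the monomial of the whole code: the exponents only grow, `N` and `S`
  -- are positive, and constant costs are covered by a budget of at least 1. A loop multiplies the
  -- budget of its body by `N` or `S`.
  sound : ∀ c m → wellFormed c ≡ true → Small m →
    ∃[ t ] (compile c ∶ m ⇓[ t ] run c m) × t ≤ coefficient c * budget c

  sound-iter : ∀ ρ v c → wellFormed (UP ρ v c) ≡ true → ∀ k m → Small m →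
    ⟦ limit ρ ⟧ m ∸ m v 0 ≡ k →
    ∃[ t ] (compile (UP ρ v c) ∶ m ⇓[ t ] iter k (λ m′ → next v (run c m′)) m)
      × t ≤ 7 + k * (13 + coefficient c * budget c)

  sound skip m h sm = 1 , ⇓-skip , s≤s z≤n
  sound (a [ e ]≔ f) m h sm =
    _ , ⇓-assign , ≤-reflexive (sym (*-identityʳ _))
  sound (c ⨟ d) m h sm =
    let hc , hd = ∧-split h
        t , ⇓c , t≤ = sound c m hc sm
        u , ⇓d , u≤ = sound d (run c m) hd (Small-run c m hc sm)
    in t + u , ⇓-seq ⇓c ⇓d , (begin
      t + u ≤⟨ +-mono-≤ t≤ u≤ ⟩
      coefficient c * budget c + coefficient d * budget d
        ≤⟨ +-mono-≤
             (*-monoʳ-≤ (coefficient c) (monomial-mono (m≤m⊔n (degreeᴺ c) (degreeᴺ d))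
               (m≤m⊔n (degreeˢ c) (degreeˢ d))))
             (*-monoʳ-≤ (coefficient d) (monomial-mono (m≤n⊔m (degreeᴺ c) (degreeᴺ d))
               (m≤n⊔m (degreeˢ c) (degreeˢ d)))) ⟩
      coefficient c * budget (c ⨟ d) + coefficient d * budget (c ⨟ d)
        ≡⟨ sym (*-distribʳ-+ (budget (c ⨟ d)) (coefficient c) (coefficient d)) ⟩
      (coefficient c + coefficient d) * budget (c ⨟ d) ∎)
    where open ≤-Reasoning
  sound cd@(IF b THEN c ELSE d) m h sm with ⟦ b ⟧ᵗ m in eq
  ... | true =
    let hc , hd = ∧-split h
        t , ⇓c , t≤ = sound c m hc sm
    in costᵗ b + t , ⇓-if-true eq ⇓c , (begin
      costᵗ b + t ≤⟨ +-mono-≤ (m≤m*n (costᵗ b) (budget cd) {{>-nonZero (1≤budget cd)}})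
        (≤-trans t≤ (*-mono-≤ (m≤m+n (coefficient c) (coefficient d))
          (monomial-mono (m≤m⊔n (degreeᴺ c) (degreeᴺ d)) (m≤m⊔n (degreeˢ c) (degreeˢ d))))) ⟩
      costᵗ b * budget cd + (coefficient c + coefficient d) * budget cd
        ≡⟨ sym (*-distribʳ-+ (budget cd) (costᵗ b) _) ⟩
      coefficient cd * budget cd ∎)
    where open ≤-Reasoning
  ... | false =
    let hc , hd = ∧-split h
        t , ⇓d , t≤ = sound d m hd sm
    in costᵗ b + t , ⇓-if-false eq ⇓d , (begin
      costᵗ b + t ≤⟨ +-mono-≤ (m≤m*n (costᵗ b) (budget cd) {{>-nonZero (1≤budget cd)}})
        (≤-trans t≤ (*-mono-≤ (m≤n+m (coefficient d) (coefficient c))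
          (monomial-mono (m≤n⊔m (degreeᴺ c) (degreeᴺ d)) (m≤n⊔m (degreeˢ c) (degreeˢ d))))) ⟩
      costᵗ b * budget cd + (coefficient c + coefficient d) * budget cd
        ≡⟨ sym (*-distribʳ-+ (budget cd) (costᵗ b) _) ⟩
      coefficient cd * budget cd ∎)
    where open ≤-Reasoning
  sound (UP ρ v c) m h sm =
    let k = ⟦ limit ρ ⟧ m ∸ m v 0
        t , ⇓c , t≤ = sound-iter ρ v c h k m sm refl
        κ = coefficient c
        X = budget c
        Y = value ρ * X
    in t , ⇓c , (begin
      t                              ≤⟨ t≤ ⟩
      7 + k * (13 + κ * X)           ≤⟨ +-monoʳ-≤ 7 (*-monoˡ-≤ (13 + κ * X)
                                          (≤-trans (m∸n≤m _ (m v 0)) (limit-value ρ m sm))) ⟩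
      7 + value ρ * (13 + κ * X)     ≤⟨ +-monoʳ-≤ 7 (*-monoʳ-≤ (value ρ) (+-monoˡ-≤ (κ * X)
                                          (*-monoʳ-≤ 13 (1≤budget c)))) ⟩
      7 + value ρ * (13 * X + κ * X) ≡⟨ expand (value ρ) X κ ⟩
      7 + (13 + κ) * Y               ≤⟨ +-monoˡ-≤ ((13 + κ) * Y) (*-monoʳ-≤ 7 1≤Y) ⟩
      7 * Y + (13 + κ) * Y           ≡⟨ sym (*-distribʳ-+ Y 7 (13 + κ)) ⟩
      (20 + κ) * Y                   ≡⟨ cong ((20 + κ) *_) (budget-UP ρ v c) ⟩
      (20 + κ) * budget (UP ρ v c)   ∎)
    where
    open ≤-Reasoning
    1≤Y : 1 ≤ value ρ * budget c
    1≤Y = subst (1 ≤_) (sym (budget-UP ρ v c)) (1≤budget (UP ρ v c))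
    expand : ∀ r X κ → 7 + r * (13 * X + κ * X) ≡ 7 + (13 + κ) * (r * X)
    expand = solve-∀

  sound-iter ρ v c h zero m sm eq = _ , ⇓-while-false (<ᵇ-false (m v 0) (⟦ limit ρ ⟧ m) (m∸n≡0⇒m≤n eq)) ,
    ≤-trans (costᵗ-limit ρ v) (m≤m+n 7 0)
  sound-iter ρ v c h (suc k) m sm eq =
    let hv , hc′ = ∧-split {not (readOnly v)} h
        hw , hc = ∧-split {not (writes v c)} hc′
        t , ⇓c , t≤ = sound c m hc sm
        u , ⇓w , u≤ = sound-iter ρ v c h k (next v (run c m))
          (Small-next v (run c m) (not-true hv) (Small-run c m hc sm))
          (trans (cong₂ _∸_
                   (trans (limit-next ρ v (run c m) (not-true hv)) (limit-frame ρ c m hc))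
                   (trans (next-counter v (run c m)) (cong suc (frame c m (not-true hw) 0))))
            (trans (sym (pred[m∸n]≡m∸[1+n] _ (m v 0))) (cong pred eq)))
    in _ , ⇓-while-true (<ᵇ-true (m v 0) (⟦ limit ρ ⟧ m) (m∸n≢0⇒n<m λ z → 1+n≢0 (trans (sym eq) z)))
             (⇓-seq ⇓c ⇓-assign) ⇓w ,
       (begin
         costᵗ (v [ lit 0 ] <ᵗ limit ρ) + ((t + 6) + u)
           ≤⟨ +-mono-≤ (costᵗ-limit ρ v) (+-mono-≤ (+-monoˡ-≤ 6 t≤) u≤) ⟩
         7 + (κX + 6 + (7 + k * (13 + κX)))
           ≡⟨ collect κX k ⟩
         7 + suc k * (13 + κX) ∎)
    where
    open ≤-Reasoning
    κX : ℕ
    κX = coefficient c * budget c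
    collect : ∀ x k → 7 + (x + 6 + (7 + k * (13 + x))) ≡ 7 + suc k * (13 + x)
    collect = solve-∀

-- A relation between memories rather than a statement about `run`, because the memory between two
-- iterations of a loop is not the result of running that loop.
Keeps : Code → Memory → Memory → Set
Keeps c m m′ = ∀ a → writes a c ≡ false → ∀ i → m′ a i ≡ m a i

-- Besides the invariant, the step may use that arrays which the loop cannot write have their
-- initial contents. So `Inv` has to mention only what changes.
loop-invariant : ∀ ρ v c m (Inv : ℕ → Memory → Set) {i N} →
  wellFormed (UP ρ v c) ≡ true → ⟦ limit ρ ⟧ m ≡ N → m v 0 ≡ i → i ≤ N → Inv i m →
  (∀ k m′ → k < N → m′ v 0 ≡ k → Keeps (UP ρ v c) m m′ → Inv k m′ →
    Inv (suc k) (next v (run c m′))) →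
  Inv N (run (UP ρ v c) m)
loop-invariant ρ v c m Inv {i} {N} wf lim start i≤N init step =
  go (⟦ limit ρ ⟧ m ∸ m v 0) i m
    (trans (cong₂ (λ x y → i + (x ∸ y)) lim start) (m+[n∸m]≡n i≤N))
    start (λ a h j → refl) init
  where
  unwritten : writes v c ≡ false
  unwritten = not-true (proj₁ (∧-split {not (writes v c)} (proj₂ (∧-split {not (readOnly v)} wf))))

  go : ∀ k i m′ → i + k ≡ N → m′ v 0 ≡ i → Keeps (UP ρ v c) m m′ → Inv i m′ →
    Inv N (iter k (λ m″ → next v (run c m″)) m′)
  go zero    i m′ eq count keeps inv = subst (λ x → Inv x m′) (trans (sym (+-identityʳ i)) eq) inv
  go (suc k) i m′ eq count keeps inv =
    go k (suc i) (next v (run c m′)) (trans (sym (+-suc i k)) eq)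
      (trans (next-counter v (run c m′)) (cong suc (trans (frame c m′ unwritten 0) count)))
      (λ a h j → trans (frame-iter v c 1 m′ (proj₁ (∨-split h)) (proj₂ (∨-split {v ≡ᵇ a} h)) j) (keeps a h j))
      (step i m′ (subst (suc i ≤_) eq (subst (_≤ i + suc k) (+-comm i 1) (+-monoʳ-≤ i (s≤s z≤n)))) count keeps inv)


-- Smith's rule

total : ∀ {A : Set} → (A → ℕ) → List A → ℕ
total f xs = sum (map f xs)

total-++ : ∀ {A : Set} (f : A → ℕ) xs ys → total f (xs ++ ys) ≡ total f xs + total f ys
total-++ f xs ys = trans (cong sum (List.map-++ f xs ys)) (sum-++ (map f xs) (map f ys))

total-↭ : ∀ {A : Set} (f : A → ℕ) {xs ys} → xs ↭ ys → total f xs ≡ total f ys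
total-↭ f eq = sum-↭ (Perm.map⁺ f eq)

total-reverse : ∀ {A : Set} (f : A → ℕ) xs → total f (reverse xs) ≡ total f xs
total-reverse f xs = total-↭ f (Perm.↭-reverse xs)

module Smith {A : Set} (p w : A → ℕ) where

  cost : ℕ → List A → ℕ
  cost t []       = 0
  cost t (x ∷ xs) = w x * (t + p x) + cost (t + p x) xs

  infix 4 _≼_
  -- The ratio `w x / p x` is at least `w y / p y`, multiplied out to stay within natural numbers.
  _≼_ : A → A → Set
  x ≼ y = w y * p x ≤ w x * p y

  -- Multiply by the processing time of the middle element, chain, and cancel it. In the exchange
  -- argument the middle element is once an ordinary job and once the composite job.
  ≼-trans : ∀ {x y z} → 0 < p y → x ≼ y → y ≼ z → x ≼ z
  ≼-trans {x} {y} {z} 0<py x≼y y≼z = *-cancelʳ-≤ _ _ (p y) {{>-nonZero 0<py}} (begin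
    w z * p x * p y   ≡⟨ swap (w z) (p x) (p y) ⟩
    w z * p y * p x   ≤⟨ *-monoˡ-≤ (p x) y≼z ⟩
    w y * p z * p x   ≡⟨ swap (w y) (p z) (p x) ⟩
    w y * p x * p z   ≤⟨ *-monoˡ-≤ (p z) x≼y ⟩
    w x * p y * p z   ≡⟨ swap (w x) (p y) (p z) ⟩
    w x * p z * p y   ∎)
    where
    open ≤-Reasoning
    swap : ∀ a b c → a * b * c ≡ a * c * b
    swap = solve-∀

  cost-++ : ∀ t xs ys → cost t (xs ++ ys) ≡ cost t xs + cost (t + total p xs) ys
  cost-++ t []       ys = cong (λ u → cost u ys) (sym (+-identityʳ t))
  cost-++ t (x ∷ xs) ys
    rewrite cost-++ (t + p x) xs ys | +-assoc t (p x) (total p xs) =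
    sym (+-assoc (w x * (t + p x)) _ _)

  cost-shift : ∀ t xs → cost t xs ≡ t * total w xs + cost 0 xs
  cost-shift t []       = sym (trans (+-identityʳ (t * 0)) (*-zeroʳ t))
  cost-shift t (x ∷ xs)
    rewrite cost-shift (t + p x) xs | cost-shift (p x) xs =
    expand (w x) t (p x) (total w xs) (cost 0 xs)
    where
    expand : ∀ a t b s c →
      a * (t + b) + ((t + b) * s + c) ≡ t * (a + s) + (a * b + (b * s + c))
    expand = solve-∀

  -- No job is completed after `t + total p xs`. With `t = 0` this is the bound behind the choice of
  -- `∞`.
  cost-≤ : ∀ t xs → cost t xs ≤ total w xs * (t + total p xs)
  cost-≤ t []       = z≤n
  cost-≤ t (x ∷ xs) = begin
    w x * (t + p x) + cost (t + p x) xs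
      ≤⟨ +-mono-≤ (*-monoʳ-≤ (w x) (+-monoʳ-≤ t (m≤m+n (p x) (total p xs))))
           (≤-trans (cost-≤ (t + p x) xs)
             (≤-reflexive (cong (total w xs *_) (+-assoc t (p x) (total p xs))))) ⟩
    w x * (t + (p x + total p xs)) + total w xs * (t + (p x + total p xs))
      ≡⟨ sym (*-distribʳ-+ (t + (p x + total p xs)) (w x) (total w xs)) ⟩
    (w x + total w xs) * (t + (p x + total p xs)) ∎
    where open ≤-Reasoning

  -- Only `x` and `y` change their completion times. Apart from common terms, the costs are
  -- `w y * p x` on the left and `w x * p y` on the right.
  cost-swap : ∀ t {x y} zs → x ≼ y → cost t (x ∷ y ∷ zs) ≤ cost t (y ∷ x ∷ zs)
  cost-swap t {x} {y} zs x≼y = begin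
    w x * (t + p x) + (w y * (t + p x + p y) + cost (t + p x + p y) zs)
      ≡⟨ expandˡ (w x) (w y) (p x) (p y) t _ ⟩
    w y * p x + (w x * (t + p x) + w y * (t + p y) + cost (t + p x + p y) zs)
      ≤⟨ +-monoˡ-≤ _ x≼y ⟩
    w x * p y + (w x * (t + p x) + w y * (t + p y) + cost (t + p x + p y) zs)
      ≡⟨ cong (λ u → w x * p y + (w x * (t + p x) + w y * (t + p y) + cost u zs))
           (swap t (p x) (p y)) ⟩
    w x * p y + (w x * (t + p x) + w y * (t + p y) + cost (t + p y + p x) zs)
      ≡⟨ expandʳ (w x) (w y) (p x) (p y) t _ ⟩
    w y * (t + p y) + (w x * (t + p y + p x) + cost (t + p y + p x) zs) ∎
    where
    open ≤-Reasoning
    swap : ∀ t a b → t + a + b ≡ t + b + a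
    swap = solve-∀
    expandˡ : ∀ a b x y t c →
      a * (t + x) + (b * (t + x + y) + c) ≡ b * x + (a * (t + x) + b * (t + y) + c)
    expandˡ = solve-∀
    expandʳ : ∀ a b x y t c →
      a * y + (a * (t + x) + b * (t + y) + c) ≡ b * (t + y) + (a * (t + y + x) + c)
    expandʳ = solve-∀

  cost-bubble : ∀ t {x} ys zs → All (x ≼_) ys → cost t (x ∷ ys ++ zs) ≤ cost t (ys ++ x ∷ zs)
  cost-bubble t     []       zs []            = ≤-refl
  cost-bubble t {x} (y ∷ ys) zs (x≼y ∷ x≼ys) =
    ≤-trans (cost-swap t (ys ++ zs) x≼y)
      (+-monoʳ-≤ (w y * (t + p y)) (cost-bubble (t + p y) ys zs x≼ys))

  -- Wherever the head of the sorted list stands in `ys`, adjacent swaps bring it to the front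
  -- without increasing the cost; the rest is induction.
  smith : ∀ t {xs ys} → AllPairs _≼_ xs → xs ↭ ys → cost t xs ≤ cost t ys
  smith t {[]}     []            xs↭ys = z≤n
  smith t {x ∷ xs} (x≼xs ∷ sorted) xs↭ys
    with ys₁ , ys₂ , refl ← ∈-∃++ (Perm.∈-resp-↭ xs↭ys (here refl)) =
    ≤-trans (+-monoʳ-≤ (w x * (t + p x)) (smith (t + p x) sorted rest))
      (cost-bubble t ys₁ ys₂ (All.++⁻ˡ ys₁ (Perm.All-resp-↭ rest x≼xs)))
    where
    rest : xs ↭ ys₁ ++ ys₂
    rest = Perm.drop-mid [] ys₁ xs↭ys

-- A block of jobs that are processed consecutively acts like a single job.
module Block {A : Set} (p w : A → ℕ) (P W : ℕ) where

  p⁺ w⁺ : Maybe A → ℕ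
  p⁺ = maybe′ p P
  w⁺ = maybe′ w W

  open Smith p w
  open Smith p⁺ w⁺ public using () renaming (cost to cost⁺; _≼_ to _≼⁺_; ≼-trans to ≼⁺-trans; smith to smith⁺)

  around : List A → List A → List (Maybe A)
  around xs zs = map just xs ++ nothing ∷ map just zs

  cost⁺-just : ∀ t xs → cost⁺ t (map just xs) ≡ cost t xs
  cost⁺-just t []       = refl
  cost⁺-just t (x ∷ xs) = cong (w x * (t + p x) +_) (cost⁺-just (t + p x) xs)

  -- Started at time `t`, the jobs of the block cost `t * W + cost 0 ys`, whereas the composite job
  -- costs `W * (t + P)`. So the difference depends on the block alone; it is distributed over both
  -- sides to avoid subtraction.
  cost-block : ∀ t xs ys zs → total p ys ≡ P → total w ys ≡ W →
    cost t (xs ++ ys ++ zs) + W * P ≡ cost⁺ t (around xs zs) + cost 0 ys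
  cost-block t [] ys zs refl refl
    rewrite cost-++ t ys zs | cost-shift t ys | cost⁺-just (t + P) zs =
    collect t (total w ys) (cost 0 ys) (cost (t + P) zs) P
    where
    collect : ∀ t a b c d → t * a + b + c + a * d ≡ a * (t + d) + c + b
    collect = solve-∀
  cost-block t (x ∷ xs) ys zs eqP eqW =
    trans (+-assoc (w x * (t + p x)) _ (W * P))
      (trans (cong (w x * (t + p x) +_) (cost-block (t + p x) xs ys zs eqP eqW))
        (sym (+-assoc (w x * (t + p x)) _ (cost 0 ys))))


-- Classes of jobs and the exchange argument

module _ {A : Set} where

  select : (A → ℕ) → ℕ → List A → List A
  select f c = filter (λ x → f x ≟ c)

  arrange : (A → ℕ) → List A → List A
  arrange f xs = select f 0 xs ++ select f 1 xs ++ select f 2 xs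

  arrange-↭ : ∀ f {xs} → All (λ x → f x ≤ 2) xs → arrange f xs ↭ xs
  arrange-↭ f []                  = ↭-refl
  arrange-↭ f {x ∷ xs} (px ∷ pxs) with f x
  arrange-↭ f {x ∷ xs} (px ∷ pxs) | 0 = prep x (arrange-↭ f pxs)
  arrange-↭ f {x ∷ xs} (px ∷ pxs) | 1 =
    ↭-trans (Perm.shift x (select f 0 xs) _) (prep x (arrange-↭ f pxs))
  arrange-↭ f {x ∷ xs} (px ∷ pxs) | 2 =
    ↭-trans (Perm.++⁺ˡ (select f 0 xs) (Perm.shift x (select f 1 xs) _))
      (↭-trans (Perm.shift x (select f 0 xs) _) (prep x (arrange-↭ f pxs)))
  arrange-↭ f {x ∷ xs} (s≤s (s≤s ()) ∷ pxs) | suc (suc (suc _))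

  disjoint : ∀ xs {ys : List A} {x} → Unique (xs ++ ys) → x ∈ xs → x ∉ ys
  disjoint (_ ∷ xs) (≢s ∷ _) (here refl) x∈ys = All.lookup (All.++⁻ʳ xs ≢s) x∈ys refl
  disjoint (_ ∷ xs) (_ ∷ un) (there x∈xs) x∈ys = disjoint xs un x∈xs x∈ys

  Unique-++ʳ : ∀ xs {ys : List A} → Unique (xs ++ ys) → Unique ys
  Unique-++ʳ []       un       = un
  Unique-++ʳ (_ ∷ xs) (_ ∷ un) = Unique-++ʳ xs un

  Unique-↭ : ∀ {xs ys : List A} → xs ↭ ys → Unique xs → Unique ys
  Unique-↭ eq = Unique-resp-↭ (setoid A) (↭⇒↭ₛ eq)

  drop-prefix : ∀ (xs : List A) {ys zs} → xs ++ ys ↭ xs ++ zs → ys ↭ zs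
  drop-prefix []       eq = eq
  drop-prefix (x ∷ xs) eq = drop-prefix xs (Perm.drop-∷ eq)

-- The class of a job is 0, 1 or 2 if it is processed before, in or after the
-- renting period, respectively.
Okay : ∀ {A : Set} → (A → ℕ) → ℕ → (A → ℕ) → A → Set
Okay r c f x = f x ≡ 1 ⊎ (f x ≡ c × r x ≡ 0)

-- The first decision is whether a job is in the renting period, the second whether its ratio is at
-- least that of the block.
classify : ∀ {P Q : Set} → Dec P → Dec Q → ℕ
classify (yes _) _       = 1
classify (no _)  (yes _) = 0
classify (no _)  (no _)  = 2

module Normalise {A : Set} (_≟ᴬ_ : DecidableEquality A) (p w r : A → ℕ) (p>0 : ∀ x → 0 < p x) where

  open Smith p w
  open import Data.List.Membership.DecPropositional _≟ᴬ_ using () renaming (_∈?_ to _∈ᴬ?_)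

  record Normal (js before during after : List A) : Set where
    field
      class           : A → ℕ
      front back      : List A
      js≡             : js ≡ front ++ back
      okay-front      : All (Okay r 0 class) front
      okay-back       : All (Okay r 2 class) back
      during≡         : total p (select class 1 js) ≡ total p during
      cost≤           : cost 0 (arrange class js) ≤ cost 0 (before ++ during ++ after)

  -- The block keeps its set of jobs, hence its length. By Smith's rule with the composite job, the
  -- other jobs go before or after the block according to their ratios, and each of the three parts
  -- can be sorted. As `js` is sorted by ratio, the jobs that may precede the block come from a
  -- prefix of it.
  normalise : ∀ {js before during after} → AllPairs _≼_ js → Unique js →
    before ++ during ++ after ↭ js → 0 < total p during →
    All (λ x → r x ≡ 0) before → All (λ x → r x ≡ 0) after →
    Normal js before during after
  normalise {js} {before} {during} {after} sorted un perm 0<P r-before r-after =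
    let front , back , js≡ , good , bad = split js sorted in record
      { class      = class
      ; front      = front
      ; back       = back
      ; js≡        = js≡
      ; okay-front = All.tabulate λ {x} x∈ → okay-good x (∈js js≡ (∈-++⁺ˡ x∈)) (All.lookup good x∈)
      ; okay-back  = All.tabulate λ {x} x∈ → okay-bad x (∈js js≡ (∈-++⁺ʳ front x∈)) (All.lookup bad x∈)
      ; during≡    = total-↭ p during*↭
      -- Old and new block have the same length and weight, hence the same correction `W * P`. The
      -- order around the block and the order inside it can then be improved separately.
      ; cost≤      = +-cancelʳ-≤ (W * P) _ _ (begin
          cost 0 (arrange class js) + W * P
            ≡⟨ cost-block 0 before* during* after* (total-↭ p during*↭) (total-↭ w during*↭) ⟩
          cost⁺ 0 (around before* after*) + cost 0 during*
            ≤⟨ +-mono-≤ (smith⁺ 0 around-sorted around-↭)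
                 (smith 0 (AllPairs.filter⁺ _ sorted) during*↭) ⟩
          cost⁺ 0 (around before after) + cost 0 during
            ≡⟨ sym (cost-block 0 before during after refl refl) ⟩
          cost 0 (before ++ during ++ after) + W * P ∎)
      }
    where
    open ≤-Reasoning

    P = total p during
    W = total w during
    open Block p w P W

    good? : ∀ x → Dec (just x ≼⁺ nothing)
    good? x = W * p x ≤? w x * P

    class : A → ℕ
    class x = classify (x ∈ᴬ? during) (good? x)

    unique : Unique (before ++ during ++ after)
    unique = Unique-↭ (↭-sym perm) un

    ∈js : ∀ {xs x} → js ≡ xs → x ∈ xs → x ∈ before ++ during ++ after
    ∈js refl x∈ = Perm.∈-resp-↭ (↭-sym perm) x∈

    r-outside : ∀ x → x ∈ before ++ during ++ after → x ∉ during → r x ≡ 0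
    r-outside x x∈ x∉ with ∈-++⁻ before x∈
    ... | inj₁ x∈before = All.lookup r-before x∈before
    ... | inj₂ x∈rest with ∈-++⁻ during x∈rest
    ...   | inj₁ x∈during = contradiction x∈during x∉
    ...   | inj₂ x∈after  = All.lookup r-after x∈after

    okay-good : ∀ x → x ∈ before ++ during ++ after → just x ≼⁺ nothing → Okay r 0 class x
    okay-good x x∈ g with x ∈ᴬ? during | good? x
    ... | yes _  | _     = inj₁ refl
    ... | no x∉  | yes _ = inj₂ (refl , r-outside x x∈ x∉)
    ... | no _   | no ¬g = contradiction g ¬g

    okay-bad : ∀ x → x ∈ before ++ during ++ after → ¬ (just x ≼⁺ nothing) → Okay r 2 class x
    okay-bad x x∈ ¬g with x ∈ᴬ? during | good? x
    ... | yes _  | _     = inj₁ refl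
    ... | no x∉  | no _  = inj₂ (refl , r-outside x x∈ x∉)
    ... | no _   | yes g = contradiction g ¬g

    class≤2 : ∀ x → class x ≤ 2
    class≤2 x with x ∈ᴬ? during | good? x
    ... | yes _ | _     = s≤s z≤n
    ... | no _  | yes _ = z≤n
    ... | no _  | no _  = ≤-refl

    class-∈ : ∀ {x} → x ∈ during → class x ≡ 1
    class-∈ {x} x∈ with x ∈ᴬ? during
    ... | yes _ = refl
    ... | no x∉ = contradiction x∈ x∉

    class-∉ : ∀ {x} → x ∉ during → class x ≢ 1
    class-∉ {x} x∉ with x ∈ᴬ? during | good? x
    ... | yes x∈ | _     = contradiction x∈ x∉
    ... | no _   | yes _ = λ ()
    ... | no _   | no _  = λ ()

    class-0 : ∀ x → class x ≡ 0 → just x ≼⁺ nothing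
    class-0 x eq with x ∈ᴬ? during | good? x
    class-0 x eq | no _  | yes g = g
    class-0 x () | no _  | no _
    class-0 x () | yes _ | _

    class-2 : ∀ x → class x ≡ 2 → nothing ≼⁺ just x
    class-2 x eq with x ∈ᴬ? during | good? x
    class-2 x eq | no _  | no ¬g = <⇒≤ (≰⇒> ¬g)
    class-2 x () | no _  | yes _
    class-2 x () | yes _ | _

    -- Once the ratio of a job is below that of the block, transitivity puts all later ratios below
    -- it as well.
    split : ∀ xs → AllPairs _≼_ xs → ∃[ front ] ∃[ back ] xs ≡ front ++ back
      × All (λ x → just x ≼⁺ nothing) front × All (λ x → ¬ (just x ≼⁺ nothing)) back
    split []       []        = [] , [] , refl , [] , []
    split (x ∷ xs) (≼s ∷ ps) with good? x
    ... | yes g =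
      let front , back , eq , good , bad = split xs ps
      in x ∷ front , back , cong (x ∷_) eq , g ∷ good , bad
    ... | no ¬g = [] , x ∷ xs , refl , [] ,
      ¬g ∷ All.map (λ {y} x≼y g → ¬g (≼⁺-trans {just x} {just y} {nothing} (p>0 y) x≼y g)) ≼s

    before* during* after* : List A
    before* = select class 0 js
    during* = select class 1 js
    after*  = select class 2 js

    during*↭ : during* ↭ during
    during*↭ = ↭-trans (Perm.filter-↭ _ (↭-sym perm)) (↭-reflexive
      (trans (List.filter-++ _ before (during ++ after))
      (trans (cong₂ _++_
        (List.filter-none _ (All.tabulate λ x∈ →
          class-∉ (λ x∈during → disjoint before unique x∈ (∈-++⁺ˡ x∈during))))
        (trans (List.filter-++ _ during after)
          (cong₂ _++_ (List.filter-all _ (All.tabulate class-∈))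
            (List.filter-none _ (All.tabulate λ x∈ →
              class-∉ (λ x∈during → disjoint during (Unique-++ʳ before unique) x∈during x∈))))))
        (List.++-identityʳ during))))

    outside-↭ : before* ++ after* ↭ before ++ after
    outside-↭ = drop-prefix during
      (↭-trans (Perm.++⁺ʳ (before* ++ after*) (↭-sym during*↭))
      (↭-trans (Perm.shifts during* before*)
      (↭-trans (arrange-↭ class (All.universal class≤2 js))
      (↭-trans (↭-sym perm)
        (Perm.shifts before during)))))

    around-shift : ∀ xs zs → around xs zs ↭ nothing ∷ map just (xs ++ zs)
    around-shift xs zs = ↭-trans (Perm.shift nothing (map just xs) (map just zs))
      (↭-reflexive (cong (nothing ∷_) (sym (List.map-++ just xs zs))))

    around-↭ : around before* after* ↭ around before after
    around-↭ = ↭-trans (around-shift before* after*)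
      (↭-trans (prep nothing (Perm.map⁺ just outside-↭)) (↭-sym (around-shift before after)))

    before*≼ : All (λ x → just x ≼⁺ nothing) before*
    before*≼ = All.map (λ {x} → class-0 x) (All.all-filter _ js)

    after*≽ : All (λ x → nothing ≼⁺ just x) after*
    after*≽ = All.map (λ {x} → class-2 x) (All.all-filter _ js)

    -- Jobs on different sides of the block are compared through the composite job as the middle
    -- element; this is where the block must have positive length.
    around-sorted : AllPairs _≼⁺_ (around before* after*)
    around-sorted = AllPairs.++⁺
      (AllPairs.map⁺ (AllPairs.filter⁺ _ sorted))
      (All.map⁺ after*≽ ∷ AllPairs.map⁺ (AllPairs.filter⁺ _ sorted))
      (All.map⁺ (All.map (λ {x} x≼ → x≼ ∷ All.map⁺ (All.map
        (λ {y} ≼y → ≼⁺-trans {just x} {nothing} {just y} 0<P x≼ ≼y) after*≽)) before*≼))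

-- The dynamic program

data Direction : Set where
  forward backward : Direction

-- The term `u ∸ (u ∸ v)` is the minimum of `u` and `v`, written with operations that `Expr` offers.
-- It serves for table entries and for clamping.
∸-minˡ : ∀ {u v} → u ≤ v → u ∸ (u ∸ v) ≡ u
∸-minˡ {u} u≤v = cong (u ∸_) (m≤n⇒m∸n≡0 u≤v)

∸-min-≤ : ∀ u v → u ∸ (u ∸ v) ≤ v
∸-min-≤ u v with ≤-total u v
... | inj₁ u≤v = ≤-trans (m∸n≤m u (u ∸ v)) u≤v
... | inj₂ v≤u = ≤-reflexive (m∸[m∸n]≡n v≤u)

-- A sum below `k` has no room for a positive multiple of `k`. With `k = ∞`, this reads feasibility
-- off a table entry.
no-penalty : ∀ {a z k} → a + k * z < k → z ≡ 0
no-penalty {z = zero}  h = refl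
no-penalty {a} {suc z} {k} h =
  contradiction (≤-trans (m≤m*n k (suc z)) (m≤n+m _ a)) (<⇒≱ h)

module _ {A : Set} (f : A → ℕ) where

  select-reverse : ∀ c xs → select f c (reverse xs) ≡ reverse (select f c xs)
  select-reverse c []       = refl
  select-reverse c (x ∷ xs) rewrite List.unfold-reverse x xs
    | List.filter-++ (λ x → f x ≟ c) (reverse xs) (x ∷ []) | select-reverse c xs
    with f x ≟ c
  ... | yes p rewrite List.filter-accept (λ x → f x ≟ c) {xs = xs} p
                    | List.filter-accept (λ x → f x ≟ c) {xs = []} p =
    sym (List.unfold-reverse x (select f c xs))
  ... | no ¬p rewrite List.filter-reject (λ x → f x ≟ c) {xs = xs} ¬p
                    | List.filter-reject (λ x → f x ≟ c) {xs = []} ¬p =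
    List.++-identityʳ _

  select-++ : ∀ c xs ys → select f c (xs ++ ys) ≡ select f c xs ++ select f c ys
  select-++ c = List.filter-++ (λ x → f x ≟ c)

  select-accept : ∀ {c x} xs → f x ≡ c → select f c (x ∷ xs) ≡ x ∷ select f c xs
  select-accept xs = List.filter-accept (λ x → f x ≟ _) {xs = xs}

  select-reject : ∀ {c x} xs → f x ≢ c → select f c (x ∷ xs) ≡ select f c xs
  select-reject xs = List.filter-reject (λ x → f x ≟ _) {xs = xs}

  module _ (r : A → ℕ) where

    select-none : ∀ {c d xs} → d ≢ 1 → d ≢ c → All (Okay r c f) xs → select f d xs ≡ []
    select-none {c} {d} d≢1 d≢c ok = List.filter-none _ (All.map other ok)
      where
      other : ∀ {x} → Okay r c f x → f x ≢ d
      other (inj₁ eq)       refl = d≢1 eq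
      other (inj₂ (eq , _)) refl = d≢c eq

    total-select : ∀ g {c xs} → c ≢ 1 → All (Okay r c f) xs →
      total g xs ≡ total g (select f 1 xs) + total g (select f c xs)
    total-select g c≢1 [] = refl
    total-select g {c} {x ∷ xs} c≢1 (inj₁ eq ∷ ok)
      rewrite select-accept xs eq | select-reject {c} xs (λ eq′ → c≢1 (trans (sym eq′) eq)) =
      trans (cong (g x +_) (total-select g c≢1 ok)) (sym (+-assoc (g x) _ _))
    total-select g {c} {x ∷ xs} c≢1 (inj₂ (eq , _) ∷ ok)
      rewrite select-accept xs eq | select-reject {1} xs (λ eq′ → c≢1 (trans (sym eq) eq′)) =
      trans (cong (g x +_) (total-select g c≢1 ok))
        (swap (g x) (total g (select f 1 xs)) (total g (select f c xs)))
      where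
      swap : ∀ a b c → a + (b + c) ≡ b + (a + c)
      swap = solve-∀

select-cong : ∀ {A : Set} {f g : A → ℕ} c {xs} → All (λ x → f x ≡ g x) xs → select f c xs ≡ select g c xs
select-cong c [] = refl
select-cong {f = f} {g} c {x ∷ xs} (eq ∷ eqs) with g x ≟ c
... | yes p rewrite select-accept f xs (trans eq p) | select-accept g xs p = cong (x ∷_) (select-cong c eqs)
... | no ¬p rewrite select-reject f xs (λ q → ¬p (trans (sym eq) q)) | select-reject g xs ¬p = select-cong c eqs

-- Both tables assign jobs to two machines, one for the renting period (at
-- time x) and one for the jobs outside it (at time y), where the latter must
-- stop at time P.  In the backward table, time is reversed, so that a job that
-- occupies the reversed interval [x, x + p] is completed at time P ∸ x.
-- Assignments that are not permitted are penalised by ∞ instead of excluded.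
module Table {A : Set} (p w r : A → ℕ) (P ∞ : ℕ) where

  open Smith p w using (cost; cost-++)

  finish : Direction → ℕ → ℕ → ℕ
  finish forward  x q = x + q
  finish backward x q = P ∸ x

  -- Times are cut off at `P` to remain valid table indices. What is looked up after a cut-off does
  -- not matter, as the overrun is penalised by at least `∞`.
  clamp : ℕ → ℕ
  clamp x = x ∸ (x ∸ P)

  -- The recursion is over the jobs still to come, from arbitrary machine times, so that one table
  -- serves all splits. Checking the final `y` suffices, because the total processing time then
  -- determines the final `x`.
  table within outside : Direction → List A → ℕ → ℕ → ℕ
  table d []       x y = ∞ * (P ∸ y)
  table d (j ∷ js) x y = within d (j ∷ js) x y ∸ (within d (j ∷ js) x y ∸ outside d (j ∷ js) x y)
  within d []       x y = 0
  within d (j ∷ js) x y =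
    table d js (clamp (x + p j)) y + w j * finish d x (p j) + ∞ * ((x + p j) ∸ P)
  outside d []       x y = 0
  outside d (j ∷ js) x y =
    table d js x (clamp (y + p j)) + w j * finish d y (p j) + ∞ * (((y + p j) ∸ P) + r j)

  clamp-≤ : ∀ x → clamp x ≤ P
  clamp-≤ x = ∸-min-≤ x P

  clamp-id : ∀ {x} → x ≤ P → clamp x ≡ x
  clamp-id = ∸-minˡ

  along : Direction → ℕ → List A → ℕ
  along d x []       = 0
  along d x (j ∷ js) = w j * finish d x (p j) + along d (x + p j) js

  along-++ : ∀ d x xs ys → along d x (xs ++ ys) ≡ along d x xs + along d (x + total p xs) ys
  along-++ d x []       ys = cong (λ z → along d z ys) (sym (+-identityʳ x))
  along-++ d x (j ∷ xs) ys rewrite along-++ d (x + p j) xs ys | +-assoc x (p j) (total p xs) =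
    sym (+-assoc (w j * finish d x (p j)) _ _)

  along-forward : ∀ x xs → along forward x xs ≡ cost x xs
  along-forward x []       = refl
  along-forward x (j ∷ xs) = cong (w j * (x + p j) +_) (along-forward (x + p j) xs)

  -- The hypothesis says that the reversed interval starting at `x` is the mirror image of the one
  -- starting at `t`. The first job `j` comes last in reversed time, at `x + total p xs`, and the
  -- mirror image of that is `t + p j`.
  along-backward : ∀ t x xs → t + total p xs + x ≡ P → along backward x (reverse xs) ≡ cost t xs
  along-backward t x []       eq = refl
  along-backward t x (j ∷ xs) eq rewrite List.unfold-reverse j xs
    | along-++ backward x (reverse xs) (j ∷ []) | total-reverse p xs
    | along-backward (t + p j) x xs (trans (cong (_+ x) (+-assoc t (p j) (total p xs))) eq) =
    trans (+-comm (cost (t + p j) xs) _)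
      (cong (_+ cost (t + p j) xs) (trans (+-identityʳ _) (cong (w j *_) (begin
        P ∸ (x + total p xs)
          ≡⟨ cong (_∸ (x + total p xs)) (trans (sym eq) (regroup t (p j) (total p xs) x)) ⟩
        t + p j + (x + total p xs) ∸ (x + total p xs)
          ≡⟨ m+n∸n≡m (t + p j) (x + total p xs) ⟩
        t + p j ∎))))
    where
    open ≡-Reasoning
    regroup : ∀ t a b x → t + (a + b) + x ≡ t + a + (x + b)
    regroup = solve-∀

  table-≤-within : ∀ d j js x y → x + p j ≤ P →
    table d (j ∷ js) x y ≤ table d js (x + p j) y + w j * finish d x (p j)
  table-≤-within d j js x y x≤ =
    ≤-trans (m∸n≤m (within d (j ∷ js) x y) (within d (j ∷ js) x y ∸ outside d (j ∷ js) x y)) (≤-reflexive eq)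
    where
    eq : within d (j ∷ js) x y ≡ table d js (x + p j) y + w j * finish d x (p j)
    eq rewrite clamp-id x≤ | m≤n⇒m∸n≡0 x≤ | *-zeroʳ ∞ = +-identityʳ _

  table-≤-outside : ∀ d j js x y → y + p j ≤ P → r j ≡ 0 →
    table d (j ∷ js) x y ≤ table d js x (y + p j) + w j * finish d y (p j)
  table-≤-outside d j js x y y≤ rj =
    ≤-trans (∸-min-≤ (within d (j ∷ js) x y) (outside d (j ∷ js) x y)) (≤-reflexive eq)
    where
    eq : outside d (j ∷ js) x y ≡ table d js x (y + p j) + w j * finish d y (p j)
    eq rewrite clamp-id y≤ | m≤n⇒m∸n≡0 y≤ | rj | *-zeroʳ ∞ = +-identityʳ _

  -- An entry is at most either alternative, in particular the one that `f` takes for the next job.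
  -- The hypotheses make every penalty on that path vanish.
  table-≤ : ∀ d {c f} → c ≢ 1 → ∀ {js x y} → All (Okay r c f) js →
    x + total p (select f 1 js) ≤ P → y + total p (select f c js) ≡ P →
    table d js x y ≤ along d x (select f 1 js) + along d y (select f c js)
  table-≤ d c≢1 {[]} {x} {y} [] x≤ y≡
    rewrite m≤n⇒m∸n≡0 (≤-reflexive (sym (trans (sym (+-identityʳ y)) y≡))) | *-zeroʳ ∞ = z≤n
  table-≤ d {c} {f} c≢1 {j ∷ js} {x} {y} (inj₁ eq ∷ ok) x≤ y≡
    rewrite select-accept f js eq | select-reject f {c} js (λ eq′ → c≢1 (trans (sym eq′) eq)) =
    ≤-trans (table-≤-within d j js x y (≤-trans (+-monoʳ-≤ x (m≤m+n (p j) _)) x≤))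
      (≤-trans (+-monoˡ-≤ _ (table-≤ d c≢1 ok (subst (_≤ P) (sym (+-assoc x (p j) _)) x≤) y≡))
        (≤-reflexive (rotate (along d (x + p j) (select f 1 js)) (along d y (select f c js)) (w j * finish d x (p j)))))
    where
    rotate : ∀ a b c → a + b + c ≡ c + a + b
    rotate = solve-∀
  table-≤ d {c} {f} c≢1 {j ∷ js} {x} {y} (inj₂ (eq , rj) ∷ ok) x≤ y≡
    rewrite select-accept f js eq | select-reject f {1} js (λ eq′ → c≢1 (trans (sym eq) eq′)) =
    ≤-trans (table-≤-outside d j js x y
        (≤-trans (+-monoʳ-≤ y (m≤m+n (p j) _)) (≤-reflexive y≡)) rj)
      (≤-trans (+-monoˡ-≤ _ (table-≤ d c≢1 ok x≤ (trans (+-assoc y (p j) _) y≡)))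
        (≤-reflexive (rotate (along d x (select f 1 js)) (along d (y + p j) (select f c js)) (w j * finish d y (p j)))))
    where
    rotate : ∀ a b c → a + b + c ≡ a + (c + b)
    rotate = solve-∀

  -- The converse direction: the entry is below `∞`, so the alternative that attains the minimum
  -- pays no penalty and its step is feasible.
  within-optimal : ∀ d j js x y → table d (j ∷ js) x y < ∞ →
    within d (j ∷ js) x y ≤ outside d (j ∷ js) x y →
    x + p j ≤ P × table d (j ∷ js) x y ≡ table d js (x + p j) y + w j * finish d x (p j)
  within-optimal d j js x y <∞ u≤v = x≤ , trans (∸-minˡ u≤v) eq
    where
    x≤ : x + p j ≤ P
    x≤ = m∸n≡0⇒m≤n (no-penalty (subst (_< ∞) (∸-minˡ u≤v) <∞))
    eq : within d (j ∷ js) x y ≡ table d js (x + p j) y + w j * finish d x (p j)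
    eq rewrite clamp-id x≤ | m≤n⇒m∸n≡0 x≤ | *-zeroʳ ∞ = +-identityʳ _

  outside-optimal : ∀ d j js x y → table d (j ∷ js) x y < ∞ →
    outside d (j ∷ js) x y < within d (j ∷ js) x y →
    y + p j ≤ P × r j ≡ 0 ×
    table d (j ∷ js) x y ≡ table d js x (y + p j) + w j * finish d y (p j)
  outside-optimal d j js x y <∞ v<u = y≤ , m+n≡0⇒n≡0 _ zero-penalty , trans (m∸[m∸n]≡n (<⇒≤ v<u)) eq
    where
    zero-penalty : ((y + p j) ∸ P) + r j ≡ 0
    zero-penalty = no-penalty (subst (_< ∞) (m∸[m∸n]≡n (<⇒≤ v<u)) <∞)
    y≤ : y + p j ≤ P
    y≤ = m∸n≡0⇒m≤n (m+n≡0⇒m≡0 _ zero-penalty)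
    eq : outside d (j ∷ js) x y ≡ table d js x (y + p j) + w j * finish d y (p j)
    eq rewrite clamp-id y≤ | zero-penalty | *-zeroʳ ∞ = +-identityʳ _

  -- A partial walk along a cheapest path through the table: the jobs seen so
  -- far have been assigned according to f.
  record Walk (d : Direction) (c : ℕ) (js : List A) (x₀ y₀ : ℕ)
              (f : A → ℕ) (rest : List A) (x y : ℕ) : Set where
    field
      seen  : List A
      js≡   : js ≡ seen ++ rest
      okay  : All (Okay r c f) seen
      x≡    : x ≡ x₀ + total p (select f 1 seen)
      y≡    : y ≡ y₀ + total p (select f c seen)
      x≤P   : x ≤ P
      y≤P   : y ≤ P
      cost≡ : along d x₀ (select f 1 seen) + along d y₀ (select f c seen) + table d rest x y
                ≡ table d js x₀ y₀

  walk-start : ∀ {d c js x₀ y₀ f} → x₀ ≤ P → y₀ ≤ P → Walk d c js x₀ y₀ f js x₀ y₀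
  walk-start {x₀ = x₀} {y₀} x≤ y≤ = record
    { seen = [] ; js≡ = refl ; okay = [] ; x≡ = sym (+-identityʳ x₀) ; y≡ = sym (+-identityʳ y₀)
    ; x≤P = x≤ ; y≤P = y≤ ; cost≡ = refl }

  walk-<∞ : ∀ {d c js x₀ y₀ f rest x y} → table d js x₀ y₀ < ∞ →
    Walk d c js x₀ y₀ f rest x y → table d rest x y < ∞
  walk-<∞ <∞ walk = ≤-<-trans (m≤n+m _ _) (subst (_< ∞) (sym (Walk.cost≡ walk)) <∞)

  module _ {d : Direction} {c : ℕ} {js : List A} {x₀ y₀ : ℕ} {j : A} {rest : List A} {x y : ℕ}
           {f g : A → ℕ} (c≢1 : c ≢ 1)
           (un : Unique js) (<∞ : table d js x₀ y₀ < ∞)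
           (walk : Walk d c js x₀ y₀ f (j ∷ rest) x y)
           (g≡f : ∀ i → i ≢ j → g i ≡ f i) where

    open Walk walk

    private
      same : All (λ i → g i ≡ f i) seen
      same = All.tabulate λ {i} i∈ → g≡f i λ { refl →
        disjoint seen (subst Unique js≡ un) i∈ (here refl) }

      okay′ : All (Okay r c g) seen
      okay′ = All.zipWith (λ (eq , ok) →
        [ (λ e → inj₁ (trans eq e)) , (λ (e , z) → inj₂ (trans eq e , z)) ]′ ok) (same , okay)

      js≡′ : js ≡ (seen ∷ʳ j) ++ rest
      js≡′ = trans js≡ (sym (List.++-assoc seen (j ∷ []) rest))

      extend : ∀ {b} → g j ≡ b → select g b (seen ∷ʳ j) ≡ select f b seen ∷ʳ j
      extend {b} eq = trans (select-++ g b seen (j ∷ []))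
        (cong₂ _++_ (select-cong b same) (select-accept g [] eq))

      keep : ∀ {b} → g j ≢ b → select g b (seen ∷ʳ j) ≡ select f b seen
      keep {b} neq = trans (select-++ g b seen (j ∷ []))
        (trans (cong₂ _++_ (select-cong b same) (select-reject g [] neq)) (List.++-identityʳ _))

      total-∷ʳ : ∀ z xs → z + total p xs + p j ≡ z + total p (xs ∷ʳ j)
      total-∷ʳ z xs rewrite total-++ p xs (j ∷ []) | +-identityʳ (p j) = +-assoc z _ _

    -- Here `g` agrees with `f` except possibly at `j`, as after a single write to the array of
    -- classes. Since jobs occur only once in `js`, the classes of those already seen are
    -- unaffected.
    walk-within : within d (j ∷ rest) x y ≤ outside d (j ∷ rest) x y → g j ≡ 1 →
      Walk d c js x₀ y₀ g rest (x + p j) y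
    walk-within u≤v gj = record
      { seen = seen ∷ʳ j ; js≡ = js≡′ ; okay = All.++⁺ okay′ (inj₁ gj ∷ [])
      ; x≡ = trans (cong (_+ p j) x≡)
               (trans (total-∷ʳ x₀ (select f 1 seen)) (cong (λ xs → x₀ + total p xs) (sym (extend gj))))
      ; y≡ = trans y≡ (cong (λ xs → y₀ + total p xs) (sym (keep gj≢c)))
      ; x≤P = proj₁ opt ; y≤P = y≤P
      ; cost≡ = trans cost-step cost≡ }
      where
      gj≢c : g j ≢ c
      gj≢c eq = c≢1 (trans (sym eq) gj)
      opt = within-optimal d j rest x y (walk-<∞ <∞ walk) u≤v
      cost-step : along d x₀ (select g 1 (seen ∷ʳ j)) + along d y₀ (select g c (seen ∷ʳ j))
          + table d rest (x + p j) y
        ≡ along d x₀ (select f 1 seen) + along d y₀ (select f c seen) + table d (j ∷ rest) x y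
      cost-step rewrite extend gj | keep gj≢c | along-++ d x₀ (select f 1 seen) (j ∷ [])
        | sym x≡ | proj₂ opt =
        shuffle (along d x₀ (select f 1 seen)) (w j * finish d x (p j))
          (along d y₀ (select f c seen)) (table d rest (x + p j) y)
        where
        shuffle : ∀ a b c e → a + (b + 0) + c + e ≡ a + c + (e + b)
        shuffle = solve-∀

    walk-outside : outside d (j ∷ rest) x y < within d (j ∷ rest) x y → g j ≡ c →
      Walk d c js x₀ y₀ g rest x (y + p j)
    walk-outside v<u gj = record
      { seen = seen ∷ʳ j ; js≡ = js≡′ ; okay = All.++⁺ okay′ (inj₂ (gj , proj₁ (proj₂ opt)) ∷ [])
      ; y≡ = trans (cong (_+ p j) y≡)
               (trans (total-∷ʳ y₀ (select f c seen)) (cong (λ xs → y₀ + total p xs) (sym (extend gj))))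
      ; x≡ = trans x≡ (cong (λ xs → x₀ + total p xs) (sym (keep gj≢1)))
      ; x≤P = x≤P ; y≤P = proj₁ opt
      ; cost≡ = trans cost-step cost≡ }
      where
      gj≢1 : g j ≢ 1
      gj≢1 eq = c≢1 (trans (sym gj) eq)
      opt = outside-optimal d j rest x y (walk-<∞ <∞ walk) v<u
      cost-step : along d x₀ (select g 1 (seen ∷ʳ j)) + along d y₀ (select g c (seen ∷ʳ j))
          + table d rest x (y + p j)
        ≡ along d x₀ (select f 1 seen) + along d y₀ (select f c seen) + table d (j ∷ rest) x y
      cost-step rewrite extend gj | keep gj≢1 | along-++ d y₀ (select f c seen) (j ∷ [])
        | sym y≡ | proj₂ (proj₂ opt) =
        shuffle (along d x₀ (select f 1 seen)) (w j * finish d y (p j))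
          (along d y₀ (select f c seen)) (table d rest x (y + p j))
        where
        shuffle : ∀ a b c e → a + (c + (b + 0)) + e ≡ a + c + (e + b)
        shuffle = solve-∀

  record Optimal (d : Direction) (c : ℕ) (js : List A) (x₀ y₀ : ℕ) (f : A → ℕ) : Set where
    field
      okay  : All (Okay r c f) js
      ends  : y₀ + total p (select f c js) ≡ P
      cost≡ : along d x₀ (select f 1 js) + along d y₀ (select f c js) ≡ table d js x₀ y₀

  -- The remaining entry is `∞ * (P ∸ y)`, which is below `∞` only if the outside machine has
  -- reached `P`.
  walk-end : ∀ {d c js x₀ y₀ f x y} → table d js x₀ y₀ < ∞ →
    Walk d c js x₀ y₀ f [] x y → Optimal d c js x₀ y₀ f
  walk-end {d} {c} {js} {x₀} {y₀} {f} {x} {y} <∞ walk = record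
    { okay  = subst (All (Okay r c f)) (sym js≡seen) okay
    ; ends  = trans (cong (λ xs → y₀ + total p (select f c xs)) js≡seen) (trans (sym y≡) y≡P)
    ; cost≡ = trans (cong (λ xs → along d x₀ (select f 1 xs) + along d y₀ (select f c xs)) js≡seen)
        (trans (trans (sym (+-identityʳ _))
          (cong ((along d x₀ (select f 1 seen) + along d y₀ (select f c seen)) +_) (sym end≡0))) cost≡) }
    where
    open Walk walk
    js≡seen : js ≡ seen
    js≡seen = trans js≡ (List.++-identityʳ seen)
    y≡P : y ≡ P
    y≡P = ≤-antisym y≤P (m∸n≡0⇒m≤n (no-penalty {0} (walk-<∞ <∞ walk)))
    end≡0 : ∞ * (P ∸ y) ≡ 0
    end≡0 rewrite y≡P | n∸n≡0 P = *-zeroʳ ∞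

-- Joining the two tables

module Combination {A : Set} (p w r : A → ℕ) (P ∞ : ℕ) where

  open Smith p w using (cost; cost-++)
  open Table p w r P ∞

  -- The backward table is entered at the mirror images of `total p front` and `a`. An end of the
  -- renting period after `P` is penalised too, so that every `a` up to `P` can be tried with every
  -- `e`.
  combined : List A → List A → ℕ → ℕ → ℕ
  combined front back a e =
    table backward (reverse front) (P ∸ total p front) (P ∸ a)
      + table forward back (total p front) (clamp (a + e)) + ∞ * ((a + e) ∸ P)

  combined-unpenalised : ∀ front back a e → a + e ≤ P → combined front back a e ≡
    table backward (reverse front) (P ∸ total p front) (P ∸ a) + table forward back (total p front) (a + e)
  combined-unpenalised front back a e a+e≤P rewrite clamp-id a+e≤P | m≤n⇒m∸n≡0 a+e≤P | *-zeroʳ ∞ = +-identityʳ _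

  All-reverse : ∀ {Q : A → Set} {xs} → All Q xs → All Q (reverse xs)
  All-reverse = Perm.All-resp-↭ (↭-sym (Perm.↭-reverse _))

  module _ {front back : List A} {f : A → ℕ}
           (okF : All (Okay r 0 f) front) (okB : All (Okay r 2 f) back)
           (P≡ : total p (front ++ back) ≡ P) where

    private
      js before m₁ m₂ after : List A
      js     = front ++ back
      before = select f 0 front
      m₁     = select f 1 front
      m₂     = select f 1 back
      after  = select f 2 back

      a e Q : ℕ
      a = total p before
      e = total p (select f 1 js)
      Q = total p front

      arrange≡ : arrange f js ≡ before ++ (m₁ ++ m₂) ++ after
      arrange≡
        rewrite select-++ f 0 front back | select-++ f 1 front back | select-++ f 2 front back
          | select-none f r {2} {0} (λ ()) (λ ()) okB | select-none f r {0} {2} (λ ()) (λ ()) okF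
          | List.++-identityʳ (select f 0 front) = refl

      Q≡ : Q ≡ a + total p m₁
      Q≡ = trans (total-select f r p (λ ()) okF) (+-comm (total p m₁) a)

      e≡ : e ≡ total p m₁ + total p m₂
      e≡ = trans (cong (total p) (select-++ f 1 front back)) (total-++ p m₁ m₂)

      Q≤P : Q ≤ P
      Q≤P = ≤-trans (m≤m+n Q (total p back)) (≤-reflexive (trans (sym (total-++ p front back)) P≡))

      a≤Q : a ≤ Q
      a≤Q = ≤-trans (m≤m+n a _) (≤-reflexive (sym Q≡))

      a≤P : a ≤ P
      a≤P = ≤-trans a≤Q Q≤P

      parts : a + e + total p after ≡ P
      parts = begin
        a + e + total p after
          ≡⟨ cong (λ z → a + z + total p after) e≡ ⟩
        a + (total p m₁ + total p m₂) + total p after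
          ≡⟨ regroup a (total p m₁) (total p m₂) (total p after) ⟩
        a + total p m₁ + (total p m₂ + total p after)
          ≡⟨ sym (cong₂ _+_ Q≡ (total-select f r p (λ ()) okB)) ⟩
        Q + total p back
          ≡⟨ sym (total-++ p front back) ⟩
        total p js
          ≡⟨ P≡ ⟩
        P ∎
        where
        open ≡-Reasoning
        regroup : ∀ a b c d → a + (b + c) + d ≡ a + b + (c + d)
        regroup = solve-∀

      before-cost : along backward (P ∸ a) (select f 0 (reverse front)) ≡ cost 0 before
      before-cost rewrite select-reverse f 0 front = along-backward 0 (P ∸ a) before (m+[n∸m]≡n a≤P)

      m₁-cost : along backward (P ∸ Q) (select f 1 (reverse front)) ≡ cost a m₁
      m₁-cost rewrite select-reverse f 1 front =
        along-backward a (P ∸ Q) m₁ (trans (cong (_+ (P ∸ Q)) (sym Q≡)) (m+[n∸m]≡n Q≤P))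

    -- The jobs of the front in the renting period occupy the time from `a` to `Q`, as `Q` is
    -- `a + total p m₁`. So those of the back start at `Q`, whatever `a` is.
    arrange-cost : cost 0 (arrange f js) ≡
      (along backward (P ∸ Q) (select f 1 (reverse front)) + along backward (P ∸ a) (select f 0 (reverse front)))
      + (along forward Q (select f 1 back) + along forward (a + e) (select f 2 back))
    arrange-cost = begin
      cost 0 (arrange f js)
        ≡⟨ cong (cost 0) arrange≡ ⟩
      cost 0 (before ++ (m₁ ++ m₂) ++ after)
        ≡⟨ cost-++ 0 before _ ⟩
      cost 0 before + cost a ((m₁ ++ m₂) ++ after)
        ≡⟨ cong (cost 0 before +_) (cost-++ a (m₁ ++ m₂) after) ⟩
      cost 0 before + (cost a (m₁ ++ m₂) + cost (a + total p (m₁ ++ m₂)) after)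
        ≡⟨ cong₂ (λ x y → cost 0 before + (x + cost (a + y) after))
             (trans (cost-++ a m₁ m₂) (cong (λ z → cost a m₁ + cost z m₂) (sym Q≡)))
             (cong (total p) (sym (select-++ f 1 front back))) ⟩
      cost 0 before + (cost a m₁ + cost Q m₂ + cost (a + e) after)
        ≡⟨ regroup (cost 0 before) (cost a m₁) (cost Q m₂) (cost (a + e) after) ⟩
      (cost a m₁ + cost 0 before) + (cost Q m₂ + cost (a + e) after)
        ≡⟨ sym (cong₂ _+_ (cong₂ _+_ m₁-cost before-cost)
             (cong₂ _+_ (along-forward Q m₂) (along-forward (a + e) after))) ⟩
      _ ∎
      where
      open ≡-Reasoning
      regroup : ∀ a b c d → a + (b + c + d) ≡ (b + a) + (c + d)
      regroup = solve-∀

    combined-≤ : combined front back a e ≤ cost 0 (arrange f js) × a ≤ P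
    combined-≤ = (begin
      combined front back a e
        ≡⟨ combined-unpenalised front back a e a+e≤P ⟩
      table backward (reverse front) (P ∸ Q) (P ∸ a) + table forward back Q (a + e)
        ≤⟨ +-mono-≤ (table-≤ backward {0} {f} (λ ()) (All-reverse okF) back≤ back≡)
                    (table-≤ forward {2} {f} (λ ()) okB forth≤ parts) ⟩
      (along backward (P ∸ Q) (select f 1 (reverse front)) + along backward (P ∸ a) (select f 0 (reverse front)))
      + (along forward Q (select f 1 back) + along forward (a + e) (select f 2 back))
        ≡⟨ sym arrange-cost ⟩
      cost 0 (arrange f js) ∎) , a≤P
      where
      open ≤-Reasoning
      a+e≤P : a + e ≤ P
      a+e≤P = ≤-trans (m≤m+n (a + e) _) (≤-reflexive parts)
      back≡ : P ∸ a + total p (select f 0 (reverse front)) ≡ P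
      back≡ rewrite select-reverse f 0 front | total-reverse p before = m∸n+n≡m a≤P
      back≤ : P ∸ Q + total p (select f 1 (reverse front)) ≤ P
      back≤ rewrite select-reverse f 1 front | total-reverse p m₁ =
        ≤-trans (+-monoʳ-≤ (P ∸ Q) (≤-trans (m≤n+m _ a) (≤-reflexive (sym Q≡)))) (≤-reflexive (m∸n+n≡m Q≤P))
      forth≤ : Q + total p m₂ ≤ P
      forth≤ = ≤-trans (+-monoʳ-≤ Q (≤-trans (m≤m+n _ (total p after))
        (≤-reflexive (sym (total-select f r p (λ ()) okB)))))
        (≤-reflexive (trans (sym (total-++ p front back)) P≡))

    -- Both outside machines end at `P`. In reversed time this forces `a′` to be the total time
    -- before the renting period; in forward time it forces `a′ + e′` to be the end of that period,
    -- so `e′` is its length.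
    combined-optimal : ∀ {a′ e′} → a′ ≤ P →
      Optimal backward 0 (reverse front) (P ∸ Q) (P ∸ a′) f →
      Optimal forward 2 back Q (a′ + e′) f →
      e ≡ e′ × cost 0 (arrange f js) ≡
        table backward (reverse front) (P ∸ Q) (P ∸ a′) + table forward back Q (a′ + e′)
    combined-optimal {a′} {e′} a′≤P optB optF with a′≡ | e′≡
      where
      a′≡ : a′ ≡ a
      a′≡ = +-cancelˡ-≡ (P ∸ a′) a′ a (trans (m∸n+n≡m a′≤P)
        (trans (sym (Optimal.ends optB)) (cong (P ∸ a′ +_)
          (trans (cong (total p) (select-reverse f 0 front)) (total-reverse p before)))))
      e′≡ : e′ ≡ e
      e′≡ = +-cancelˡ-≡ a e′ e (trans (cong (_+ e′) (sym a′≡))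
        (+-cancelʳ-≡ (total p after) (a′ + e′) (a + e) (trans (Optimal.ends optF) (sym parts))))
    ... | refl | refl = refl , trans arrange-cost (cong₂ _+_ (Optimal.cost≡ optB) (Optimal.cost≡ optF))

-- Sequences, Smith's order and the Pareto front

module Sequences (I : Instance) where

  open Instance I
  open Smith p w public

  rent : Fin n → ℕ
  rent j = if does (j ∈? rJobs) then 1 else 0

  rent-∈ : ∀ {j} → j ∈ˢ rJobs → rent j ≢ 0
  rent-∈ {j} j∈ with j ∈? rJobs
  ... | yes _ = λ ()
  ... | no j∉ = contradiction j∈ j∉

  rent-∉ : ∀ {j} → rent j ≢ 0 → j ∈ˢ rJobs
  rent-∉ {j} neq with j ∈? rJobs
  ... | yes j∈ = j∈
  ... | no _   = contradiction refl neq

  Free : List (Fin n) → Set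
  Free = All (λ j → rent j ≡ 0)

  unique : ∀ σ → Unique (jobs σ)
  unique (_ , perm) = Unique-↭ (↭-sym perm) (allFin⁺ n)

  ∈-jobs : ∀ σ j → j ∈ jobs σ
  ∈-jobs (_ , perm) j = Perm.∈-resp-↭ (↭-sym perm) (∈-allFin j)

  total-jobs : ∀ σ → total p (jobs σ) ≡ P
  total-jobs (_ , perm) = total-↭ p perm

  completionIn-head : ∀ j js → completionIn (j ∷ js) j ≡ p j
  completionIn-head j js with j Fin.≟ j
  ... | yes _ = +-identityʳ (p j)
  ... | no j≢j = contradiction refl j≢j

  completionIn-tail : ∀ {i j} js → i ≢ j → completionIn (i ∷ js) j ≡ p i + completionIn js j
  completionIn-tail {i} {j} js i≢j with i Fin.≟ j
  ... | yes i≡j = contradiction i≡j i≢j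
  ... | no _    = refl

  completionIn-split : ∀ xs {j} ys → Unique (xs ++ j ∷ ys) → completionIn (xs ++ j ∷ ys) j ≡ total p xs + p j
  completionIn-split []       ys un         = completionIn-head _ ys
  completionIn-split (x ∷ xs) ys (x∉ ∷ un) =
    trans (completionIn-tail (xs ++ _ ∷ ys) (All.lookup x∉ (∈-++⁺ʳ xs (here refl))))
      (trans (cong (p x +_) (completionIn-split xs ys un)) (sym (+-assoc (p x) _ _)))

  total-cong : ∀ {f g : Fin n → ℕ} {js} → All (λ j → f j ≡ g j) js → total f js ≡ total g js
  total-cong []         = refl
  total-cong (eq ∷ eqs) = cong₂ _+_ eq (total-cong eqs)

  total-completions : ∀ t js → Unique js → total (λ j → w j * (t + completionIn js j)) js ≡ cost t js
  total-completions t []       un        = refl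
  total-completions t (i ∷ js) (i∉ ∷ un) = cong₂ _+_
    (cong (λ x → w i * (t + x)) (completionIn-head i js))
    (trans (total-cong (All.map (λ {j} i≢j → cong (w j *_)
        (trans (cong (t +_) (completionIn-tail js i≢j)) (sym (+-assoc t (p i) _)))) i∉))
      (total-completions (t + p i) js un))

  ∑wC-cost : ∀ σ → ∑wC σ ≡ cost 0 (jobs σ)
  ∑wC-cost σ@(js , perm) =
    trans (total-↭ (λ j → w j * C σ j) (↭-sym perm)) (total-completions 0 js (unique σ))

  -- All r-jobs lie in `during`. The inequality can be strict, since `during` may begin or end with
  -- other jobs.
  er-≤ : ∀ σ before during after → jobs σ ≡ before ++ during ++ after →
    Free before → Free after → er σ ≤ total p during
  er-≤ σ before during after eq free-before free-after = begin
    er σ ≤⟨ ∸-mono (max≤v⁺ z≤n (All.map⁺ (All.tabulate λ j∈ → proj₁ (bounds (r-job j∈)))))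
             (v≤min⁺ before≤P (All.map⁺ (All.tabulate λ j∈ → proj₂ (bounds (r-job j∈))))) ⟩
    (total p before + total p during) ∸ total p before ≡⟨ m+n∸m≡n (total p before) _ ⟩
    total p during ∎
    where
    open ≤-Reasoning
    r-job : ∀ {j} → j ∈ rJobList → rent j ≢ 0
    r-job j∈ = rent-∈ (proj₂ (∈-filter⁻ (_∈? rJobs) {xs = allFin n} j∈))

    before≤P : total p before ≤ P
    before≤P = ≤-trans (m≤m+n _ _) (≤-reflexive
      (trans (sym (total-++ p before (during ++ after))) (trans (cong (total p) (sym eq)) (total-jobs σ))))

    ∈-during : ∀ {j} → rent j ≢ 0 → j ∈ during
    ∈-during {j} r with ∈-++⁻ before (subst (j ∈_) eq (∈-jobs σ j))
    ... | inj₁ j∈ = contradiction (All.lookup free-before j∈) r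
    ... | inj₂ j∈ with ∈-++⁻ during j∈
    ...   | inj₁ j∈′ = j∈′
    ...   | inj₂ j∈′ = contradiction (All.lookup free-after j∈′) r

    bounds : ∀ {j} → rent j ≢ 0 → C σ j ≤ total p before + total p during × total p before ≤ C σ j ∸ p j
    bounds {j} r with xs , ys , during≡ ← ∈-∃++ (∈-during r) =
      ≤-trans (≤-reflexive C≡) (≤-trans (≤-reflexive (+-assoc (total p before) (total p xs) (p j)))
        (+-monoʳ-≤ (total p before) (≤-trans (+-monoʳ-≤ (total p xs) (m≤m+n (p j) (total p ys)))
          (≤-reflexive (sym (trans (cong (total p) during≡) (total-++ p xs (j ∷ ys)))))))) ,
      ≤-trans (m≤m+n (total p before) (total p xs))
        (≤-reflexive (sym (trans (cong (_∸ p j) C≡) (m+n∸n≡m _ (p j)))))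
      where
      js≡ : jobs σ ≡ (before ++ xs) ++ j ∷ (ys ++ after)
      js≡ = trans eq (trans (cong (before ++_) (trans (cong (_++ after) during≡) (List.++-assoc xs (j ∷ ys) after)))
        (sym (List.++-assoc before xs _)))
      C≡ : C σ j ≡ total p before + total p xs + p j
      C≡ = trans (cong (λ js → completionIn js j) js≡)
        (trans (completionIn-split (before ++ xs) (ys ++ after) (subst Unique js≡ (unique σ)))
          (cong (_+ p j) (total-++ p before xs)))

  first-r : ∀ js → Free js ⊎
    (∃[ xs ] ∃[ j ] ∃[ ys ] js ≡ xs ++ j ∷ ys × Free xs × rent j ≢ 0)
  first-r []       = inj₁ []
  first-r (j ∷ js) with rent j ≟ 0
  ... | no r    = inj₂ ([] , j , js , refl , [] , r)
  ... | yes r≡0 with first-r js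
  ...   | inj₁ free                            = inj₁ (r≡0 ∷ free)
  ...   | inj₂ (xs , k , ys , eq , free , r) = inj₂ (j ∷ xs , k , ys , cong (j ∷_) eq , r≡0 ∷ free , r)

  last-r : ∀ js → Free js ⊎
    (∃[ xs ] ∃[ j ] ∃[ ys ] js ≡ xs ++ j ∷ ys × Free ys × rent j ≢ 0)
  last-r []       = inj₁ []
  last-r (j ∷ js) with last-r js
  ... | inj₂ (xs , k , ys , eq , free , r) = inj₂ (j ∷ xs , k , ys , cong (j ∷_) eq , free , r)
  ... | inj₁ free with rent j ≟ 0
  ...   | no r    = inj₂ ([] , j , js , refl , free , r)
  ...   | yes r≡0 = inj₁ (r≡0 ∷ free)

  completion-≤ : ∀ σ {j} → rent j ≢ 0 → C σ j ≤ max 0 (map (C σ) rJobList)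
  completion-≤ σ {j} r = All.lookup (All.map⁻ (xs≤max 0 (map (C σ) rJobList)))
    (∈-filter⁺ (_∈? rJobs) (∈-allFin j) (rent-∉ r))

  start-≥ : ∀ σ {j} → rent j ≢ 0 → min P (map (λ j → C σ j ∸ p j) rJobList) ≤ C σ j ∸ p j
  start-≥ σ {j} r = All.lookup (All.map⁻ (min≤xs P (map (λ j → C σ j ∸ p j) rJobList)))
    (∈-filter⁺ (_∈? rJobs) (∈-allFin j) (rent-∉ r))

  -- Cut before the first and after the last r-job. The start of the former bounds the minimum in
  -- `er` from above, the completion of the latter bounds the maximum from below.
  er-decompose : ∀ σ → ∃[ before ] ∃[ during ] ∃[ after ]
    jobs σ ≡ before ++ during ++ after × Free before × Free after
    × 0 < total p during × total p during ≤ er σ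
  er-decompose σ with first-r (jobs σ)
  ... | inj₁ free = contradiction (All.lookup free (∈-jobs σ (proj₁ rJobs-nonempty)))
    (rent-∈ {proj₁ rJobs-nonempty} (proj₂ rJobs-nonempty))
  -- The first r-job `j` is included in the search for the last one, because it may be the only one.
  ... | inj₂ (xs , j , ys , eq , free-xs , rj) with last-r (j ∷ ys)
  ...   | inj₁ (r≡0 ∷ _) = contradiction r≡0 rj
  ...   | inj₂ (us , k , zs , eq′ , free-zs , rk) =
    xs , us ∷ʳ k , zs , js≡ , free-xs , free-zs ,
    ≤-trans (p-positive k) (≤-trans (m≤n+m (p k) (total p us)) (≤-reflexive during≡)) ,
    (begin
      total p (us ∷ʳ k)
        ≡⟨ sym (m+n∸m≡n (total p xs) _) ⟩
      (total p xs + total p (us ∷ʳ k)) ∸ total p xs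
        ≡⟨ sym (cong₂ _∸_ Ck Cj) ⟩
      C σ k ∸ (C σ j ∸ p j)
        ≤⟨ ∸-mono (completion-≤ σ rk) (start-≥ σ rj) ⟩
      er σ ∎)
    where
    open ≤-Reasoning
    during≡ : total p us + p k ≡ total p (us ∷ʳ k)
    during≡ rewrite total-++ p us (k ∷ []) = cong (total p us +_) (sym (+-identityʳ (p k)))
    js≡ : jobs σ ≡ xs ++ (us ∷ʳ k) ++ zs
    js≡ = trans eq (cong (xs ++_) (trans eq′ (sym (List.++-assoc us (k ∷ []) zs))))
    js≡k : jobs σ ≡ (xs ++ us) ++ k ∷ zs
    js≡k = trans eq (trans (cong (xs ++_) eq′) (sym (List.++-assoc xs us (k ∷ zs))))
    Cj : C σ j ∸ p j ≡ total p xs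
    Cj = trans (cong (_∸ p j) (trans (cong (λ js → completionIn js j) eq)
      (completionIn-split xs ys (subst Unique eq (unique σ))))) (m+n∸n≡m (total p xs) (p j))
    Ck : C σ k ≡ total p xs + total p (us ∷ʳ k)
    Ck = trans (cong (λ js → completionIn js k) js≡k)
      (trans (completionIn-split (xs ++ us) zs (subst Unique js≡k (unique σ)))
        (trans (cong (_+ p k) (total-++ p xs us))
          (trans (+-assoc (total p xs) _ _) (cong (total p xs +_) during≡))))

  -- All completion times are at most `P`, so this exceeds every value of `∑wC` by at least 1.
  ∞ : ℕ
  ∞ = 1 + total w (allFin n) * P

  ∑wC-<∞ : ∀ σ → ∑wC σ < ∞
  ∑wC-<∞ σ@(js , perm) = s≤s (≤-trans (≤-reflexive (∑wC-cost σ)) (≤-trans (cost-≤ 0 js)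
    (≤-reflexive (cong₂ _*_ (total-↭ w perm) (total-jobs σ)))))

  er-≤P : ∀ σ → er σ ≤ P
  er-≤P σ = ≤-trans (er-≤ σ [] (jobs σ) [] (sym (List.++-identityʳ _)) [] [])
    (≤-reflexive (total-jobs σ))

-- Numbers `a * n + x` with a last digit below `n` compare like pairs. This serves both the
-- tie-breaking keys and the addresses of table entries.
lex-cases : ∀ n {a b x y} → y < n → a * n + x < b * n + y → a < b ⊎ (a ≡ b × x < y)
lex-cases n {a} {b} {x} {y} y<n h with <-cmp a b
... | tri< a<b _ _ = inj₁ a<b
... | tri≈ _ refl _ = inj₂ (refl , +-cancelˡ-< (a * n) x y h)
... | tri> _ _ b<a = contradiction h (≤⇒≯ (begin
    b * n + y ≤⟨ +-monoʳ-≤ (b * n) (<⇒≤ y<n) ⟩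
    b * n + n ≡⟨ +-comm (b * n) n ⟩
    suc b * n ≤⟨ *-monoˡ-≤ n b<a ⟩
    a * n     ≤⟨ m≤m+n (a * n) x ⟩
    a * n + x ∎))
  where open ≤-Reasoning

lex-< : ∀ n {a b x y} → x < n → a < b → a * n + x < b * n + y
lex-< n {a} {b} {x} {y} x<n a<b = begin-strict
  a * n + x <⟨ +-monoʳ-< (a * n) x<n ⟩
  a * n + n ≡⟨ +-comm (a * n) n ⟩
  suc a * n ≤⟨ *-monoˡ-≤ n a<b ⟩
  b * n     ≤⟨ m≤m+n (b * n) y ⟩
  b * n + y ∎
  where open ≤-Reasoning

lex-injective : ∀ n {a b x y} → x < n → y < n → a * n + x ≡ b * n + y → a ≡ b × x ≡ y
lex-injective n {a} {b} {x} {y} x<n y<n eq with <-cmp a b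
... | tri< a<b _ _  = contradiction eq (<⇒≢ (lex-< n x<n a<b))
... | tri≈ _ refl _ = refl , +-cancelˡ-≡ (a * n) x y eq
... | tri> _ _ b<a  = contradiction (sym eq) (<⇒≢ (lex-< n y<n b<a))

tabulate-split : ∀ {A : Set} {n} (f : Fin n → A) xs {x ys} → tabulate f ≡ xs ++ x ∷ ys →
  ∃[ i ] toℕ i ≡ length xs × f i ≡ x
tabulate-split {n = suc n} f []       refl = zero , refl , refl
tabulate-split {n = suc n} f (_ ∷ xs) eq   =
  let i , i≡ , fi = tabulate-split (λ i → f (suc i)) xs (List.∷-injectiveʳ eq)
  in suc i , cong suc i≡ , fi

allFin-split : ∀ {n} xs {j : Fin n} {ys} → allFin n ≡ xs ++ j ∷ ys → toℕ j ≡ length xs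
allFin-split xs eq with tabulate-split id xs eq
... | i , i≡ , refl = i≡

-- Smith's order as a strict total order, and ranks in it

module RatioOrder (I : Instance) where

  open Instance I
  open Sequences I

  -- Comparing key i j with key j i compares the ratios, and breaks ties by index.
  key : Fin n → Fin n → ℕ
  key i j = w j * p i * n + toℕ i

  infix 4 _≺_
  _≺_ : Fin n → Fin n → Set
  i ≺ j = key i j < key j i

  ≺⇒≼ : ∀ {i j} → i ≺ j → i ≼ j
  ≺⇒≼ {i} {j} h with lex-cases n (Fin.toℕ<n j) h
  ... | inj₁ lt       = <⇒≤ lt
  ... | inj₂ (eq , _) = ≤-reflexive eq

  <-≤-ratio : ∀ {i j k} → w j * p i < w i * p j → w k * p j ≤ w j * p k → w k * p i < w i * p k
  <-≤-ratio {i} {j} {k} ij jk = *-cancelʳ-< (p j) _ _ (begin-strict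
    w k * p i * p j ≡⟨ swap (w k) (p i) (p j) ⟩
    w k * p j * p i ≤⟨ *-monoˡ-≤ (p i) jk ⟩
    w j * p k * p i ≡⟨ swap (w j) (p k) (p i) ⟩
    w j * p i * p k <⟨ *-monoˡ-< (p k) {{>-nonZero (p-positive k)}} ij ⟩
    w i * p j * p k ≡⟨ swap (w i) (p j) (p k) ⟩
    w i * p k * p j ∎)
    where
    open ≤-Reasoning
    swap : ∀ a b c → a * b * c ≡ a * c * b
    swap = solve-∀

  ≤-<-ratio : ∀ {i j k} → w j * p i ≤ w i * p j → w k * p j < w j * p k → w k * p i < w i * p k
  ≤-<-ratio {i} {j} {k} ij jk = *-cancelʳ-< (p j) _ _ (begin-strict
    w k * p i * p j ≡⟨ swap (w k) (p i) (p j) ⟩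
    w k * p j * p i <⟨ *-monoˡ-< (p i) {{>-nonZero (p-positive i)}} jk ⟩
    w j * p k * p i ≡⟨ swap (w j) (p k) (p i) ⟩
    w j * p i * p k ≤⟨ *-monoˡ-≤ (p k) ij ⟩
    w i * p j * p k ≡⟨ swap (w i) (p j) (p k) ⟩
    w i * p k * p j ∎)
    where
    open ≤-Reasoning
    swap : ∀ a b c → a * b * c ≡ a * c * b
    swap = solve-∀

  ≺-trans : ∀ {i j k} → i ≺ j → j ≺ k → i ≺ k
  ≺-trans {i} {j} {k} ij jk with lex-cases n (Fin.toℕ<n j) ij | lex-cases n (Fin.toℕ<n k) jk
  ... | inj₁ lt        | _              = lex-< n (Fin.toℕ<n i) (<-≤-ratio {i} {j} {k} lt (≺⇒≼ jk))
  ... | inj₂ _         | inj₁ lt        = lex-< n (Fin.toℕ<n i) (≤-<-ratio {i} {j} {k} (≺⇒≼ ij) lt)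
  ... | inj₂ (_ , i<j) | inj₂ (_ , j<k) =
    +-mono-≤-< (*-monoˡ-≤ n (≼-trans {i} {j} {k} (p-positive j) (≺⇒≼ ij) (≺⇒≼ jk))) (<-trans i<j j<k)

  ≺-total : ∀ i j → i ≢ j → i ≺ j ⊎ j ≺ i
  ≺-total i j i≢j with <-cmp (key i j) (key j i)
  ... | tri< lt _ _ = inj₁ lt
  ... | tri> _ _ gt = inj₂ gt
  ... | tri≈ _ eq _ = contradiction
    (Fin.toℕ-injective (proj₂ (lex-injective n {w j * p i} {w i * p j} (Fin.toℕ<n i) (Fin.toℕ<n j) eq))) i≢j

  insert : ∀ x ys → All (x ≢_) ys → AllPairs _≺_ ys → ∃[ zs ] zs ↭ x ∷ ys × AllPairs _≺_ zs
  insert x []       x≢       []           = x ∷ [] , ↭-refl , [] ∷ []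
  insert x (y ∷ ys) (x≢y ∷ x≢) (y≺ ∷ sorted) with ≺-total x y x≢y
  ... | inj₁ x≺y = x ∷ y ∷ ys , ↭-refl , (x≺y ∷ All.map (≺-trans x≺y) y≺) ∷ y≺ ∷ sorted
  ... | inj₂ y≺x =
    let zs , perm , sorted′ = insert x ys x≢ sorted
    in y ∷ zs , ↭-trans (prep y perm) (↭-sym (Perm.shift y (x ∷ []) ys)) ,
       Perm.All-resp-↭ (↭-sym perm) (y≺x ∷ y≺) ∷ sorted′

  sort : ∀ xs → Unique xs → ∃[ ys ] ys ↭ xs × AllPairs _≺_ ys
  sort []       []         = [] , ↭-refl , []
  sort (x ∷ xs) (x≢ ∷ un) =
    let ys , perm , sorted   = sort xs un
        zs , perm′ , sorted′ = insert x ys (Perm.All-resp-↭ (↭-sym perm) x≢) sorted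
    in zs , ↭-trans perm′ (prep x perm) , sorted′

  -- This sort is a specification that the program does not execute; the program finds the position
  -- of each job by counting.
  order : List (Fin n)
  order = proj₁ (sort (allFin n) (allFin⁺ n))

  order-↭ : order ↭ allFin n
  order-↭ = proj₁ (proj₂ (sort (allFin n) (allFin⁺ n)))

  order-≺ : AllPairs _≺_ order
  order-≺ = proj₂ (proj₂ (sort (allFin n) (allFin⁺ n)))

  order-unique : Unique order
  order-unique = Unique-↭ (↭-sym order-↭) (allFin⁺ n)

  order-sorted : AllPairs _≼_ order
  order-sorted = AllPairs.map ≺⇒≼ order-≺

  length-order : length order ≡ n
  length-order = trans (Perm.↭-length order-↭) (List.length-tabulate id)

  total-order : total p order ≡ P
  total-order = total-↭ p order-↭

  ahead : Fin n → Fin n → ℕ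
  ahead j i = if key i j <ᵇ key j i then 1 else 0

  rank : Fin n → ℕ
  rank j = total (ahead j) (allFin n)

  ahead-≺ : ∀ {i j} → i ≺ j → ahead j i ≡ 1
  ahead-≺ {i} {j} h rewrite <ᵇ-true (key i j) (key j i) h = refl

  ahead-⊀ : ∀ {i j} → ¬ (i ≺ j) → ahead j i ≡ 0
  ahead-⊀ {i} {j} h rewrite <ᵇ-false (key i j) (key j i) (≮⇒≥ h) = refl

  total-1 : ∀ {f : Fin n → ℕ} {xs} → All (λ x → f x ≡ 1) xs → total f xs ≡ length xs
  total-1 []         = refl
  total-1 (eq ∷ eqs) = cong₂ _+_ eq (total-1 eqs)

  total-0 : ∀ {f : Fin n → ℕ} {xs} → All (λ x → f x ≡ 0) xs → total f xs ≡ 0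
  total-0 []         = refl
  total-0 (eq ∷ eqs) = cong₂ _+_ eq (total-0 eqs)

  AllPairs-before : ∀ xs {y ys} → AllPairs _≺_ (xs ++ y ∷ ys) → All (_≺ y) xs
  AllPairs-before []       ps        = []
  AllPairs-before (x ∷ xs) (x≺ ∷ ps) = All.lookup x≺ (∈-++⁺ʳ xs (here refl)) ∷ AllPairs-before xs ps

  AllPairs-after : ∀ xs {y ys} → AllPairs _≺_ (xs ++ y ∷ ys) → All (y ≺_) ys
  AllPairs-after []       (y≺ ∷ _) = y≺
  AllPairs-after (x ∷ xs) (_ ∷ ps) = AllPairs-after xs ps

  -- The sum that defines the rank may be taken in sorted order, where exactly the jobs in `xs`
  -- contribute 1.
  rank-order : ∀ xs {j ys} → order ≡ xs ++ j ∷ ys → rank j ≡ length xs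
  rank-order xs {j} {ys} eq = begin
    rank j
      ≡⟨ total-↭ (ahead j) (↭-trans (↭-sym order-↭) (↭-reflexive eq)) ⟩
    total (ahead j) (xs ++ j ∷ ys)
      ≡⟨ total-++ (ahead j) xs (j ∷ ys) ⟩
    total (ahead j) xs + (ahead j j + total (ahead j) ys)
      ≡⟨ cong₂ (λ a b → total (ahead j) xs + (a + b)) (ahead-⊀ {j} {j} (<-irrefl refl))
           (total-0 (All.map (λ {i} j≺i → ahead-⊀ {i} {j} (<-asym j≺i)) (AllPairs-after xs sorted))) ⟩
    total (ahead j) xs + 0
      ≡⟨ +-identityʳ _ ⟩
    total (ahead j) xs
      ≡⟨ total-1 (All.map (λ {i} → ahead-≺ {i} {j}) (AllPairs-before xs sorted)) ⟩
    length xs ∎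
    where
    open ≡-Reasoning
    sorted : AllPairs _≺_ (xs ++ j ∷ ys)
    sorted = subst (AllPairs _≺_) eq order-≺

  rank-injective : ∀ i j → rank i ≡ rank j → i ≡ j
  rank-injective i j eq = same (split i) (split j)
    where
    split : ∀ i → ∃[ xs ] ∃[ ys ] order ≡ xs ++ i ∷ ys
    split i = ∈-∃++ (Perm.∈-resp-↭ (↭-sym order-↭) (∈-allFin i))

    prefix : ∀ xs xs′ {x x′ ys ys′} → length xs ≡ length xs′ →
      xs ++ x ∷ ys ≡ xs′ ++ x′ ∷ ys′ → x ≡ x′
    prefix []       []         _  refl = refl
    prefix (_ ∷ xs) (_ ∷ xs′) l  e    = prefix xs xs′ (suc-injective l) (List.∷-injectiveʳ e)

    same : (∃[ xs ] ∃[ ys ] order ≡ xs ++ i ∷ ys) → (∃[ xs ] ∃[ ys ] order ≡ xs ++ j ∷ ys) → i ≡ j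
    same (xs , ys , e) (xs′ , ys′ , e′) =
      prefix xs xs′ (trans (sym (rank-order xs e)) (trans eq (rank-order xs′ e′))) (trans (sym e) e′)

-- Growing the Pareto front by increasing length of the renting period

module Frontiers (I : Instance) where

  open Instance I
  open Sequences I

  -- The Pareto front restricted to sequences with er below e.
  record Frontier (e best : ℕ) (σs : List Sequence) : Set where
    field
      lower    : ∀ σ → er σ < e → best ≤ ∑wC σ
      attained : best < ∞ → ∃[ σ ] ∑wC σ ≤ best × er σ < e
      above    : All (λ σ → best ≤ ∑wC σ) σs
      distinct : Unique (map value σs)
      sound    : All (λ σ → ParetoOptimal I (value σ)) σs
      complete : ∀ σ → ParetoOptimal I (value σ) → er σ < e → value σ ∈ map value σs

  frontier-start : Frontier 0 ∞ []
  frontier-start = record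
    { lower = λ σ () ; attained = λ h → contradiction h (<-irrefl refl) ; above = []
    ; distinct = [] ; sound = [] ; complete = λ σ po () }

  module _ {e best current : ℕ} {σs : List Sequence} (F : Frontier e best σs)
           (lower-e : ∀ σ → er σ ≡ e → current ≤ ∑wC σ) where

    open Frontier F

    -- A sequence with `er` equal to `e` costs at least `best`, which some sequence with smaller
    -- `er` attains. So it is dominated and adds no Pareto-optimal pair.
    frontier-skip : best ≤ current → Frontier (suc e) best σs
    frontier-skip best≤ = record
      { lower = lower′
      ; attained = λ h → let σ , f≤ , e< = attained h in σ , f≤ , m<n⇒m<1+n e<
      ; above = above ; distinct = distinct ; sound = sound
      ; complete = complete′ }
      where
      lower′ : ∀ σ → er σ < suc e → best ≤ ∑wC σ
      lower′ σ (s≤s er≤) with m≤n⇒m<n∨m≡n er≤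
      ... | inj₁ er<  = lower σ er<
      ... | inj₂ refl = ≤-trans best≤ (lower-e σ refl)

      complete′ : ∀ σ → ParetoOptimal I (value σ) → er σ < suc e → value σ ∈ map value σs
      complete′ σ po (s≤s er≤) with m≤n⇒m<n∨m≡n er≤
      ... | inj₁ er<  = complete σ po er<
      ... | inj₂ refl =
        let best≤σ = lower′ σ ≤-refl
            τ , fτ , eτ = attained (≤-<-trans best≤σ (∑wC-<∞ σ))
        in contradiction (≤-trans fτ best≤σ , <⇒≤ eτ , inj₂ eτ) (proj₂ po τ)

    -- If `er τ` were below `e`, then `τ` would cost at least `best`, contrary to the strict
    -- improvement. So `er τ` is `e`, and the lower bound for that length makes its cost exactly
    -- `current`. Strictness also keeps the new pair distinct from the earlier ones.
    frontier-improve : current < best → ∀ τ → ∑wC τ ≤ current → er τ ≤ e →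
      Frontier (suc e) current (σs ∷ʳ τ)
    frontier-improve current< τ fτ≤ eτ≤ = record
      { lower = lower′
      ; attained = λ _ → τ , fτ≤ , s≤s eτ≤
      ; above = All.++⁺ (All.map (≤-trans (<⇒≤ current<)) above) (≤-reflexive (sym fτ≡) ∷ [])
      ; distinct = subst Unique (sym (List.map-++ value σs (τ ∷ [])))
          (AllPairs.++⁺ distinct ([] ∷ [])
            (All.map⁺ (All.map (λ best≤ → (λ eq → <⇒≱ current<
              (≤-trans best≤ (≤-trans (≤-reflexive (cong proj₁ eq)) fτ≤))) ∷ []) above)))
      ; sound = All.++⁺ sound (((τ , refl) , optimal) ∷ [])
      ; complete = complete′ }
      where
      eτ≡ : er τ ≡ e
      eτ≡ with m≤n⇒m<n∨m≡n eτ≤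
      ... | inj₂ eq  = eq
      ... | inj₁ eτ< = contradiction (≤-trans (lower τ eτ<) fτ≤) (<⇒≱ current<)

      fτ≡ : ∑wC τ ≡ current
      fτ≡ = ≤-antisym fτ≤ (lower-e τ eτ≡)

      lower′ : ∀ σ → er σ < suc e → current ≤ ∑wC σ
      lower′ σ (s≤s er≤) with m≤n⇒m<n∨m≡n er≤
      ... | inj₁ er< = ≤-trans (<⇒≤ current<) (lower σ er<)
      ... | inj₂ eq  = lower-e σ eq

      optimal : ∀ σ → ¬ (value σ dominates value τ)
      optimal σ (f≤ , e≤ , inj₁ f<) =
        <⇒≱ f< (≤-trans fτ≤ (lower′ σ (s≤s (≤-trans e≤ eτ≤))))
      optimal σ (f≤ , e≤ , inj₂ e<) =
        <⇒≱ current< (≤-trans (lower σ (<-≤-trans e< eτ≤)) (≤-trans f≤ fτ≤))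

      mem : ∀ {v} → v ∈ map value σs ⊎ v ≡ value τ → v ∈ map value (σs ∷ʳ τ)
      mem {v} h = subst (v ∈_) (sym (List.map-++ value σs (τ ∷ [])))
        ([ ∈-++⁺ˡ , (λ eq → ∈-++⁺ʳ (map value σs) (here eq)) ]′ h)

      complete′ : ∀ σ → ParetoOptimal I (value σ) → er σ < suc e → value σ ∈ map value (σs ∷ʳ τ)
      complete′ σ po (s≤s er≤) with m≤n⇒m<n∨m≡n er≤
      ... | inj₁ er< = mem (inj₁ (complete σ po er<))
      ... | inj₂ eq with m≤n⇒m<n∨m≡n (≤-trans fτ≤ (lower-e σ eq))
      ...   | inj₁ f<  = contradiction
        (<⇒≤ f< , ≤-trans eτ≤ (≤-reflexive (sym eq)) , inj₁ f<) (proj₂ po τ)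
      ...   | inj₂ fτ≡fσ = mem (inj₂ (cong₂ _,_ (sym fτ≡fσ) (trans eq (sym eτ≡))))

  -- No renting period is longer than `P`, so the restriction to `er` below `suc P` excludes no
  -- sequence.
  frontier-finish : ∀ {best σs} → Frontier (suc P) best σs → IsParetoFront I σs
  frontier-finish {σs = σs} F = distinct , λ v → mk⇔ (to v) (from v)
    where
    open Frontier F
    to : ∀ v → v ∈ map value σs → ParetoOptimal I v
    to v v∈ with σ , σ∈ , refl ← ∈-map⁻ value v∈ = All.lookup sound σ∈
    from : ∀ v → ParetoOptimal I v → v ∈ map value σs
    from v po@((σ , refl) , _) = complete σ po (s≤s (er-≤P σ))

-- The program

pattern bigᴬ      = 7
pattern orderᴬ    = 8
pattern reverseᴬ  = 9
pattern prefixᴬ   = 10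
pattern forwardᴬ  = 11
pattern backwardᴬ = 12
pattern classᴬ    = 13
pattern iᴬ        = 14
pattern jᴬ        = 15
pattern xᴬ        = 16
pattern yᴬ        = 17
pattern uᴬ        = 18
pattern vᴬ        = 19
pattern eᴬ        = 20
pattern kᴬ        = 21
pattern aᴬ        = 22
pattern bestᴬ     = 23
pattern currentᴬ  = 24
pattern splitᴬ    = 25
pattern startᴬ    = 26
pattern positionᴬ = 27

infix 20 !_
!_ : ArrayName → Expr
! a = a [ lit 0 ]

infix 3 _≔_
_≔_ : ArrayName → Expr → Code
a ≔ e = a [ lit 0 ]≔ e

tableᴬ orderingᴬ : Direction → ArrayName
tableᴬ forward     = forwardᴬ
tableᴬ backward    = backwardᴬ
orderingᴬ forward  = orderᴬ
orderingᴬ backward = reverseᴬ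

outsideClass : Direction → ℕ
outsideClass forward  = 2
outsideClass backward = 0

indexᵉ : Expr → Expr → Expr → Expr
indexᵉ i x y = (i ⊗ (! totalᴬ ⊕ lit 1) ⊕ x) ⊗ (! totalᴬ ⊕ lit 1) ⊕ y

clampᵉ : Expr → Expr
clampᵉ e = e ⊖ (e ⊖ ! totalᴬ)

finishᵉ : Direction → Expr → Expr → Expr
finishᵉ forward  x q = x ⊕ q
finishᵉ backward x q = ! totalᴬ ⊖ x

jobᵉ timeᵉ withinᵉ outsideᵉ : Direction → Expr
jobᵉ     d = orderingᴬ d [ ! iᴬ ]
timeᵉ    d = pᴬ [ jobᵉ d ]
withinᵉ  d =
  tableᴬ d [ indexᵉ (! iᴬ ⊕ lit 1) (clampᵉ (! xᴬ ⊕ timeᵉ d)) (! yᴬ) ]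
  ⊕ wᴬ [ jobᵉ d ] ⊗ finishᵉ d (! xᴬ) (timeᵉ d)
  ⊕ ! bigᴬ ⊗ ((! xᴬ ⊕ timeᵉ d) ⊖ ! totalᴬ)
outsideᵉ d =
  tableᴬ d [ indexᵉ (! iᴬ ⊕ lit 1) (! xᴬ) (clampᵉ (! yᴬ ⊕ timeᵉ d)) ]
  ⊕ wᴬ [ jobᵉ d ] ⊗ finishᵉ d (! yᴬ) (timeᵉ d)
  ⊕ ! bigᴬ ⊗ (((! yᴬ ⊕ timeᵉ d) ⊖ ! totalᴬ) ⊕ rᴬ [ jobᵉ d ])

keyᵉ : ArrayName → ArrayName → Expr
keyᵉ i j = wᴬ [ ! j ] ⊗ pᴬ [ ! i ] ⊗ ! sizeᴬ ⊕ ! i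

sums sorting rankLoop prefixes restart decide search body : Code
fill : Direction → Code
fillRow : Direction → Expr → Expr → Code
walk : Direction → Code
emit : ℕ → Code
classification emission output improvement choose : Code

-- Counter and sums start from the 0 that the input memory holds in all three scalars.
sums = UP eachJob iᴬ (uᴬ ≔ ! uᴬ ⊕ pᴬ [ ! iᴬ ] ⨟ vᴬ ≔ ! vᴬ ⊕ wᴬ [ ! iᴬ ])

rankLoop = UP eachJob iᴬ (IF keyᵉ iᴬ jᴬ <ᵗ keyᵉ jᴬ iᴬ THEN uᴬ ≔ ! uᴬ ⊕ lit 1 ELSE skip)

-- Each job is written directly to the position given by its rank, and to the mirrored position of
-- the reversed order.
sorting = jᴬ ≔ lit 0 ⨟ UP eachJob jᴬ
  (uᴬ ≔ lit 0 ⨟ iᴬ ≔ lit 0 ⨟ rankLoop ⨟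
   orderᴬ [ ! uᴬ ]≔ ! jᴬ ⨟ reverseᴬ [ (! sizeᴬ ⊖ lit 1) ⊖ ! uᴬ ]≔ ! jᴬ)

prefixes = prefixᴬ ≔ lit 0 ⨟ iᴬ ≔ lit 0 ⨟ UP eachJob iᴬ
  (prefixᴬ [ ! iᴬ ⊕ lit 1 ]≔ prefixᴬ [ ! iᴬ ] ⊕ pᴬ [ orderᴬ [ ! iᴬ ] ])

fillRow d i value = xᴬ ≔ lit 0 ⨟ UP eachTime xᴬ (yᴬ ≔ lit 0 ⨟ UP eachTime yᴬ
  (tableᴬ d [ indexᵉ i (! xᴬ) (! yᴬ) ]≔ value))

fill d =
  fillRow d (! sizeᴬ) (! bigᴬ ⊗ (! totalᴬ ⊖ ! yᴬ)) ⨟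
  jᴬ ≔ lit 0 ⨟ UP eachJob jᴬ
    -- Loops only count up, but each row is computed from the next one; so the row index is
    -- `n - 1 - j`.
    (iᴬ ≔ (! sizeᴬ ⊖ lit 1) ⊖ ! jᴬ ⨟
     fillRow d (! iᴬ) (withinᵉ d ⊖ (withinᵉ d ⊖ outsideᵉ d)))

-- No decisions are stored with the table; evaluating both alternatives again shows which one
-- attains the minimum.
walk d = UP eachJob iᴬ (IF withinᵉ d ≤ᵗ outsideᵉ d
  THEN (classᴬ [ jobᵉ d ]≔ lit 1 ⨟ xᴬ ≔ ! xᴬ ⊕ timeᵉ d)
  ELSE (classᴬ [ jobᵉ d ]≔ lit (outsideClass d) ⨟ yᴬ ≔ ! yᴬ ⊕ timeᵉ d))

emit c = iᴬ ≔ lit 0 ⨟ UP eachJob iᴬ (IF classᴬ [ orderᴬ [ ! iᴬ ] ] ≡ᵗ lit c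
  THEN (sequencesᴬ [ ! positionᴬ ]≔ orderᴬ [ ! iᴬ ] ⨟ positionᴬ ≔ ! positionᴬ ⊕ lit 1)
  ELSE skip)

place : Direction → Code
-- In the reversed order, the `n - k` jobs of the back precede the `k` jobs of the front.
place backward =
  iᴬ ≔ ! sizeᴬ ⊖ ! splitᴬ ⨟ xᴬ ≔ ! totalᴬ ⊖ prefixᴬ [ ! splitᴬ ] ⨟ yᴬ ≔ ! totalᴬ ⊖ ! startᴬ
place forward  =
  iᴬ ≔ ! splitᴬ ⨟ xᴬ ≔ prefixᴬ [ ! splitᴬ ] ⨟ yᴬ ≔ ! startᴬ ⊕ ! eᴬ

classification = (place backward ⨟ walk backward) ⨟ place forward ⨟ walk forward

emission = emit 0 ⨟ emit 1 ⨟ emit 2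

output = classification ⨟ emission

improvement = bestᴬ ≔ ! currentᴬ ⨟ countᴬ ≔ ! countᴬ ⊕ lit 1

combinedᵉ : Expr
combinedᵉ =
  backwardᴬ [ indexᵉ (! sizeᴬ ⊖ ! kᴬ) (! totalᴬ ⊖ prefixᴬ [ ! kᴬ ]) (! totalᴬ ⊖ ! aᴬ) ]
  ⊕ forwardᴬ [ indexᵉ (! kᴬ) (prefixᴬ [ ! kᴬ ]) (clampᵉ (! aᴬ ⊕ ! eᴬ)) ]
  ⊕ ! bigᴬ ⊗ ((! aᴬ ⊕ ! eᴬ) ⊖ ! totalᴬ)

choose = kᴬ ≔ lit 0 ⨟ UP eachSplit kᴬ (aᴬ ≔ lit 0 ⨟ UP eachTime aᴬ
  (IF combinedᵉ <ᵗ ! currentᴬ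
   THEN (currentᴬ ≔ combinedᵉ ⨟ splitᴬ ≔ ! kᴬ ⨟ startᴬ ≔ ! aᴬ)
   ELSE skip))

decide = IF ! currentᴬ <ᵗ ! bestᴬ THEN (improvement ⨟ output) ELSE skip

body = currentᴬ ≔ ! bigᴬ ⨟ choose ⨟ decide

restart = countᴬ ≔ lit 0 ⨟ positionᴬ ≔ lit 0 ⨟ bestᴬ ≔ ! bigᴬ ⨟ eᴬ ≔ lit 0

search = restart ⨟ UP eachTime eᴬ body

preparation solving : Code
preparation = bigᴬ ≔ lit 1 ⊕ ! vᴬ ⊗ ! totalᴬ ⨟ sorting ⨟ prefixes
solving     = fill forward ⨟ fill backward ⨟ search

-- Correctness of the program

write-other : ∀ a b → (a ≡ᵇ b) ≡ false → ∀ m i v k → (m [ a ][ i ]≔ v) b k ≡ m b k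
write-other a b h m i v k rewrite h = refl

next-other : ∀ a b → (a ≡ᵇ b) ≡ false → ∀ m k → next a m b k ≡ m b k
next-other a b h m k = write-other a b h m 0 (m a 0 + 1) k

write-same : ∀ a m i v → (m [ a ][ i ]≔ v) a i ≡ v
write-same a m i v rewrite ≡ᵇ-refl a | ≡ᵇ-refl i = refl

write-elsewhere : ∀ a m i v k → i ≢ k → (m [ a ][ i ]≔ v) a k ≡ m a k
write-elsewhere a m i v k i≢k rewrite ≡ᵇ-refl a | ≡ᵇ-≢ i≢k = refl

-- Addresses of table entries and the filling of one row

module Verification (I : Instance) where

  open Instance I
  open Sequences I
  open RatioOrder I
  open Frontiers I
  open Table p w rent P ∞
  open Combination p w rent P ∞

  index : ℕ → ℕ → ℕ → ℕ
  index i x y = (i * (P + 1) + x) * (P + 1) + y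

  index-injective : ∀ {i x y i′ x′ y′} → x ≤ P → y ≤ P → x′ ≤ P → y′ ≤ P →
    index i x y ≡ index i′ x′ y′ → i ≡ i′ × x ≡ x′ × y ≡ y′
  index-injective {i} {x} {y} {i′} {x′} x≤ y≤ x′≤ y′≤ eq =
    let eq₁ , y≡ = lex-injective (P + 1) {i * (P + 1) + x} {i′ * (P + 1) + x′} (bound y≤) (bound y′≤) eq
        i≡ , x≡ = lex-injective (P + 1) {i} {i′} (bound x≤) (bound x′≤) eq₁
    in i≡ , x≡ , y≡
    where
    bound : ∀ {z} → z ≤ P → z < P + 1
    bound {z} z≤ = subst (z <_) (+-comm 1 P) (s≤s z≤)

  module FillRow (d : Direction) (iᵉ valueᵉ : Expr) (i : ℕ) (F : ℕ → ℕ → ℕ) (m : Memory)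
                 (total≡ : m totalᴬ 0 ≡ P) where

    tab : ArrayName
    tab = tableᴬ d

    cellLoop : Code
    cellLoop = UP eachTime yᴬ (tab [ indexᵉ iᵉ (! xᴬ) (! yᴬ) ]≔ valueᵉ)

    -- Computing a row reads the next row of the same array, so `Keeps` alone is not enough. The
    -- other rows survive because addresses are injective in row and times.
    record Others (m′ : Memory) : Set where
      constructor others
      field
        arrays : Keeps (fillRow d iᵉ valueᵉ) m m′
        rows   : ∀ {i′ x y} → i′ ≢ i → x ≤ P → y ≤ P → m′ tab (index i′ x y) ≡ m tab (index i′ x y)

    Correct : Set
    Correct = ∀ {m′} x y → Others m′ → m′ xᴬ 0 ≡ x → m′ yᴬ 0 ≡ y → x ≤ P → y ≤ P →
      ⟦ iᵉ ⟧ m′ ≡ i × ⟦ valueᵉ ⟧ m′ ≡ F x y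

    private
      tab≢x : ∀ d → (tableᴬ d ≡ᵇ xᴬ) ≡ false
      tab≢x forward  = refl
      tab≢x backward = refl

      y≢tab : ∀ d → (yᴬ ≡ᵇ tableᴬ d) ≡ false
      y≢tab forward  = refl
      y≢tab backward = refl

      x≢tab : ∀ d → (xᴬ ≡ᵇ tableᴬ d) ≡ false
      x≢tab forward  = refl
      x≢tab backward = refl

      total-kept : ∀ d → writes totalᴬ (fillRow d iᵉ valueᵉ) ≡ false
      total-kept forward  = refl
      total-kept backward = refl

      y-others : ∀ {m′} v → Others m′ → Others (m′ [ yᴬ ][ 0 ]≔ v)
      y-others {m′} v (others arrays rows) = others
        (λ a h k → let _ , h′ = ∨-split {xᴬ ≡ᵇ a} h
                       _ , h″ = ∨-split {xᴬ ≡ᵇ a} h′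
                   in trans (write-other yᴬ a (proj₁ (∨-split {yᴬ ≡ᵇ a} h″)) m′ 0 v k) (arrays a h k))
        (λ {i′} {x} {y} i′≢ x≤ y≤ →
          trans (write-other yᴬ tab (y≢tab d) m′ 0 v (index i′ x y)) (rows i′≢ x≤ y≤))

      x-others : ∀ {m′} v → Others m′ → Others (m′ [ xᴬ ][ 0 ]≔ v)
      x-others {m′} v (others arrays rows) = others
        (λ a h k → trans (write-other xᴬ a (proj₁ (∨-split {xᴬ ≡ᵇ a} h)) m′ 0 v k) (arrays a h k))
        (λ {i′} {x} {y} i′≢ x≤ y≤ →
          trans (write-other xᴬ tab (x≢tab d) m′ 0 v (index i′ x y)) (rows i′≢ x≤ y≤))

      tab-others : ∀ {m′ x y} v → x ≤ P → y ≤ P → Others m′ → Others (m′ [ tab ][ index i x y ]≔ v)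
      tab-others {m′} {x} {y} v x≤ y≤ (others arrays rows) = others
        (λ a h k → let _ , h₁ = ∨-split {xᴬ ≡ᵇ a} h
                       _ , h₂ = ∨-split {xᴬ ≡ᵇ a} h₁
                       _ , h₃ = ∨-split {yᴬ ≡ᵇ a} h₂
                       _ , h₄ = ∨-split {yᴬ ≡ᵇ a} h₃
                   in trans (write-other tab a h₄ m′ (index i x y) v k) (arrays a h k))
        (λ {i′} {x′} {y′} i′≢ x′≤ y′≤ → trans (write-elsewhere tab m′ (index i x y) v (index i′ x′ y′)
            (λ eq → i′≢ (sym (proj₁ (index-injective x≤ y≤ x′≤ y′≤ eq)))))
          (rows i′≢ x′≤ y′≤))

      others-limit : ∀ {m′} → Others m′ → ⟦ limit eachTime ⟧ m′ ≡ suc P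
      others-limit o = trans (cong (_+ 1) (trans (Others.arrays o totalᴬ (total-kept d) 0) total≡)) (+-comm P 1)

    record Done (x y : ℕ) (m′ : Memory) : Set where
      constructor done
      field
        same  : Others m′
        below : ∀ {x′ y′} → x′ < x → y′ ≤ P → m′ tab (index i x′ y′) ≡ F x′ y′
        cells : ∀ {y′} → y′ < y → m′ tab (index i x y′) ≡ F x y′

    module _ (correct : Correct) where

      cell-step : ∀ {x y m′} → x ≤ P → y ≤ P → m′ xᴬ 0 ≡ x → m′ yᴬ 0 ≡ y → Done x y m′ →
        Done x (suc y) (next yᴬ (run (tab [ indexᵉ iᵉ (! xᴬ) (! yᴬ) ]≔ valueᵉ) m′))
      cell-step {x} {y} {m′} x≤ y≤ x≡ y≡ (done same below cells) =
        subst (λ M → Done x (suc y) (next yᴬ M)) (cong₂ (λ k v → m′ [ tab ][ k ]≔ v) (sym k≡) (sym v≡))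
          (done (y-others (M yᴬ 0 + 1) (tab-others (F x y) x≤ y≤ same))
            (λ {x′} {y′} x′< y′≤ → trans (next-other yᴬ tab (y≢tab d) M (index i x′ y′))
              (trans (write-elsewhere tab m′ (index i x y) (F x y) (index i x′ y′)
                (λ eq → <⇒≢ x′< (sym (proj₁ (proj₂
                  (index-injective {i} {x} {y} {i} x≤ y≤ (≤-trans (<⇒≤ x′<) x≤) y′≤ eq))))))
                (below x′< y′≤)))
            cells′)
        where
        o = correct x y same x≡ y≡ x≤ y≤
        M = m′ [ tab ][ index i x y ]≔ F x y
        tot : m′ totalᴬ 0 ≡ P
        tot = trans (Others.arrays same totalᴬ (total-kept d) 0) total≡
        k≡ : ⟦ indexᵉ iᵉ (! xᴬ) (! yᴬ) ⟧ m′ ≡ index i x y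
        k≡ rewrite tot | x≡ | y≡ | proj₁ o = refl
        v≡ : ⟦ valueᵉ ⟧ m′ ≡ F x y
        v≡ = proj₂ o
        cells′ : ∀ {y′} → y′ < suc y → next yᴬ M tab (index i x y′) ≡ F x y′
        cells′ {y′} (s≤s y′≤y) with m≤n⇒m<n∨m≡n y′≤y
        ... | inj₂ refl = trans (next-other yᴬ tab (y≢tab d) M (index i x y′)) (write-same tab m′ (index i x y) (F x y))
        ... | inj₁ y′<y = trans (next-other yᴬ tab (y≢tab d) M (index i x y′))
          (trans (write-elsewhere tab m′ (index i x y) (F x y) (index i x y′)
            (λ eq → <⇒≢ y′<y (sym (proj₂ (proj₂
              (index-injective {i} {x} {y} {i} x≤ y≤ x≤ (≤-trans y′≤y y≤) eq))))))
            (cells y′<y))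

      cellLoop-wf : ∀ d → wellFormed (UP eachTime yᴬ (tableᴬ d [ indexᵉ iᵉ (! xᴬ) (! yᴬ) ]≔ valueᵉ)) ≡ true
      cellLoop-wf forward  = refl
      cellLoop-wf backward = refl

      cell-loop : ∀ {x m′} → x ≤ P → m′ xᴬ 0 ≡ x → m′ yᴬ 0 ≡ 0 → Done x 0 m′ →
        Done x (suc P) (run cellLoop m′)
      cell-loop {x} {m′} x≤ x≡ y≡ dn =
        loop-invariant eachTime yᴬ (tab [ indexᵉ iᵉ (! xᴬ) (! yᴬ) ]≔ valueᵉ) m′ (Done x)
          (cellLoop-wf d) (others-limit (Done.same dn)) y≡ z≤n dn
          λ { k m″ (s≤s k≤P) y″≡ keeps dn′ →
              cell-step x≤ k≤P (trans (keeps xᴬ (tab≢x d) 0) x≡) y″≡ dn′ }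

      row-step : ∀ {x m′} → x ≤ P → m′ xᴬ 0 ≡ x → Done x 0 m′ →
        Done (suc x) 0 (next xᴬ (run (yᴬ ≔ lit 0 ⨟ cellLoop) m′))
      row-step {x} {m′} x≤ x≡ (done same below cells) = done (x-others (M xᴬ 0 + 1) (Done.same dn))
        (λ { {x′} {y′} (s≤s x′≤x) y′≤ → trans (next-other xᴬ tab (x≢tab d) M (index i x′ y′)) (cell x′≤x y′≤) })
        (λ ())
        where
        M = run (yᴬ ≔ lit 0 ⨟ cellLoop) m′
        start : Done x 0 (m′ [ yᴬ ][ 0 ]≔ 0)
        start = done (y-others 0 same)
          (λ {x′} {y′} x′< y′≤ →
            trans (write-other yᴬ tab (y≢tab d) m′ 0 0 (index i x′ y′)) (below x′< y′≤)) (λ ())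
        dn : Done x (suc P) (run cellLoop (m′ [ yᴬ ][ 0 ]≔ 0))
        dn = cell-loop x≤ x≡ refl start
        cell : ∀ {x′ y′} → x′ ≤ x → y′ ≤ P → run cellLoop (m′ [ yᴬ ][ 0 ]≔ 0) tab (index i x′ y′) ≡ F x′ y′
        cell x′≤x y′≤ with m≤n⇒m<n∨m≡n x′≤x
        ... | inj₁ x′<x = Done.below dn x′<x y′≤
        ... | inj₂ refl = Done.cells dn (s≤s y′≤)

      rowLoop-wf : ∀ d → wellFormed (UP eachTime xᴬ (yᴬ ≔ lit 0 ⨟ UP eachTime yᴬ
        (tableᴬ d [ indexᵉ iᵉ (! xᴬ) (! yᴬ) ]≔ valueᵉ))) ≡ true
      rowLoop-wf forward  = refl
      rowLoop-wf backward = refl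

      fillRow-correct : let m′ = run (fillRow d iᵉ valueᵉ) m in
        Others m′ × (∀ {x y} → x ≤ P → y ≤ P → m′ tab (index i x y) ≡ F x y)
      fillRow-correct = Done.same dn , λ x≤ y≤ → Done.below dn (s≤s x≤) y≤
        where
        start : Done 0 0 (m [ xᴬ ][ 0 ]≔ 0)
        start = done (x-others 0 (others (λ a h k → refl) (λ _ _ _ → refl))) (λ ()) (λ ())
        dn : Done (suc P) 0 (run (fillRow d iᵉ valueᵉ) m)
        dn = loop-invariant eachTime xᴬ (yᴬ ≔ lit 0 ⨟ cellLoop) (m [ xᴬ ][ 0 ]≔ 0) (λ x → Done x 0)
          (rowLoop-wf d) (others-limit (Done.same start)) refl z≤n start
          λ { k m″ (s≤s k≤P) x≡ keeps dn → row-step k≤P x≡ dn }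

-- Invariants of the memory and the filling of the tables

Agrees : List ArrayName → Memory → Memory → Set
Agrees as m m′ = ∀ a → a ∈ as → ∀ i → m′ a i ≡ m a i

avoids : List ArrayName → Code → Bool
avoids []       c = true
avoids (a ∷ as) c = not (writes a c) ∧ avoids as c

avoids-∈ : ∀ {as} c → avoids as c ≡ true → ∀ a → a ∈ as → writes a c ≡ false
avoids-∈ c h a (here refl) = not-true (proj₁ (∧-split h))
avoids-∈ c h a (there {b} a∈) = avoids-∈ c (proj₂ (∧-split {not (writes b c)} h)) a a∈

keeps-agrees : ∀ {as} c {m m′} → avoids as c ≡ true → Keeps c m m′ → Agrees as m m′
keeps-agrees c h keeps a a∈ = keeps a (avoids-∈ c h a a∈)

run-agrees : ∀ {as} c m → avoids as c ≡ true → Agrees as m (run c m)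
run-agrees c m h a a∈ = frame c m (avoids-∈ c h a a∈)

agrees-trans : ∀ {as m m′ m″} → Agrees as m m′ → Agrees as m′ m″ → Agrees as m m″
agrees-trans f g a a∈ i = trans (g a a∈ i) (f a a∈ i)

basicArrays setupArrays : List ArrayName
basicArrays = sizeᴬ ∷ pᴬ ∷ wᴬ ∷ rᴬ ∷ totalᴬ ∷ bigᴬ ∷ []
setupArrays = sizeᴬ ∷ pᴬ ∷ wᴬ ∷ rᴬ ∷ totalᴬ ∷ bigᴬ ∷ orderᴬ ∷ reverseᴬ ∷ prefixᴬ ∷ []

module TableFilling (I : Instance) where

  open Instance I
  open Sequences I
  open RatioOrder I
  open Verification I
  open Table p w rent P ∞

  record Basic (m : Memory) : Set where
    constructor basic
    field
      size≡  : m sizeᴬ 0 ≡ n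
      p≡     : ∀ j → m pᴬ (toℕ j) ≡ p j
      w≡     : ∀ j → m wᴬ (toℕ j) ≡ w j
      r≡     : ∀ j → m rᴬ (toℕ j) ≡ rent j
      total≡ : m totalᴬ 0 ≡ P
      big≡   : m bigᴬ 0 ≡ ∞

  -- A position is given by the list before it instead of a number; this matches the recursion of
  -- the tables on suffixes and the form in which `list-invariant` presents a loop.
  Lists : ArrayName → List (Fin n) → Memory → Set
  Lists a js m = ∀ xs j ys → js ≡ xs ++ j ∷ ys → m a (length xs) ≡ toℕ j

  lineup : Direction → List (Fin n)
  lineup forward  = order
  lineup backward = reverse order

  length-lineup : ∀ d → length (lineup d) ≡ n
  length-lineup forward  = length-order
  length-lineup backward = trans (List.length-reverse order) length-order

  record Setup (m : Memory) : Set where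
    constructor setup
    field
      basics  : Basic m
      listing : ∀ d → Lists (orderingᴬ d) (lineup d) m
      prefix≡ : ∀ xs ys → order ≡ xs ++ ys → m prefixᴬ (length xs) ≡ total p xs

  basic-agrees : ∀ {m m′} → Agrees basicArrays m m′ → Basic m → Basic m′
  basic-agrees ag (basic s p w r t b) = basic
    (trans (ag sizeᴬ (here refl) 0) s)
    (λ j → trans (ag pᴬ (there (here refl)) (toℕ j)) (p j))
    (λ j → trans (ag wᴬ (there (there (here refl))) (toℕ j)) (w j))
    (λ j → trans (ag rᴬ (there (there (there (here refl)))) (toℕ j)) (r j))
    (trans (ag totalᴬ (there (there (there (there (here refl))))) 0) t)
    (trans (ag bigᴬ (there (there (there (there (there (here refl)))))) 0) b)

  setup-agrees : ∀ {m m′} → Agrees setupArrays m m′ → Setup m → Setup m′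
  setup-agrees {m} {m′} ag (setup b l q) = setup
    (basic-agrees (λ a a∈ → ag a (∈-++⁺ˡ a∈)) b)
    (λ d xs j ys eq → trans (ag (orderingᴬ d) (ordering∈ d) (length xs)) (l d xs j ys eq))
    (λ xs ys eq → trans (ag prefixᴬ (∈-++⁺ʳ basicArrays (there (there (here refl)))) (length xs)) (q xs ys eq))
    where
    ordering∈ : ∀ d → orderingᴬ d ∈ setupArrays
    ordering∈ forward  = ∈-++⁺ʳ basicArrays (here refl)
    ordering∈ backward = ∈-++⁺ʳ basicArrays (there (here refl))

  Row : Direction → ℕ → List (Fin n) → Memory → Set
  Row d i js m = ∀ {x y} → x ≤ P → y ≤ P → m (tableᴬ d) (index i x y) ≡ table d js x y

  Filled : Direction → Memory → Set
  Filled d m = ∀ xs ys → lineup d ≡ xs ++ ys → Row d (length xs) ys m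

  finish-eval : ∀ d m e q → m totalᴬ 0 ≡ P → ⟦ finishᵉ d e q ⟧ m ≡ finish d (⟦ e ⟧ m) (⟦ q ⟧ m)
  finish-eval forward  m e q eq = refl
  finish-eval backward m e q eq = cong (_∸ ⟦ e ⟧ m) eq

  module Eval {d : Direction} {m : Memory} {i : ℕ} {j : Fin n} {js : List (Fin n)} {x y : ℕ}
              (b : Basic m) (i≡ : m iᴬ 0 ≡ i) (j≡ : m (orderingᴬ d) i ≡ toℕ j)
              (x≡ : m xᴬ 0 ≡ x) (y≡ : m yᴬ 0 ≡ y) (x≤ : x ≤ P) (y≤ : y ≤ P)
              (row : Row d (suc i) js m) where

    job-eval : ⟦ jobᵉ d ⟧ m ≡ toℕ j
    job-eval = trans (cong (m (orderingᴬ d)) i≡) j≡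

    time-eval : ⟦ timeᵉ d ⟧ m ≡ p j
    time-eval = trans (cong (m pᴬ) job-eval) (Basic.p≡ b j)

    private
      cell : ∀ eˣ eʸ {x y} → ⟦ eˣ ⟧ m ≡ x → ⟦ eʸ ⟧ m ≡ y → x ≤ P → y ≤ P →
        m (tableᴬ d) (⟦ indexᵉ (! iᴬ ⊕ lit 1) eˣ eʸ ⟧ m) ≡ table d js x y
      cell eˣ eʸ refl refl x≤ y≤ rewrite Basic.total≡ b | i≡ | +-comm i 1 = row x≤ y≤

      clamp-eval : ∀ e {x} → ⟦ e ⟧ m ≡ x → ⟦ clampᵉ e ⟧ m ≡ clamp x
      clamp-eval e refl rewrite Basic.total≡ b = refl

      weight-eval : ⟦ wᴬ [ jobᵉ d ] ⟧ m ≡ w j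
      weight-eval = trans (cong (m wᴬ) job-eval) (Basic.w≡ b j)

      finish-eval′ : ∀ e {x} → ⟦ e ⟧ m ≡ x → ⟦ finishᵉ d e (timeᵉ d) ⟧ m ≡ finish d x (p j)
      finish-eval′ e eq = trans (finish-eval d m e (timeᵉ d) (Basic.total≡ b)) (cong₂ (finish d) eq time-eval)

    within-eval : ⟦ withinᵉ d ⟧ m ≡ within d (j ∷ js) x y
    within-eval = cong₂ _+_
      (cong₂ _+_
        (cell (clampᵉ (! xᴬ ⊕ timeᵉ d)) (! yᴬ) (clamp-eval (! xᴬ ⊕ timeᵉ d) x+p≡) y≡ (clamp-≤ (x + p j)) y≤)
        (cong₂ _*_ weight-eval (finish-eval′ (! xᴬ) x≡)))
      (cong₂ _*_ (Basic.big≡ b) (cong₂ _∸_ x+p≡ (Basic.total≡ b)))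
      where
      x+p≡ : ⟦ ! xᴬ ⊕ timeᵉ d ⟧ m ≡ x + p j
      x+p≡ = cong₂ _+_ x≡ time-eval

    outside-eval : ⟦ outsideᵉ d ⟧ m ≡ outside d (j ∷ js) x y
    outside-eval = cong₂ _+_
      (cong₂ _+_
        (cell (! xᴬ) (clampᵉ (! yᴬ ⊕ timeᵉ d)) x≡ (clamp-eval (! yᴬ ⊕ timeᵉ d) y+p≡) x≤ (clamp-≤ (y + p j)))
        (cong₂ _*_ weight-eval (finish-eval′ (! yᴬ) y≡)))
      (cong₂ _*_ (Basic.big≡ b) (cong₂ _+_ (cong₂ _∸_ y+p≡ (Basic.total≡ b))
        (trans (cong (m rᴬ) job-eval) (Basic.r≡ b j))))
      where
      y+p≡ : ⟦ ! yᴬ ⊕ timeᵉ d ⟧ m ≡ y + p j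
      y+p≡ = cong₂ _+_ y≡ time-eval

  fillRow-setup : ∀ d iᵉ vᵉ → avoids setupArrays (fillRow d iᵉ vᵉ) ≡ true
  fillRow-setup forward  iᵉ vᵉ = refl
  fillRow-setup backward iᵉ vᵉ = refl

  fillRow-keeps : ∀ d iᵉ vᵉ → writes iᴬ (fillRow d iᵉ vᵉ) ≡ false
  fillRow-keeps forward  iᵉ vᵉ = refl
  fillRow-keeps backward iᵉ vᵉ = refl

  scalar≢table : ∀ d → (iᴬ ≡ᵇ tableᴬ d) ≡ false × (jᴬ ≡ᵇ tableᴬ d) ≡ false
  scalar≢table forward  = refl , refl
  scalar≢table backward = refl , refl

  terminalᵉ : Expr
  terminalᵉ = ! bigᴬ ⊗ (! totalᴬ ⊖ ! yᴬ)

  updateᵉ : Direction → Expr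
  updateᵉ d = withinᵉ d ⊖ (withinᵉ d ⊖ outsideᵉ d)

  fillTerminal : ∀ d m → Setup m → let m′ = run (fillRow d (! sizeᴬ) terminalᵉ) m in
    Setup m′ × Row d n [] m′
  fillTerminal d m s = setup-agrees (run-agrees (fillRow d (! sizeᴬ) terminalᵉ) m (fillRow-setup d (! sizeᴬ) terminalᵉ)) s ,
    proj₂ (fillRow-correct correct)
    where
    open FillRow d (! sizeᴬ) terminalᵉ n (table d []) m (Basic.total≡ (Setup.basics s))
    correct : Correct
    correct x y o x≡ y≡ x≤ y≤ = Basic.size≡ b , cong₂ _*_ (Basic.big≡ b) (cong₂ _∸_ (Basic.total≡ b) y≡)
      where
      b = Setup.basics (setup-agrees (keeps-agrees (fillRow d (! sizeᴬ) terminalᵉ)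
        (fillRow-setup d (! sizeᴬ) terminalᵉ) (Others.arrays o)) s)

  fillStep : ∀ d m xs j ys → lineup d ≡ xs ++ j ∷ ys → Setup m → m iᴬ 0 ≡ length xs → Row d (suc (length xs)) ys m →
    let m′ = run (fillRow d (! iᴬ) (updateᵉ d)) m in
    Row d (length xs) (j ∷ ys) m′ × (∀ {i′} js → i′ ≢ length xs → Row d i′ js m → Row d i′ js m′)
  fillStep d m xs j ys eq s i≡ row = proj₂ (fillRow-correct correct) ,
    λ js i′≢ row′ x≤ y≤ → trans (Others.rows (proj₁ (fillRow-correct correct)) i′≢ x≤ y≤) (row′ x≤ y≤)
    where
    open FillRow d (! iᴬ) (updateᵉ d) (length xs) (table d (j ∷ ys)) m (Basic.total≡ (Setup.basics s))
    correct : Correct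
    correct {m′} x y o x≡ y≡ x≤ y≤ = i′≡ ,
      cong₂ _∸_ within-eval (cong₂ _∸_ within-eval outside-eval)
      where
      i′≡ : m′ iᴬ 0 ≡ length xs
      i′≡ = trans (Others.arrays o iᴬ (fillRow-keeps d (! iᴬ) (updateᵉ d)) 0) i≡
      s′ : Setup m′
      s′ = setup-agrees (keeps-agrees (fillRow d (! iᴬ) (updateᵉ d))
        (fillRow-setup d (! iᴬ) (updateᵉ d)) (Others.arrays o)) s
      row′ : Row d (suc (length xs)) ys m′
      row′ x≤ y≤ = trans (Others.rows o 1+n≢n x≤ y≤) (row x≤ y≤)
      open Eval {d} {m′} {length xs} {j} {ys} {x} {y} (Setup.basics s′) i′≡ (Setup.listing s′ d xs j ys eq) x≡ y≡ x≤ y≤ row′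

  fillBody : Direction → Code
  fillBody d = iᴬ ≔ (! sizeᴬ ⊖ lit 1) ⊖ ! jᴬ ⨟ fillRow d (! iᴬ) (updateᵉ d)

  fillLoop-wf : ∀ d → wellFormed (UP eachJob jᴬ (fillBody d)) ≡ true
  fillLoop-wf forward  = refl
  fillLoop-wf backward = refl

  fillLoop-setup : ∀ d → avoids setupArrays (UP eachJob jᴬ (fillBody d)) ≡ true
  fillLoop-setup forward  = refl
  fillLoop-setup backward = refl

  -- Rows are addressed by prefix length but completed by increasing suffix length; after `k`
  -- iterations, the suffixes of length at most `k` are done.
  FilledFrom : Direction → ℕ → Memory → Set
  FilledFrom d k m = ∀ xs ys → lineup d ≡ xs ++ ys → length ys ≤ k → Row d (length xs) ys m

  lineup-lengths : ∀ d xs {ys} → lineup d ≡ xs ++ ys → length xs + length ys ≡ n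
  lineup-lengths d xs eq = trans (sym (List.length-++ xs)) (trans (cong length (sym eq)) (length-lineup d))

  fill-correct : ∀ d m → Setup m → Setup (run (fill d) m) × Filled d (run (fill d) m)
  fill-correct d m s =
    setup-agrees (run-agrees (UP eachJob jᴬ (fillBody d)) m₂ (fillLoop-setup d)) s₂ ,
    λ xs ys eq → final xs ys eq (≤-trans (m≤n+m (length ys) (length xs)) (≤-reflexive (lineup-lengths d xs eq)))
    where
    m₁ = run (fillRow d (! sizeᴬ) terminalᵉ) m
    m₂ = m₁ [ jᴬ ][ 0 ]≔ 0

    s₂ : Setup m₂
    s₂ = setup-agrees (run-agrees (jᴬ ≔ lit 0) m₁ refl) (proj₁ (fillTerminal d m s))

    start : FilledFrom d 0 m₂
    start xs [] eq z≤n {x} {y} x≤ y≤ = trans (write-other jᴬ (tableᴬ d) (proj₂ (scalar≢table d)) m₁ 0 0 _)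
      (subst (λ i → m₁ (tableᴬ d) (index i x y) ≡ table d [] x y)
        (trans (sym (lineup-lengths d xs eq)) (+-identityʳ _)) (proj₂ (fillTerminal d m s) x≤ y≤))

    step : ∀ k m′ → k < n → m′ jᴬ 0 ≡ k → Keeps (UP eachJob jᴬ (fillBody d)) m₂ m′ → FilledFrom d k m′ →
      FilledFrom d (suc k) (next jᴬ (run (fillBody d) m′))
    step k m′ k<n j≡ keeps inv xs ys eq ys≤ {x} {y} x≤ y≤ =
      trans (next-other jᴬ (tableᴬ d) (proj₂ (scalar≢table d)) (run (fillBody d) m′) _) (go xs ys eq ys≤ x≤ y≤)
      where
      s′ : Setup m′
      s′ = setup-agrees (keeps-agrees (UP eachJob jᴬ (fillBody d)) (fillLoop-setup d) keeps) s₂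

      m″ : Memory
      m″ = run (iᴬ ≔ (! sizeᴬ ⊖ lit 1) ⊖ ! jᴬ) m′

      s″ : Setup m″
      s″ = setup-agrees (run-agrees (iᴬ ≔ (! sizeᴬ ⊖ lit 1) ⊖ ! jᴬ) m′ refl) s′

      inv″ : FilledFrom d k m″
      inv″ xs ys eq ys≤ x≤ y≤ =
        trans (write-other iᴬ (tableᴬ d) (proj₁ (scalar≢table d)) m′ 0 _ _) (inv xs ys eq ys≤ x≤ y≤)

      i≡ : m″ iᴬ 0 ≡ n ∸ suc k
      i≡ = trans (cong₂ (λ a b → (a ∸ 1) ∸ b) (Basic.size≡ (Setup.basics s′)) j≡) (∸-+-assoc n 1 k)

      i≡length : ∀ xs {j ys} → lineup d ≡ xs ++ j ∷ ys → length ys ≡ k → m″ iᴬ 0 ≡ length xs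
      i≡length xs {j} {ys} eq refl = trans i≡ (trans (cong (_∸ suc (length ys)) (sym (lineup-lengths d xs eq)))
        (m+n∸n≡m (length xs) (suc (length ys))))

      next-row : ∀ xs j ys → lineup d ≡ xs ++ j ∷ ys → length ys ≡ k → Row d (suc (length xs)) ys m″
      next-row xs j ys eq len {x} {y} x≤ y≤ = subst (λ i → m″ (tableᴬ d) (index i x y) ≡ table d ys x y)
        (trans (List.length-++ xs) (+-comm (length xs) 1))
        (inv″ (xs ∷ʳ j) ys (trans eq (sym (List.++-assoc xs (j ∷ []) ys))) (≤-reflexive len) x≤ y≤)

      go : FilledFrom d (suc k) (run (fillBody d) m′)
      go xs ys eq ys≤ with m≤n⇒m<n∨m≡n ys≤
      go xs (j ∷ ys) eq ys≤ | inj₂ len =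
        proj₁ (fillStep d m″ xs j ys eq s″ (i≡length xs eq (suc-injective len)) (next-row xs j ys eq (suc-injective len)))
      go xs ys eq ys≤ | inj₁ (s≤s ys≤k) = kept
        where
        split-at : ∀ i (js : List (Fin n)) → i < length js → ∃[ us ] ∃[ j ] ∃[ vs ] js ≡ us ++ j ∷ vs × length us ≡ i
        split-at zero    (j ∷ js) _       = [] , j , js , refl , refl
        split-at (suc i) (j ∷ js) (s≤s h) = let us , j′ , vs , eq , len = split-at i js h
                                            in j ∷ us , j′ , vs , cong (j ∷_) eq , cong suc len
        -- To speak of the row being written, the lineup is split at its position `n ∸ suc k`. The
        -- row of `xs` belongs to a shorter suffix, so it is a different one and is left alone.
        kept : Row d (length xs) ys (run (fillBody d) m′)
        kept with split-at (n ∸ suc k) (lineup d) (subst (n ∸ suc k <_) (sym (length-lineup d))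
                    (∸-monoʳ-< {n} {suc k} {0} (s≤s z≤n) k<n))
        ... | us , j , vs , eq′ , len =
          proj₂ (fillStep d m″ us j vs eq′ s″ (i≡length us eq′ vs≡k) (next-row us j vs eq′ vs≡k))
            ys (λ xs≡us → <⇒≱ (s≤s ys≤k) (≤-reflexive (sym (+-cancelˡ-≡ (length us) _ _
              (trans (cong (_+ length ys) (sym xs≡us)) (trans (lineup-lengths d xs eq)
                (trans (sym (lineup-lengths d us eq′)) (cong (λ z → length us + suc z) vs≡k))))))))
            (inv″ xs ys eq ys≤k)
          where
          vs≡k : length vs ≡ k
          vs≡k = suc-injective (+-cancelˡ-≡ (length us) _ _ (trans (lineup-lengths d us eq′)
            (sym (trans (cong (_+ suc k) len) (m∸n+n≡m k<n)))))

    final : FilledFrom d n (run (fill d) m)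
    final = loop-invariant eachJob jᴬ (fillBody d) m₂ (FilledFrom d) (fillLoop-wf d)
      (Basic.size≡ (Setup.basics s₂)) refl z≤n start step

-- The invariant speaks of the jobs processed and those remaining instead of the counter. The offset
-- `i` is there for the walks, which begin in the middle of a lineup.
list-invariant : ∀ {A : Set} v c m (js : List A) i (Inv : List A → List A → Memory → Set) →
  wellFormed (UP eachJob v c) ≡ true → m sizeᴬ 0 ≡ i + length js → m v 0 ≡ i → Inv [] js m →
  (∀ seen j rest m′ → js ≡ seen ++ j ∷ rest → m′ v 0 ≡ i + length seen →
    Keeps (UP eachJob v c) m m′ → Inv seen (j ∷ rest) m′ → Inv (seen ∷ʳ j) rest (next v (run c m′))) →
  Inv js [] (run (UP eachJob v c) m)
list-invariant {A} v c m js i Inv wf size start init step =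
  finish (loop-invariant eachJob v c m Inv′ {i} {i + length js} wf size start (m≤m+n i (length js))
    ([] , js , refl , sym (+-identityʳ i) , init) step′)
  where
  Inv′ : ℕ → Memory → Set
  Inv′ k m′ = ∃[ seen ] ∃[ rest ] js ≡ seen ++ rest × k ≡ i + length seen × Inv seen rest m′

  finish : ∀ {m′} → Inv′ (i + length js) m′ → Inv js [] m′
  finish {m′} (seen , [] , eq , len , inv) =
    subst (λ xs → Inv xs [] m′) (sym (trans eq (List.++-identityʳ seen))) inv
  finish (seen , j ∷ rest , eq , len , inv) = contradiction
    (trans (+-identityʳ (length seen)) (trans (sym (+-cancelˡ-≡ i _ _ len))
      (trans (cong length eq) (List.length-++ seen))))
    (λ e → case +-cancelˡ-≡ (length seen) _ _ e of λ ())

  step′ : ∀ k m′ → k < i + length js → m′ v 0 ≡ k → Keeps (UP eachJob v c) m m′ → Inv′ k m′ →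
    Inv′ (suc k) (next v (run c m′))
  step′ k m′ k< v≡ keeps (seen , [] , eq , len , inv) = contradiction
    (trans len (cong (λ xs → i + length xs) (sym (trans eq (List.++-identityʳ seen))))) (<⇒≢ k<)
  step′ k m′ k< v≡ keeps (seen , j ∷ rest , eq , len , inv) =
    seen ∷ʳ j , rest , trans eq (sym (List.++-assoc seen (j ∷ []) rest)) ,
    trans (cong suc len) (trans (sym (+-suc i (length seen)))
      (cong (i +_) (sym (trans (List.length-++ seen) (+-comm (length seen) 1))))) ,
    step seen j rest m′ eq (trans v≡ len) keeps inv

++-injective : ∀ {A : Set} (xs xs′ : List A) {ys ys′} → length xs ≡ length xs′ →
  xs ++ ys ≡ xs′ ++ ys′ → xs ≡ xs′ × ys ≡ ys′
++-injective []       []         _  eq = refl , eq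
++-injective (x ∷ xs) (x′ ∷ xs′) len eq =
  let eqs , rest = ++-injective xs xs′ (suc-injective len) (List.∷-injectiveʳ eq)
  in cong₂ _∷_ (List.∷-injectiveˡ eq) eqs , rest

reverse-split : ∀ {A : Set} {js : List A} xs ys → reverse js ≡ xs ++ ys → js ≡ reverse ys ++ reverse xs
reverse-split xs ys eq =
  trans (sym (List.reverse-involutive _)) (trans (cong reverse eq) (List.reverse-++ xs ys))

padded-toℕ : ∀ {n} (f : Fin n → ℕ) j → padded f (toℕ j) ≡ f j
padded-toℕ f zero    = refl
padded-toℕ f (suc j) = padded-toℕ (λ i → f (suc i)) j

total-∷ʳ : ∀ {A : Set} (f : A → ℕ) xs j → total f (xs ∷ʳ j) ≡ total f xs + f j
total-∷ʳ f xs j = trans (total-++ f xs (j ∷ [])) (cong (total f xs +_) (+-identityʳ (f j)))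

-- Sums, sorting and prefix sums

module SettingUp (I : Instance) where

  open Instance I
  open Sequences I
  open RatioOrder I
  open TableFilling I

  length-allFin : length (allFin n) ≡ n
  length-allFin = List.length-tabulate id

  summed : Memory
  summed = run sums (input I)

  sumBody : Code
  sumBody = uᴬ ≔ ! uᴬ ⊕ pᴬ [ ! iᴬ ] ⨟ vᴬ ≔ ! vᴬ ⊕ wᴬ [ ! iᴬ ]

  sums-correct : summed uᴬ 0 ≡ P × summed vᴬ 0 ≡ total w (allFin n)
  sums-correct = list-invariant iᴬ sumBody (input I) (allFin n) 0 Sums refl (sym length-allFin) refl (refl , refl) step
    where
    Sums : List (Fin n) → List (Fin n) → Memory → Set
    Sums seen rest m = m uᴬ 0 ≡ total p seen × m vᴬ 0 ≡ total w seen
    step : ∀ seen j rest m → allFin n ≡ seen ++ j ∷ rest → m iᴬ 0 ≡ length seen →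
      Keeps sums (input I) m → Sums seen (j ∷ rest) m →
      Sums (seen ∷ʳ j) rest (next iᴬ (run sumBody m))
    step seen j rest m eq i≡ keeps (u≡ , v≡) =
      trans (cong₂ _+_ u≡ (trans (keeps pᴬ refl (m iᴬ 0)) (trans (cong (padded p) j≡) (padded-toℕ p j))))
        (sym (total-∷ʳ p seen j)) ,
      trans (cong₂ _+_ v≡ (trans (keeps wᴬ refl (m iᴬ 0)) (trans (cong (padded w) j≡) (padded-toℕ w j))))
        (sym (total-∷ʳ w seen j))
      where
      j≡ : m iᴬ 0 ≡ toℕ j
      j≡ = trans i≡ (sym (allFin-split seen eq))

  started : Memory
  started = run (bigᴬ ≔ lit 1 ⊕ ! vᴬ ⊗ ! totalᴬ) (summed [ totalᴬ ][ 0 ]≔ ⟦ ! uᴬ ⟧ summed)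

  started-basic : Basic started
  started-basic = basic
    (frame sums (input I) refl 0)
    (λ j → trans (frame sums (input I) refl (toℕ j)) (padded-toℕ p j))
    (λ j → trans (frame sums (input I) refl (toℕ j)) (padded-toℕ w j))
    (λ j → trans (frame sums (input I) refl (toℕ j)) (padded-toℕ rent j))
    (proj₁ sums-correct)
    (cong₂ (λ x y → 1 + x * y) (proj₂ sums-correct) (proj₁ sums-correct))

  key-eval : ∀ {m i j a b} → Basic m → m a 0 ≡ toℕ i → m b 0 ≡ toℕ j → ⟦ keyᵉ a b ⟧ m ≡ key i j
  key-eval {m} {i} {j} {a} {b} bs a≡ b≡ = cong₂ _+_ (cong₂ _*_ (cong₂ _*_
    (trans (cong (m wᴬ) b≡) (Basic.w≡ bs j)) (trans (cong (m pᴬ) a≡) (Basic.p≡ bs i))) (Basic.size≡ bs)) a≡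

  rankTest : Test
  rankTest = keyᵉ iᴬ jᴬ <ᵗ keyᵉ jᴬ iᴬ

  count-if : ∀ b m → run (IF b THEN uᴬ ≔ ! uᴬ ⊕ lit 1 ELSE skip) m uᴬ 0 ≡ m uᴬ 0 + (if ⟦ b ⟧ᵗ m then 1 else 0)
  count-if b m with ⟦ b ⟧ᵗ m
  ... | true  = refl
  ... | false = sym (+-identityʳ _)

  rankLoop-correct : ∀ m j → Basic m → m iᴬ 0 ≡ 0 → m uᴬ 0 ≡ 0 → m jᴬ 0 ≡ toℕ j →
    run rankLoop m uᴬ 0 ≡ rank j
  rankLoop-correct m j bs i≡ u≡ j≡ =
    list-invariant iᴬ (IF rankTest THEN uᴬ ≔ ! uᴬ ⊕ lit 1 ELSE skip) m (allFin n) 0 Count refl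
      (trans (Basic.size≡ bs) (sym length-allFin)) i≡ u≡ step
    where
    Count : List (Fin n) → List (Fin n) → Memory → Set
    Count seen rest m = m uᴬ 0 ≡ total (ahead j) seen
    step : ∀ seen i rest m′ → allFin n ≡ seen ++ i ∷ rest → m′ iᴬ 0 ≡ length seen →
      Keeps rankLoop m m′ → Count seen (i ∷ rest) m′ →
      Count (seen ∷ʳ i) rest (next iᴬ (run (IF rankTest THEN uᴬ ≔ ! uᴬ ⊕ lit 1 ELSE skip) m′))
    step seen i rest m′ eq i≡ keeps inv = trans (count-if rankTest m′)
      (trans (cong₂ _+_ inv (cong (λ t → if t then 1 else 0)
          (cong₂ _<ᵇ_ (key-eval {m′} bs′ i≡′ j≡′) (key-eval {m′} bs′ j≡′ i≡′))))
        (sym (total-∷ʳ (ahead j) seen i)))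
      where
      bs′ : Basic m′
      bs′ = basic-agrees (keeps-agrees rankLoop refl keeps) bs
      i≡′ : m′ iᴬ 0 ≡ toℕ i
      i≡′ = trans i≡ (sym (allFin-split seen eq))
      j≡′ : m′ jᴬ 0 ≡ toℕ j
      j≡′ = trans (keeps jᴬ refl 0) j≡

  rank<n : ∀ j → rank j < n
  rank<n j with xs , ys , eq ← ∈-∃++ (Perm.∈-resp-↭ (↭-sym order-↭) (∈-allFin j)) =
    subst₂ _<_ (sym (rank-order xs eq))
      (trans (sym (List.length-++ xs)) (trans (cong length (sym eq)) length-order))
      (subst (_≤ length xs + suc (length ys)) (+-comm (length xs) 1) (+-monoʳ-≤ (length xs) (s≤s z≤n)))

  sortBody : Code
  sortBody = uᴬ ≔ lit 0 ⨟ iᴬ ≔ lit 0 ⨟ rankLoop ⨟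
    orderᴬ [ ! uᴬ ]≔ ! jᴬ ⨟ reverseᴬ [ (! sizeᴬ ⊖ lit 1) ⊖ ! uᴬ ]≔ ! jᴬ

  Ranked : Fin n → Memory → Set
  Ranked j m = m orderᴬ (rank j) ≡ toℕ j × m reverseᴬ (n ∸ 1 ∸ rank j) ≡ toℕ j

  -- Distinct jobs have distinct ranks, so entering `j` does not overwrite another job. In the
  -- mirrored array this also uses that ranks are at most `n ∸ 1`, where truncated subtraction is
  -- injective.
  sortBody-correct : ∀ m j → Basic m → m jᴬ 0 ≡ toℕ j →
    Ranked j (run sortBody m) × (∀ i → i ≢ j → Ranked i m → Ranked i (run sortBody m))
  sortBody-correct m j bs j≡ =
    (trans (cong (λ k → if m₂ uᴬ 0 ≡ᵇ k then m₂ jᴬ 0 else m₂ orderᴬ k) (sym u≡))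
       (trans (cong (λ t → if t then m₂ jᴬ 0 else m₂ orderᴬ (m₂ uᴬ 0)) (≡ᵇ-refl (m₂ uᴬ 0))) j₂≡) ,
     trans (cong (λ k → if slot ≡ᵇ k then m₂ jᴬ 0 else m₂ reverseᴬ k) (sym slot≡))
       (trans (cong (λ t → if t then m₂ jᴬ 0 else m₂ reverseᴬ slot) (≡ᵇ-refl slot)) j₂≡)) ,
    λ i i≢j (o , r) →
      trans (cong (λ t → if t then m₂ jᴬ 0 else m₂ orderᴬ (rank i))
          (≡ᵇ-≢ λ e → i≢j (rank-injective i j (trans (sym e) u≡))))
        (trans (frame rankLoop m₁ refl (rank i)) o) ,
      trans (cong (λ t → if t then m₂ jᴬ 0 else m₂ reverseᴬ (n ∸ 1 ∸ rank i))
          (≡ᵇ-≢ λ e → i≢j (rank-injective i j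
            (∸-cancelˡ-≡ (rank≤ i) (rank≤ j) (trans (sym e) slot≡)))))
        (trans (frame rankLoop m₁ refl (n ∸ 1 ∸ rank i)) r)
    where
    m₁ m₂ : Memory
    m₁ = run (uᴬ ≔ lit 0 ⨟ iᴬ ≔ lit 0) m
    m₂ = run rankLoop m₁
    bs₁ : Basic m₁
    bs₁ = basic-agrees (run-agrees (uᴬ ≔ lit 0 ⨟ iᴬ ≔ lit 0) m refl) bs
    slot : ℕ
    slot = m₂ sizeᴬ 0 ∸ 1 ∸ m₂ uᴬ 0
    u≡ : m₂ uᴬ 0 ≡ rank j
    u≡ = rankLoop-correct m₁ j bs₁ refl refl j≡
    j₂≡ : m₂ jᴬ 0 ≡ toℕ j
    j₂≡ = trans (frame rankLoop m₁ refl 0) j≡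
    slot≡ : slot ≡ n ∸ 1 ∸ rank j
    slot≡ = cong₂ (λ a b → a ∸ 1 ∸ b) (trans (frame rankLoop m₁ refl 0) (Basic.size≡ bs)) u≡
    rank≤ : ∀ i → rank i ≤ n ∸ 1
    rank≤ i = ∸-monoˡ-≤ 1 (rank<n i)

  sorting-correct : ∀ m → Basic m → ∀ j → Ranked j (run sorting m)
  sorting-correct m bs j = All.lookup
    (list-invariant jᴬ sortBody m₁ (allFin n) 0 (λ seen _ m → All (λ j → Ranked j m) seen) refl
      (trans (Basic.size≡ bs) (sym length-allFin)) refl [] step) (∈-allFin j)
    where
    m₁ : Memory
    m₁ = run (jᴬ ≔ lit 0) m
    step : ∀ seen j rest m′ → allFin n ≡ seen ++ j ∷ rest → m′ jᴬ 0 ≡ length seen →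
      Keeps (UP eachJob jᴬ sortBody) m₁ m′ → All (λ j → Ranked j m′) seen →
      All (λ i → Ranked i (next jᴬ (run sortBody m′))) (seen ∷ʳ j)
    step seen j rest m′ eq j≡ keeps inv =
      All.++⁺ (All.tabulate λ {i} i∈ → proj₂ correct i
          (λ { refl → disjoint seen (subst Unique eq (allFin⁺ n)) i∈ (here refl) })
          (All.lookup inv i∈))
        (proj₁ correct ∷ [])
      where
      bs′ : Basic m′
      bs′ = basic-agrees (keeps-agrees (UP eachJob jᴬ sortBody) refl keeps)
        (basic-agrees (run-agrees (jᴬ ≔ lit 0) m refl) bs)
      correct = sortBody-correct m′ j bs′ (trans j≡ (sym (allFin-split seen eq)))

  -- In the reversed order, the jobs after `j` are those of smaller rank. So its rank is
  -- `length ys`, and its mirrored position is `length xs`.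
  sorting-listing : ∀ m → (∀ j → Ranked j m) → ∀ d → Lists (orderingᴬ d) (lineup d) m
  sorting-listing m ranked forward  xs j ys eq =
    trans (cong (m orderᴬ) (sym (rank-order xs eq))) (proj₁ (ranked j))
  sorting-listing m ranked backward xs j ys eq =
    trans (cong (m reverseᴬ) (sym slot≡)) (proj₂ (ranked j))
    where
    order≡ : order ≡ reverse ys ++ j ∷ reverse xs
    order≡ = trans (reverse-split xs (j ∷ ys) eq)
      (trans (cong (_++ reverse xs) (List.unfold-reverse j ys)) (List.++-assoc (reverse ys) (j ∷ []) (reverse xs)))
    slot≡ : n ∸ 1 ∸ rank j ≡ length xs
    slot≡ = trans (cong (n ∸ 1 ∸_) (trans (rank-order (reverse ys) order≡) (List.length-reverse ys)))
      (trans (∸-+-assoc n 1 (length ys)) (trans (cong (_∸ suc (length ys)) (sym (lineup-lengths backward xs eq)))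
        (m+n∸n≡m (length xs) (suc (length ys)))))

  prefixBody : Code
  prefixBody = prefixᴬ [ ! iᴬ ⊕ lit 1 ]≔ prefixᴬ [ ! iᴬ ] ⊕ pᴬ [ orderᴬ [ ! iᴬ ] ]

  prefixes-correct : ∀ m → Basic m → (∀ d → Lists (orderingᴬ d) (lineup d) m) →
    ∀ xs ys → order ≡ xs ++ ys → run prefixes m prefixᴬ (length xs) ≡ total p xs
  prefixes-correct m bs lists xs ys eq =
    list-invariant iᴬ prefixBody m₁ order 0 Prefix refl (trans (Basic.size≡ bs) (sym length-order)) refl start step
      xs ys eq (≤-trans (m≤m+n _ _) (≤-reflexive (sym (trans (cong length eq) (List.length-++ xs)))))
    where
    m₁ : Memory
    m₁ = run (prefixᴬ ≔ lit 0 ⨟ iᴬ ≔ lit 0) m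
    Prefix : List (Fin n) → List (Fin n) → Memory → Set
    Prefix seen rest m = ∀ xs ys → order ≡ xs ++ ys → length xs ≤ length seen → m prefixᴬ (length xs) ≡ total p xs
    start : Prefix [] order m₁
    start [] ys eq z≤n = refl
    step : ∀ seen j rest m′ → order ≡ seen ++ j ∷ rest → m′ iᴬ 0 ≡ length seen →
      Keeps (UP eachJob iᴬ prefixBody) m₁ m′ → Prefix seen (j ∷ rest) m′ →
      Prefix (seen ∷ʳ j) rest (next iᴬ (run prefixBody m′))
    step seen j rest m′ order≡ i≡ keeps inv xs ys eq xs≤ with length xs ≤? length seen
    ... | yes xs≤′ = trans (write-elsewhere prefixᴬ m′ (m′ iᴬ 0 + 1) _ (length xs)
            (λ e → <⇒≱ (≤-reflexive (trans (+-comm 1 (length seen)) (trans (cong (_+ 1) (sym i≡)) e))) xs≤′))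
          (inv xs ys eq xs≤′)
    ... | no xs≰ = trans
          (cong (run prefixBody m′ prefixᴬ) len)
          (trans (write-same prefixᴬ m′ (m′ iᴬ 0 + 1) (⟦ prefixᴬ [ ! iᴬ ] ⊕ pᴬ [ orderᴬ [ ! iᴬ ] ] ⟧ m′))
          (trans (cong₂ _+_ (trans (cong (m′ prefixᴬ) i≡) (inv seen (j ∷ rest) order≡ ≤-refl)) time)
          (trans (sym (total-∷ʳ p seen j)) (cong (total p) (sym xs≡)))))
      where
      length-∷ʳ : length (seen ∷ʳ j) ≡ length seen + 1
      length-∷ʳ = List.length-++ seen
      xs-length : length xs ≡ length (seen ∷ʳ j)
      xs-length = ≤-antisym xs≤ (≤-trans (≤-reflexive (trans length-∷ʳ (+-comm (length seen) 1))) (≰⇒> xs≰))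
      len : length xs ≡ m′ iᴬ 0 + 1
      len = trans xs-length (trans length-∷ʳ (cong (_+ 1) (sym i≡)))
      xs≡ : xs ≡ seen ∷ʳ j
      xs≡ = proj₁ (++-injective xs (seen ∷ʳ j) xs-length
        (trans (sym eq) (trans order≡ (sym (List.++-assoc seen (j ∷ []) rest)))))
      agrees : Agrees (orderᴬ ∷ pᴬ ∷ []) m m′
      agrees = agrees-trans {m = m} {m₁} {m′} (run-agrees (prefixᴬ ≔ lit 0 ⨟ iᴬ ≔ lit 0) m refl)
        (keeps-agrees (UP eachJob iᴬ prefixBody) refl keeps)
      time : m′ pᴬ (m′ orderᴬ (m′ iᴬ 0)) ≡ p j
      time = trans (cong (m′ pᴬ) (trans (cong (m′ orderᴬ) i≡)
          (trans (agrees orderᴬ (here refl) (length seen)) (lists forward seen j rest order≡))))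
        (trans (agrees pᴬ (there (here refl)) (toℕ j)) (Basic.p≡ bs j))

  prepare-setup : ∀ m → Basic m → Setup (run (sorting ⨟ prefixes) m)
  prepare-setup m b = setup
    (basic-agrees (run-agrees (sorting ⨟ prefixes) m refl) b)
    (λ d xs j ys eq → trans (frame prefixes (run sorting m) (kept d) (length xs)) (lists d xs j ys eq))
    (prefixes-correct (run sorting m) (basic-agrees (run-agrees sorting m refl) b) lists)
    where
    lists : ∀ d → Lists (orderingᴬ d) (lineup d) (run sorting m)
    lists = sorting-listing (run sorting m) (sorting-correct m b)
    kept : ∀ d → writes (orderingᴬ d) prefixes ≡ false
    kept forward  = refl
    kept backward = refl

-- Reconstructing and writing out a sequence

preparedArrays : List ArrayName
preparedArrays = setupArrays ++ forwardᴬ ∷ backwardᴬ ∷ []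

applyUpTo-cong : ∀ {A : Set} {f g : ℕ → A} k → (∀ i → i < k → f i ≡ g i) → applyUpTo f k ≡ applyUpTo g k
applyUpTo-cong zero    h = refl
applyUpTo-cong (suc k) h = cong₂ _∷_ (h 0 (s≤s z≤n)) (applyUpTo-cong k (λ i i<k → h (suc i) (s≤s i<k)))

module Outputting (I : Instance) where

  open Instance I
  open Sequences I
  open RatioOrder I
  open Verification I
  open TableFilling I
  open Table p w rent P ∞
  open Combination p w rent P ∞

  record Prepared (m : Memory) : Set where
    constructor prepared
    field
      isSetup : Setup m
      filled  : ∀ d → Filled d m

  prepared-agrees : ∀ {m m′} → Agrees preparedArrays m m′ → Prepared m → Prepared m′
  prepared-agrees ag (prepared s f) = prepared
    (setup-agrees (λ a a∈ → ag a (∈-++⁺ˡ a∈)) s)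
    (λ d xs ys eq {x} {y} x≤ y≤ →
      trans (ag (tableᴬ d) (table∈ d) (index (length xs) x y)) (f d xs ys eq x≤ y≤))
    where
    table∈ : ∀ d → tableᴬ d ∈ preparedArrays
    table∈ forward  = ∈-++⁺ʳ setupArrays (here refl)
    table∈ backward = ∈-++⁺ʳ setupArrays (there (here refl))

  classOf : Memory → Fin n → ℕ
  classOf m j = m classᴬ (toℕ j)

  withinBranch outsideBranch walkBody : Direction → Code
  withinBranch  d = classᴬ [ jobᵉ d ]≔ lit 1 ⨟ xᴬ ≔ ! xᴬ ⊕ timeᵉ d
  outsideBranch d = classᴬ [ jobᵉ d ]≔ lit (outsideClass d) ⨟ yᴬ ≔ ! yᴬ ⊕ timeᵉ d
  walkBody d = IF withinᵉ d ≤ᵗ outsideᵉ d THEN withinBranch d ELSE outsideBranch d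

  outsideClass≢1 : ∀ d → outsideClass d ≢ 1
  outsideClass≢1 forward  ()
  outsideClass≢1 backward ()

  walk-prepared : ∀ d → avoids preparedArrays (walk d) ≡ true
  walk-prepared forward  = refl
  walk-prepared backward = refl

  walk-wf : ∀ d → wellFormed (walk d) ≡ true
  walk-wf forward  = refl
  walk-wf backward = refl

  time-frame : ∀ d m k v → ⟦ timeᵉ d ⟧ (m [ classᴬ ][ k ]≔ v) ≡ ⟦ timeᵉ d ⟧ m
  time-frame forward  m k v = refl
  time-frame backward m k v = refl

  Marks : Fin n → ℕ → ℕ → ℕ → Memory → Memory → Set
  Marks j c x y m m′ = m′ xᴬ 0 ≡ x × m′ yᴬ 0 ≡ y × (∀ k → m′ classᴬ k ≡ (if toℕ j ≡ᵇ k then c else m classᴬ k))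

  module _ (j : Fin n) (c x y : ℕ) (m m′ : Memory) (marks : Marks j c x y m m′) where

    marks-same : classOf m′ j ≡ c
    marks-same = trans (proj₂ (proj₂ marks) (toℕ j)) (cong (λ t → if t then c else classOf m j) (≡ᵇ-refl (toℕ j)))

    marks-other : ∀ i → i ≢ j → classOf m′ i ≡ classOf m i
    marks-other i i≢j = trans (proj₂ (proj₂ marks) (toℕ i))
      (cong (λ t → if t then c else classOf m i) (≡ᵇ-≢ λ e → i≢j (Fin.toℕ-injective (sym e))))

  ≤ᵇ-cases : ∀ a b → ((a ≤ᵇ b) ≡ true × a ≤ b) ⊎ ((a ≤ᵇ b) ≡ false × b < a)
  ≤ᵇ-cases a b with a ≤ᵇ b in eq
  ... | true  = inj₁ (refl , ≤ᵇ⇒≤ a b (subst T (sym eq) _))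
  ... | false = inj₂ (refl , ≰⇒> λ h → subst T eq (≤⇒≤ᵇ h))

  module WalkCorrect (d : Direction) (m : Memory) (prep : Prepared m) (xs js : List (Fin n))
                     (lineup≡ : lineup d ≡ xs ++ js) (i≡ : m iᴬ 0 ≡ length xs)
                     (un : Unique js) (x≤ : m xᴬ 0 ≤ P) (y≤ : m yᴬ 0 ≤ P)
                     (<∞ : table d js (m xᴬ 0) (m yᴬ 0) < ∞) where

    -- Both walks write to the same array of classes. The second component protects what the other
    -- walk has assigned to its own jobs.
    Inv : List (Fin n) → List (Fin n) → Memory → Set
    Inv seen rest m′ =
      Walk d (outsideClass d) js (m xᴬ 0) (m yᴬ 0) (classOf m′) rest (m′ xᴬ 0) (m′ yᴬ 0)
      × (∀ i → i ∉ js → classOf m′ i ≡ classOf m i)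

    step : ∀ seen j rest m′ → js ≡ seen ++ j ∷ rest → m′ iᴬ 0 ≡ length xs + length seen →
      Keeps (walk d) m m′ → Inv seen (j ∷ rest) m′ → Inv (seen ∷ʳ j) rest (next iᴬ (run (walkBody d) m′))
    step seen j rest m′ js≡ i≡′ keeps (wk , same) =
      go (≤ᵇ-cases (within d (j ∷ rest) (m′ xᴬ 0) (m′ yᴬ 0)) (outside d (j ∷ rest) (m′ xᴬ 0) (m′ yᴬ 0)))
      where
      prep′ : Prepared m′
      prep′ = prepared-agrees (keeps-agrees (walk d) (walk-prepared d) keeps) prep

      xs′ : List (Fin n)
      xs′ = xs ++ seen

      lineup≡′ : lineup d ≡ xs′ ++ j ∷ rest
      lineup≡′ = trans lineup≡ (trans (cong (xs ++_) js≡) (sym (List.++-assoc xs seen (j ∷ rest))))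

      row : Row d (suc (length xs′)) rest m′
      row {x} {y} x≤ y≤ = subst (λ i → m′ (tableᴬ d) (index i x y) ≡ table d rest x y)
        (trans (List.length-++ xs′) (+-comm (length xs′) 1))
        (Prepared.filled prep′ d (xs′ ∷ʳ j) rest (trans lineup≡′ (sym (List.++-assoc xs′ (j ∷ []) rest))) x≤ y≤)

      open Eval {d} {m′} {length xs′} {j} {rest} (Setup.basics (Prepared.isSetup prep′))
        (trans i≡′ (sym (List.length-++ xs)))
        (Setup.listing (Prepared.isSetup prep′) d xs′ j rest lineup≡′)
        refl refl (Walk.x≤P wk) (Walk.y≤P wk) row

      test≡ : ⟦ withinᵉ d ≤ᵗ outsideᵉ d ⟧ᵗ m′
        ≡ (within d (j ∷ rest) (m′ xᴬ 0) (m′ yᴬ 0) ≤ᵇ outside d (j ∷ rest) (m′ xᴬ 0) (m′ yᴬ 0))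
      test≡ = cong₂ _≤ᵇ_ within-eval outside-eval

      M : Memory
      M = next iᴬ (run (walkBody d) m′)

      untouched : ∀ c x y → Marks j c x y m′ M → ∀ i → i ∉ js → classOf M i ≡ classOf m i
      untouched c x y marks i i∉ = trans
        (marks-other j c x y m′ M marks i λ { refl → i∉ (subst (j ∈_) (sym js≡) (∈-++⁺ʳ seen (here refl))) })
        (same i i∉)

      branch : ∀ {b c} → ⟦ withinᵉ d ≤ᵗ outsideᵉ d ⟧ᵗ m′ ≡ b → c ≡ (if b then withinBranch d else outsideBranch d) →
        run (walkBody d) m′ ≡ run c m′
      branch {true}  eq refl rewrite eq = refl
      branch {false} eq refl rewrite eq = refl

      go : _ → Inv (seen ∷ʳ j) rest M
      go (inj₁ (t , u≤v)) =
        subst₂ (λ x y → Walk d (outsideClass d) js (m xᴬ 0) (m yᴬ 0) (classOf M) rest x y)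
          (sym (proj₁ marks)) (sym (proj₁ (proj₂ marks)))
          (walk-within (outsideClass≢1 d) un <∞ wk (marks-other j 1 (m′ xᴬ 0 + p j) (m′ yᴬ 0) m′ M marks)
            u≤v (marks-same j 1 (m′ xᴬ 0 + p j) (m′ yᴬ 0) m′ M marks)) ,
        untouched 1 (m′ xᴬ 0 + p j) (m′ yᴬ 0) marks
        where
        marks : Marks j 1 (m′ xᴬ 0 + p j) (m′ yᴬ 0) m′ M
        marks rewrite branch (trans test≡ t) refl | time-frame d m′ (⟦ jobᵉ d ⟧ m′) 1 | time-eval | job-eval =
          refl , refl , λ k → refl
      go (inj₂ (t , v<u)) =
        subst₂ (λ x y → Walk d (outsideClass d) js (m xᴬ 0) (m yᴬ 0) (classOf M) rest x y)
          (sym (proj₁ marks)) (sym (proj₁ (proj₂ marks)))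
          (walk-outside (outsideClass≢1 d) un <∞ wk
            (marks-other j (outsideClass d) (m′ xᴬ 0) (m′ yᴬ 0 + p j) m′ M marks) v<u
            (marks-same j (outsideClass d) (m′ xᴬ 0) (m′ yᴬ 0 + p j) m′ M marks)) ,
        untouched (outsideClass d) (m′ xᴬ 0) (m′ yᴬ 0 + p j) marks
        where
        marks : Marks j (outsideClass d) (m′ xᴬ 0) (m′ yᴬ 0 + p j) m′ M
        marks rewrite branch (trans test≡ t) refl
          | time-frame d m′ (⟦ jobᵉ d ⟧ m′) (outsideClass d) | time-eval | job-eval =
          refl , refl , λ k → refl

    walk-correct : let m′ = run (walk d) m in
      Optimal d (outsideClass d) js (m xᴬ 0) (m yᴬ 0) (classOf m′)
      × (∀ i → i ∉ js → classOf m′ i ≡ classOf m i)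
    walk-correct = walk-end <∞ (proj₁ end) , proj₂ end
      where
      end : Inv js [] (run (walk d) m)
      end = list-invariant iᴬ (walkBody d) m js (length xs) Inv (walk-wf d)
        (trans (Basic.size≡ (Setup.basics (Prepared.isSetup prep))) (sym (lineup-lengths d xs lineup≡)))
        i≡ (walk-start x≤ y≤ , λ i _ → refl) step

  -- The rows are stored without separators, so what has been written is a single list with
  -- `positionᴬ` as its length.
  Written : Memory → List ℕ → Set
  Written m ks = applyUpTo (m sequencesᴬ) (m positionᴬ 0) ≡ ks

  emitBranch : Code
  emitBranch = sequencesᴬ [ ! positionᴬ ]≔ orderᴬ [ ! iᴬ ] ⨟ positionᴬ ≔ ! positionᴬ ⊕ lit 1

  emitBody : ℕ → Code
  emitBody c = IF classᴬ [ orderᴬ [ ! iᴬ ] ] ≡ᵗ lit c THEN emitBranch ELSE skip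

  emitBranch-correct : ∀ {m ks} → Written m ks → Written (run emitBranch m) (ks ∷ʳ m orderᴬ (m iᴬ 0))
  emitBranch-correct {m} {ks} wr = begin
    applyUpTo g (m positionᴬ 0 + 1)
      ≡⟨ cong (applyUpTo g) (+-comm (m positionᴬ 0) 1) ⟩
    applyUpTo g (suc (m positionᴬ 0))
      ≡⟨ sym (List.applyUpTo-∷ʳ g (m positionᴬ 0)) ⟩
    applyUpTo g (m positionᴬ 0) ∷ʳ g (m positionᴬ 0)
      ≡⟨ cong₂ _∷ʳ_ (trans (applyUpTo-cong (m positionᴬ 0) below) wr)
           (write-same sequencesᴬ m (m positionᴬ 0) (m orderᴬ (m iᴬ 0))) ⟩
    ks ∷ʳ m orderᴬ (m iᴬ 0) ∎
    where
    open ≡-Reasoning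
    g : ℕ → ℕ
    g = run emitBranch m sequencesᴬ
    below : ∀ k → k < m positionᴬ 0 → g k ≡ m sequencesᴬ k
    below k k< = write-elsewhere sequencesᴬ m (m positionᴬ 0) (m orderᴬ (m iᴬ 0)) k (λ e → <⇒≢ k< (sym e))

  emit-correct : ∀ c m ks → Setup m → Written m ks →
    Written (run (emit c) m) (ks ++ map toℕ (select (classOf m) c order))
  emit-correct c m ks s wr =
    list-invariant iᴬ (emitBody c) m₁ order 0 Inv refl
      (trans (Basic.size≡ (Setup.basics s)) (sym length-order)) refl (trans wr (sym (List.++-identityʳ ks))) step
    where
    m₁ : Memory
    m₁ = run (iᴬ ≔ lit 0) m
    f : Fin n → ℕ
    f = classOf m
    Inv : List (Fin n) → List (Fin n) → Memory → Set
    Inv seen rest m′ = Written m′ (ks ++ map toℕ (select f c seen))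
    step : ∀ seen j rest m′ → order ≡ seen ++ j ∷ rest → m′ iᴬ 0 ≡ length seen →
      Keeps (UP eachJob iᴬ (emitBody c)) m₁ m′ → Inv seen (j ∷ rest) m′ →
      Inv (seen ∷ʳ j) rest (next iᴬ (run (emitBody c) m′))
    step seen j rest m′ eq i≡ keeps inv with f j ≟ c
    ... | yes fj≡c rewrite select-++ f c seen (j ∷ []) | select-accept f [] fj≡c
      | List.map-++ toℕ (select f c seen) (j ∷ []) =
      subst (λ M → Written M (ks ++ (map toℕ (select f c seen) ∷ʳ toℕ j))) (sym taken)
        (subst (Written (run emitBranch m′)) (trans (cong (_ ∷ʳ_) job≡) (List.++-assoc ks _ _))
          (emitBranch-correct {m′} inv))
      where
      job≡ : m′ orderᴬ (m′ iᴬ 0) ≡ toℕ j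
      job≡ = trans (cong (m′ orderᴬ) i≡) (trans (keeps orderᴬ refl (length seen)) (Setup.listing s forward seen j rest eq))
      taken : run (emitBody c) m′ ≡ run emitBranch m′
      taken rewrite job≡ | keeps classᴬ refl (toℕ j) | fj≡c | ≡ᵇ-refl c = refl
    ... | no fj≢c rewrite select-++ f c seen (j ∷ []) | select-reject f [] fj≢c | List.++-identityʳ (select f c seen) =
      subst (λ M → Written M (ks ++ map toℕ (select f c seen))) (sym taken) inv
      where
      job≡ : m′ orderᴬ (m′ iᴬ 0) ≡ toℕ j
      job≡ = trans (cong (m′ orderᴬ) i≡) (trans (keeps orderᴬ refl (length seen)) (Setup.listing s forward seen j rest eq))
      taken : run (emitBody c) m′ ≡ m′
      taken rewrite job≡ | keeps classᴬ refl (toℕ j) | ≡ᵇ-≢ fj≢c = refl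

  Optimal-cong : ∀ {d c js x y f g} → All (λ j → f j ≡ g j) js → Optimal d c js x y f → Optimal d c js x y g
  Optimal-cong {d} {c} {js} {x} {y} {f} {g} eqs opt = record
    { okay  = All.zipWith (λ (eq , ok) →
        [ (λ e → inj₁ (trans (sym eq) e)) , (λ (e , z) → inj₂ (trans (sym eq) e , z)) ]′ ok) (eqs , Optimal.okay opt)
    ; ends  = trans (cong (λ xs → y + total p xs) (sym (select-cong c eqs))) (Optimal.ends opt)
    ; cost≡ = trans (cong₂ (λ xs ys → along d x xs + along d y ys) (sym (select-cong 1 eqs)) (sym (select-cong c eqs)))
        (Optimal.cost≡ opt) }

  regroup : ∀ {ks} (xs ys zs : List (Fin n)) →
    ((ks ++ map toℕ xs) ++ map toℕ ys) ++ map toℕ zs ≡ ks ++ map toℕ (xs ++ ys ++ zs)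
  regroup {ks} xs ys zs rewrite List.map-++ toℕ xs (ys ++ zs) | List.map-++ toℕ ys zs
    | List.++-assoc ks (map toℕ xs) (map toℕ ys) =
    trans (List.++-assoc ks _ (map toℕ zs)) (cong (ks ++_) (List.++-assoc (map toℕ xs) (map toℕ ys) (map toℕ zs)))

  emission-correct : ∀ m ks → Setup m → Written m ks →
    Written (run emission m) (ks ++ map toℕ (arrange (classOf m) order))
  emission-correct m ks s wr = subst (Written (run emission m)) collect
    (emit-correct 2 m₂ _ s₂ (emit-correct 1 m₁ _ s₁ (emit-correct 0 m ks s wr)))
    where
    m₁ m₂ : Memory
    m₁ = run (emit 0) m
    m₂ = run (emit 1) m₁
    s₁ : Setup m₁
    s₁ = setup-agrees (run-agrees (emit 0) m refl) s
    s₂ : Setup m₂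
    s₂ = setup-agrees (run-agrees (emit 1) m₁ refl) s₁
    class₁ : ∀ j → classOf m₁ j ≡ classOf m j
    class₁ j = frame (emit 0) m refl (toℕ j)
    class₂ : ∀ j → classOf m₂ j ≡ classOf m j
    class₂ j = trans (frame (emit 1) m₁ refl (toℕ j)) (class₁ j)
    collect : ((ks ++ map toℕ (select (classOf m) 0 order)) ++ map toℕ (select (classOf m₁) 1 order))
        ++ map toℕ (select (classOf m₂) 2 order)
      ≡ ks ++ map toℕ (arrange (classOf m) order)
    collect = trans
      (cong₂ (λ xs ys → ((ks ++ map toℕ (select (classOf m) 0 order)) ++ map toℕ xs) ++ map toℕ ys)
        (select-cong 1 (All.universal class₁ order)) (select-cong 2 (All.universal class₂ order)))
      (regroup (select (classOf m) 0 order) (select (classOf m) 1 order) (select (classOf m) 2 order))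

  run-chain : ∀ {o} a b c d e m → o ≡ (((a ⨟ b) ⨟ c ⨟ d) ⨟ e) →
    run o m ≡ run e (run d (run c (run b (run a m))))
  run-chain a b c d e m refl = refl

  at : ∀ {m m′ : Memory} {a k} → m ≡ m′ → m a k ≡ m′ a k
  at refl = refl

  -- The intermediate memories are variables here: comparing their definitions
  -- would make the type checker unfold the program.
  module OutputCorrect (m m₁ m₂ m₃ m₄ : Memory)
                       (m₁≡ : m₁ ≡ run (place backward) m) (m₂≡ : m₂ ≡ run (walk backward) m₁)
                       (m₃≡ : m₃ ≡ run (place forward) m₂) (m₄≡ : m₄ ≡ run (walk forward) m₃)
                       (prep : Prepared m) (front back : List (Fin n)) (a e : ℕ) (ks : List ℕ)
                       (order≡ : order ≡ front ++ back) (split≡ : m splitᴬ 0 ≡ length front)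
                       (start≡ : m startᴬ 0 ≡ a) (e≡ : m eᴬ 0 ≡ e) (a+e≤P : a + e ≤ P)
                       (back<∞ : table backward (reverse front) (P ∸ total p front) (P ∸ a) < ∞)
                       (forth<∞ : table forward back (total p front) (a + e) < ∞)
                       (written : Written m ks) where

    prep₁ : Prepared m₁
    prep₁ = subst Prepared (sym m₁≡) (prepared-agrees (run-agrees (place backward) m refl) prep)

    prep₂ : Prepared m₂
    prep₂ = subst Prepared (sym m₂≡) (prepared-agrees (run-agrees (walk backward) m₁ refl) prep₁)

    prep₃ : Prepared m₃
    prep₃ = subst Prepared (sym m₃≡) (prepared-agrees (run-agrees (place forward) m₂ refl) prep₂)

    prep₄ : Prepared m₄
    prep₄ = subst Prepared (sym m₄≡) (prepared-agrees (run-agrees (walk forward) m₃ refl) prep₃)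

    basics₀ : Basic m
    basics₀ = Setup.basics (Prepared.isSetup prep)

    reverse≡ : reverse order ≡ reverse back ++ reverse front
    reverse≡ = trans (cong reverse order≡) (List.reverse-++ front back)

    prefix≡ : m prefixᴬ (m splitᴬ 0) ≡ total p front
    prefix≡ = trans (cong (m prefixᴬ) split≡) (Setup.prefix≡ (Prepared.isSetup prep) front back order≡)

    i₁≡ : m₁ iᴬ 0 ≡ length (reverse back)
    i₁≡ = trans (trans (at m₁≡) (cong₂ _∸_ (Basic.size≡ basics₀) split≡))
      (trans (cong (_∸ length front) (sym (lineup-lengths forward front order≡)))
        (trans (m+n∸m≡n (length front) (length back)) (sym (List.length-reverse back))))

    x₁≡ : m₁ xᴬ 0 ≡ P ∸ total p front
    x₁≡ = trans (at m₁≡) (cong₂ _∸_ (Basic.total≡ basics₀) prefix≡)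

    y₁≡ : m₁ yᴬ 0 ≡ P ∸ a
    y₁≡ = trans (at m₁≡) (cong₂ _∸_ (Basic.total≡ basics₀) start≡)

    unique-parts : Unique (front ++ back)
    unique-parts = subst Unique order≡ order-unique

    unique-front : Unique (reverse front)
    unique-front = Unique-++ʳ (reverse back) (subst Unique reverse≡
      (Unique-↭ (↭-sym (Perm.↭-reverse order)) order-unique))

    module W₁ = WalkCorrect backward m₁ prep₁ (reverse back) (reverse front) reverse≡ i₁≡ unique-front
      (≤-trans (≤-reflexive x₁≡) (m∸n≤m P (total p front))) (≤-trans (≤-reflexive y₁≡) (m∸n≤m P a))
      (subst₂ (λ x y → table backward (reverse front) x y < ∞) (sym x₁≡) (sym y₁≡) back<∞)

    kept₂ : ∀ b → writes b (place backward) ≡ false → writes b (walk backward) ≡ false → ∀ k → m₂ b k ≡ m b k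
    kept₂ b h h′ k = trans (at m₂≡) (trans (frame (walk backward) m₁ h′ k)
      (trans (at m₁≡) (frame (place backward) m h k)))

    split₂≡ : m₂ splitᴬ 0 ≡ length front
    split₂≡ = trans (kept₂ splitᴬ refl refl 0) split≡

    i₃≡ : m₃ iᴬ 0 ≡ length front
    i₃≡ = trans (at m₃≡) split₂≡

    x₃≡ : m₃ xᴬ 0 ≡ total p front
    x₃≡ = trans (at m₃≡) (trans (cong (m₂ prefixᴬ) split₂≡)
      (Setup.prefix≡ (Prepared.isSetup prep₂) front back order≡))

    y₃≡ : m₃ yᴬ 0 ≡ a + e
    y₃≡ = trans (at m₃≡)
      (cong₂ _+_ (trans (kept₂ startᴬ refl refl 0) start≡) (trans (kept₂ eᴬ refl refl 0) e≡))

    front≤P : total p front ≤ P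
    front≤P = ≤-trans (m≤m+n _ (total p back))
      (≤-reflexive (trans (sym (total-++ p front back)) (trans (cong (total p) (sym order≡)) total-order)))

    module W₂ = WalkCorrect forward m₃ prep₃ front back order≡ i₃≡ (Unique-++ʳ front unique-parts)
      (≤-trans (≤-reflexive x₃≡) front≤P) (≤-trans (≤-reflexive y₃≡) a+e≤P)
      (subst₂ (λ x y → table forward back x y < ∞) (sym x₃≡) (sym y₃≡) forth<∞)

    class : Fin n → ℕ
    class = classOf m₄

    -- The forward walk changes the classes of jobs in the back only, so the result of the backward
    -- walk on the front survives it.
    optimal-front : Optimal backward 0 (reverse front) (P ∸ total p front) (P ∸ a) class
    optimal-front = Optimal-cong
      (All.tabulate λ {j} j∈ → sym (trans (at m₄≡) (trans (proj₂ W₂.walk-correct j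
        (disjoint front unique-parts (Perm.∈-resp-↭ (Perm.↭-reverse front) j∈)))
        (trans (at m₃≡) (frame (place forward) m₂ refl (toℕ j))))))
      (subst (λ M → Optimal backward 0 (reverse front) (P ∸ total p front) (P ∸ a) (classOf M)) (sym m₂≡)
        (subst₂ (λ x y → Optimal backward 0 (reverse front) x y (classOf (run (walk backward) m₁))) x₁≡ y₁≡
          (proj₁ W₁.walk-correct)))

    optimal-back : Optimal forward 2 back (total p front) (a + e) class
    optimal-back = subst (λ M → Optimal forward 2 back (total p front) (a + e) (classOf M)) (sym m₄≡)
      (subst₂ (λ x y → Optimal forward 2 back x y (classOf (run (walk forward) m₃))) x₃≡ y₃≡ (proj₁ W₂.walk-correct))

    kept₄ : ∀ b → writes b (place backward) ≡ false → writes b (walk backward) ≡ false →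
      writes b (place forward) ≡ false → writes b (walk forward) ≡ false → ∀ k → m₄ b k ≡ m b k
    kept₄ b h₁ h₂ h₃ h₄ k = trans (at m₄≡) (trans (frame (walk forward) m₃ h₄ k)
      (trans (at m₃≡) (trans (frame (place forward) m₂ h₃ k) (kept₂ b h₁ h₂ k))))

    written₄ : Written m₄ ks
    written₄ = trans (cong (applyUpTo (m₄ sequencesᴬ)) (kept₄ positionᴬ refl refl refl refl 0))
      (trans (applyUpTo-cong (m positionᴬ 0) (λ k _ → kept₄ sequencesᴬ refl refl refl refl k)) written)

  record Emitted (front back : List (Fin n)) (a e : ℕ) (ks : List ℕ) (m : Memory) : Set where
    field
      class         : Fin n → ℕ
      optimal-front : Optimal backward 0 (reverse front) (P ∸ total p front) (P ∸ a) class
      optimal-back  : Optimal forward 2 back (total p front) (a + e) class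
      written       : Written m (ks ++ map toℕ (arrange class order))

  emitted : ∀ {m front back a e ks} → Prepared m → order ≡ front ++ back → m splitᴬ 0 ≡ length front →
    m startᴬ 0 ≡ a → m eᴬ 0 ≡ e → a + e ≤ P →
    table backward (reverse front) (P ∸ total p front) (P ∸ a) < ∞ →
    table forward back (total p front) (a + e) < ∞ →
    Written m ks → Emitted front back a e ks (run output m)
  emitted {m} {front} {back} {a} {e} {ks} ready order≡ split≡ start≡ e≡ a+e≤P back<∞ forth<∞ written =
    go (run (place backward) m) (run (walk backward) (run (place backward) m))
       (run (place forward) (run (walk backward) (run (place backward) m)))
       (run (walk forward) (run (place forward) (run (walk backward) (run (place backward) m))))
       refl refl refl refl chain
    where
    chain = run-chain {output} (place backward) (walk backward) (place forward) (walk forward) emission m refl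

    go : ∀ m₁ m₂ m₃ m₄ → m₁ ≡ run (place backward) m → m₂ ≡ run (walk backward) m₁ →
      m₃ ≡ run (place forward) m₂ → m₄ ≡ run (walk forward) m₃ → run output m ≡ run emission m₄ →
      Emitted front back a e ks (run output m)
    go m₁ m₂ m₃ m₄ m₁≡ m₂≡ m₃≡ m₄≡ out≡ = subst (Emitted front back a e ks) (sym out≡) (record
      { class         = class
      ; optimal-front = optimal-front
      ; optimal-back  = optimal-back
      ; written       = emission-correct m₄ ks (Prepared.isSetup prep₄) written₄ })
      where open OutputCorrect m m₁ m₂ m₃ m₄ m₁≡ m₂≡ m₃≡ m₄≡ ready front back a e ks
                   order≡ split≡ start≡ e≡ a+e≤P back<∞ forth<∞ written

applyUpTo-+ : ∀ {A : Set} (f : ℕ → A) k l → applyUpTo f (k + l) ≡ applyUpTo f k ++ applyUpTo (λ i → f (k + i)) l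
applyUpTo-+ f zero    l = refl
applyUpTo-+ f (suc k) l = cong (f 0 ∷_) (applyUpTo-+ (λ i → f (suc i)) k l)

rows-concat : ∀ n {f : ℕ → ℕ} {l} rows → All (λ row → length row ≡ n) rows → applyUpTo f l ≡ concat rows →
  applyUpTo (λ k → applyUpTo (λ i → f (k * n + i)) n) (length rows) ≡ rows
rows-concat n [] [] eq = refl
rows-concat n {f} {l} (row ∷ rows) (len ∷ lens) eq = cong₂ _∷_ (proj₁ parts)
  (trans (applyUpTo-cong (length rows) (λ k _ → applyUpTo-cong n (λ i _ → cong f (+-assoc n (k * n) i))))
    (rows-concat n rows lens (proj₂ parts)))
  where
  l≡ : l ≡ n + length (concat rows)
  l≡ = trans (sym (List.length-applyUpTo f l)) (trans (cong length eq)
    (trans (List.length-++ row) (cong (_+ length (concat rows)) len)))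
  parts : applyUpTo f n ≡ row × applyUpTo (λ i → f (n + i)) (length (concat rows)) ≡ concat rows
  parts = ++-injective (applyUpTo f n) row (trans (List.length-applyUpTo f n) (sym len))
    (trans (sym (applyUpTo-+ f n _)) (trans (cong (applyUpTo f) (sym l≡)) eq))

-- The best candidate for a given length of the renting period

module Searching (I : Instance) where

  open Instance I
  open Sequences I
  open RatioOrder I
  open Frontiers I
  open Verification I
  open TableFilling I
  open Outputting I
  open Table p w rent P ∞
  open Combination p w rent P ∞
  open Normalise Fin._≟_ p w rent p-positive

  order-split : ∀ {k} → k ≤ n → ∃[ front ] ∃[ back ] order ≡ front ++ back × length front ≡ k
  order-split {k} k≤n = take k order , drop k order , sym (List.take++drop≡id k order) ,
    trans (List.length-take k order) (trans (cong (k ⊓_) length-order) (m≤n⇒m⊓n≡m k≤n))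

  combined-eval : ∀ {m front back a e} → Prepared m → order ≡ front ++ back → m kᴬ 0 ≡ length front →
    m aᴬ 0 ≡ a → m eᴬ 0 ≡ e → ⟦ combinedᵉ ⟧ m ≡ combined front back a e
  combined-eval {m} {front} {back} {a} {e} ready order≡ k≡ a≡ e≡ =
    cong₂ _+_ (cong₂ _+_ backward≡ forward≡)
      (cong₂ _*_ (Basic.big≡ b) (cong₂ _∸_ (cong₂ _+_ a≡ e≡) (Basic.total≡ b)))
    where
    b : Basic m
    b = Setup.basics (Prepared.isSetup ready)

    front≤P : total p front ≤ P
    front≤P = ≤-trans (m≤m+n _ (total p back))
      (≤-reflexive (trans (sym (total-++ p front back)) (trans (cong (total p) (sym order≡)) total-order)))

    prefix≡ : m prefixᴬ (m kᴬ 0) ≡ total p front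
    prefix≡ = trans (cong (m prefixᴬ) k≡) (Setup.prefix≡ (Prepared.isSetup ready) front back order≡)

    cell : ∀ t iᵉ xᵉ yᵉ {i x y} → ⟦ iᵉ ⟧ m ≡ i → ⟦ xᵉ ⟧ m ≡ x → ⟦ yᵉ ⟧ m ≡ y →
      m t (⟦ indexᵉ iᵉ xᵉ yᵉ ⟧ m) ≡ m t (index i x y)
    cell t iᵉ xᵉ yᵉ refl refl refl rewrite Basic.total≡ b = refl

    index≡ : m sizeᴬ 0 ∸ m kᴬ 0 ≡ length (reverse back)
    index≡ = trans (cong₂ _∸_ (trans (Basic.size≡ b) (sym (lineup-lengths forward front order≡))) k≡)
      (trans (m+n∸m≡n (length front) (length back)) (sym (List.length-reverse back)))

    backward≡ : m backwardᴬ (⟦ indexᵉ (! sizeᴬ ⊖ ! kᴬ) (! totalᴬ ⊖ prefixᴬ [ ! kᴬ ]) (! totalᴬ ⊖ ! aᴬ) ⟧ m)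
      ≡ table backward (reverse front) (P ∸ total p front) (P ∸ a)
    backward≡ = trans
      (cell backwardᴬ (! sizeᴬ ⊖ ! kᴬ) (! totalᴬ ⊖ prefixᴬ [ ! kᴬ ]) (! totalᴬ ⊖ ! aᴬ) index≡
        (cong₂ _∸_ (Basic.total≡ b) prefix≡) (cong₂ _∸_ (Basic.total≡ b) a≡))
      (Prepared.filled ready backward (reverse back) (reverse front)
        (trans (cong reverse order≡) (List.reverse-++ front back)) (m∸n≤m P (total p front)) (m∸n≤m P a))

    forward≡ : m forwardᴬ (⟦ indexᵉ (! kᴬ) (prefixᴬ [ ! kᴬ ]) (clampᵉ (! aᴬ ⊕ ! eᴬ)) ⟧ m)
      ≡ table forward back (total p front) (clamp (a + e))
    forward≡ = trans
      (cell forwardᴬ (! kᴬ) (prefixᴬ [ ! kᴬ ]) (clampᵉ (! aᴬ ⊕ ! eᴬ)) k≡ prefix≡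
        (cong₂ (λ x y → x ∸ (x ∸ y)) (cong₂ _+_ a≡ e≡) (Basic.total≡ b)))
      (Prepared.filled ready forward front back order≡ front≤P (clamp-≤ (a + e)))

  pick chooseCell chooseLoop chooseBody : Code
  pick       = currentᴬ ≔ combinedᵉ ⨟ splitᴬ ≔ ! kᴬ ⨟ startᴬ ≔ ! aᴬ
  chooseCell = IF combinedᵉ <ᵗ ! currentᴬ THEN pick ELSE skip
  chooseLoop = UP eachTime aᴬ chooseCell
  chooseBody = aᴬ ≔ lit 0 ⨟ chooseLoop

  record Attained (e : ℕ) (m : Memory) : Set where
    field
      {front back} : List (Fin n)
      order≡   : order ≡ front ++ back
      split≡   : m splitᴬ 0 ≡ length front
      start≤P  : m startᴬ 0 ≤ P
      current≡ : m currentᴬ 0 ≡ combined front back (m startᴬ 0) e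

  -- `currentᴬ` is a lower bound for all candidates that precede `(k , a)` in the order of the
  -- loops. It starts at `∞`, which no candidate needs to attain.
  record Chosen (e k a : ℕ) (m : Memory) : Set where
    constructor chosen
    field
      below    : ∀ front back a′ → order ≡ front ++ back → length front < k → a′ ≤ P →
                 m currentᴬ 0 ≤ combined front back a′ e
      same     : ∀ front back a′ → order ≡ front ++ back → length front ≡ k → a′ < a →
                 m currentᴬ 0 ≤ combined front back a′ e
      attained : m currentᴬ 0 < ∞ → Attained e m

  <ᵇ-cases : ∀ a b → ((a <ᵇ b) ≡ true × a < b) ⊎ ((a <ᵇ b) ≡ false × b ≤ a)
  <ᵇ-cases a b with a <ᵇ b in eq
  ... | true  = inj₁ (refl , <ᵇ⇒< a b (subst T (sym eq) _))
  ... | false = inj₂ (refl , ≮⇒≥ λ h → subst T eq (<⇒<ᵇ h))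

  choose-cell : ∀ {e k a m} → Prepared m → m eᴬ 0 ≡ e → m kᴬ 0 ≡ k → m aᴬ 0 ≡ a → k ≤ n → a ≤ P →
    Chosen e k a m → Chosen e k (suc a) (next aᴬ (run chooseCell m))
  choose-cell {e} {k} {a} {m} ready e≡ k≡ a≡ k≤n a≤P (chosen below same attained) =
    go (<ᵇ-cases (⟦ combinedᵉ ⟧ m) (m currentᴬ 0))
    where
    value≡ : ∀ front back → order ≡ front ++ back → length front ≡ k → ⟦ combinedᵉ ⟧ m ≡ combined front back a e
    value≡ front back order≡ len = combined-eval {m} {front} {back} ready order≡ (trans k≡ (sym len)) a≡ e≡

    same′ : ∀ {c} → c ≤ m currentᴬ 0 → c ≤ ⟦ combinedᵉ ⟧ m →
      ∀ front back a′ → order ≡ front ++ back → length front ≡ k → a′ < suc a → c ≤ combined front back a′ e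
    same′ c≤ c≤′ front back a′ order≡ len (s≤s a′≤a) with m≤n⇒m<n∨m≡n a′≤a
    ... | inj₁ a′<a = ≤-trans c≤ (same front back a′ order≡ len a′<a)
    ... | inj₂ refl = ≤-trans c≤′ (≤-reflexive (value≡ front back order≡ len))

    branch : ∀ {b c} → ⟦ combinedᵉ <ᵗ ! currentᴬ ⟧ᵗ m ≡ b → c ≡ (if b then pick else skip) →
      run c m ≡ run chooseCell m
    branch {true}  eq refl rewrite eq = refl
    branch {false} eq refl rewrite eq = refl

    go : _ → Chosen e k (suc a) (next aᴬ (run chooseCell m))
    go (inj₁ (t , v<)) = subst (λ M → Chosen e k (suc a) (next aᴬ M)) (branch t refl) (chosen
      (λ front back a′ order≡ len a′≤ → ≤-trans (<⇒≤ v<) (below front back a′ order≡ len a′≤))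
      (same′ (<⇒≤ v<) ≤-refl)
      (λ _ → let front , back , order≡ , len = order-split k≤n in record
        { front = front ; back = back ; order≡ = order≡
        ; split≡   = trans k≡ (sym len)
        ; start≤P  = ≤-trans (≤-reflexive a≡) a≤P
        ; current≡ = trans (value≡ front back order≡ len) (cong (λ z → combined front back z e) (sym a≡)) }))
    go (inj₂ (f , ≤v)) = subst (λ M → Chosen e k (suc a) (next aᴬ M)) (branch f refl) (chosen
      below (same′ ≤-refl ≤v)
      (λ h → let open Attained (attained h) in record
        { front = front ; back = back ; order≡ = order≡ ; split≡ = split≡ ; start≤P = start≤P ; current≡ = current≡ }))

  choose-row : ∀ {e k m} → Prepared m → m eᴬ 0 ≡ e → m kᴬ 0 ≡ k → k ≤ n →
    Chosen e k 0 m → Chosen e (suc k) 0 (next kᴬ (run chooseBody m))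
  choose-row {e} {k} {m} ready e≡ k≡ k≤n (chosen below same attained) = chosen
    (λ front back a′ order≡ len a′≤P → lower front back a′ order≡ (m≤n⇒m<n∨m≡n (≤-pred len)) a′≤P)
    (λ front back a′ order≡ len ())
    (λ h → let open Attained (Chosen.attained end h) in record
      { front = front ; back = back ; order≡ = order≡ ; split≡ = split≡ ; start≤P = start≤P ; current≡ = current≡ })
    where
    m₁ : Memory
    m₁ = run (aᴬ ≔ lit 0) m
    prep₁ : Prepared m₁
    prep₁ = prepared-agrees (run-agrees (aᴬ ≔ lit 0) m refl) ready
    start : Chosen e k 0 m₁
    start = chosen below (λ front back a′ order≡ len ()) (λ h → let open Attained (attained h) in record
      { front = front ; back = back ; order≡ = order≡ ; split≡ = split≡ ; start≤P = start≤P ; current≡ = current≡ })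
    end : Chosen e k (suc P) (run chooseLoop m₁)
    end = loop-invariant eachTime aᴬ chooseCell m₁ (Chosen e k) refl
      (trans (cong (_+ 1) (Basic.total≡ (Setup.basics (Prepared.isSetup prep₁)))) (+-comm P 1)) refl z≤n start
      λ { a m′ (s≤s a≤P) a≡ keeps ch →
          choose-cell (prepared-agrees (keeps-agrees chooseLoop refl keeps) prep₁)
            (trans (keeps eᴬ refl 0) e≡) (trans (keeps kᴬ refl 0) k≡) a≡ k≤n a≤P ch }
    lower : ∀ front back a′ → order ≡ front ++ back → length front < k ⊎ length front ≡ k → a′ ≤ P →
      run chooseLoop m₁ currentᴬ 0 ≤ combined front back a′ e
    lower front back a′ order≡ (inj₁ len) a′≤P = Chosen.below end front back a′ order≡ len a′≤P
    lower front back a′ order≡ (inj₂ len) a′≤P = Chosen.same end front back a′ order≡ len (s≤s a′≤P)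

  choose-correct : ∀ {e m} → Prepared m → m eᴬ 0 ≡ e → m currentᴬ 0 ≡ ∞ → Chosen e (suc n) 0 (run choose m)
  choose-correct {e} {m} ready e≡ current≡ =
    loop-invariant eachSplit kᴬ chooseBody m₁ (λ k → Chosen e k 0) refl
      (trans (cong (_+ 1) (Basic.size≡ (Setup.basics (Prepared.isSetup prep₁)))) (+-comm n 1)) refl z≤n
      (chosen (λ _ _ _ _ ()) (λ _ _ _ _ _ ()) (λ h → contradiction h (<-irrefl current≡)))
      λ { k m′ (s≤s k≤n) k≡ keeps ch →
          choose-row (prepared-agrees (keeps-agrees (UP eachSplit kᴬ chooseBody) refl keeps) prep₁)
            (trans (keeps eᴬ refl 0) e≡) k≡ k≤n ch }
    where
    m₁ : Memory
    m₁ = run (kᴬ ≔ lit 0) m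
    prep₁ : Prepared m₁
    prep₁ = prepared-agrees (run-agrees (kᴬ ≔ lit 0) m refl) ready

  -- Cutting `σ` at its first and last r-job and normalising gives a split and a start that are
  -- among the candidates. Its block has length exactly `er σ`, and neither the exchange argument
  -- nor the table lookup increases the cost.
  chosen-lower : ∀ {e m} → Chosen e (suc n) 0 m → ∀ σ → er σ ≡ e → m currentᴬ 0 ≤ ∑wC σ
  chosen-lower {e} {m} ch σ refl
    with before , during , after , jobs≡ , free-before , free-after , 0<during , during≤er ← er-decompose σ =
    begin
      m currentᴬ 0
        ≤⟨ Chosen.below ch front back (total p (select class 0 front)) js≡
             (s≤s (≤-trans (m≤m+n (length front) (length back)) (≤-reflexive (lineup-lengths forward front js≡))))
             (proj₂ bound) ⟩
      combined front back (total p (select class 0 front)) (er σ)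
        ≡⟨ cong (combined front back (total p (select class 0 front))) er≡ ⟩
      combined front back (total p (select class 0 front)) (total p (select class 1 (front ++ back)))
        ≤⟨ proj₁ bound ⟩
      cost 0 (arrange class (front ++ back))
        ≡⟨ cong (λ js → cost 0 (arrange class js)) (sym js≡) ⟩
      cost 0 (arrange class order)
        ≤⟨ cost≤ ⟩
      cost 0 (before ++ during ++ after)
        ≡⟨ cong (cost 0) (sym jobs≡) ⟩
      cost 0 (jobs σ)
        ≡⟨ sym (∑wC-cost σ) ⟩
      ∑wC σ ∎
    where
    open ≤-Reasoning
    open Normal (normalise {order} {before} {during} {after} order-sorted order-unique
      (↭-trans (↭-reflexive (sym jobs≡)) (↭-trans (proj₂ σ) (↭-sym order-↭))) 0<during free-before free-after)
    bound = combined-≤ okay-front okay-back (trans (cong (total p) (sym js≡)) total-order)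
    er≡ : er σ ≡ total p (select class 1 (front ++ back))
    er≡ = trans (≤-antisym (er-≤ σ before during after jobs≡ free-before free-after) during≤er)
      (trans (sym during≡) (cong (λ js → total p (select class 1 js)) js≡))

  row : Sequence → List ℕ
  row σ = map toℕ (jobs σ)

  -- `best≤` ensures that a strict improvement is below `∞` and so comes from a feasible assignment.
  record Progress (e : ℕ) (m : Memory) : Set where
    constructor progress
    field
      {found}  : List Sequence
      frontier : Frontier e (m bestᴬ 0) found
      best≤    : m bestᴬ 0 ≤ ∞
      written  : Written m (concat (map row found))
      count≡   : m countᴬ 0 ≡ length found

  concat-∷ʳ : ∀ σs σ → concat (map row σs) ++ row σ ≡ concat (map row (σs ∷ʳ σ))
  concat-∷ʳ σs σ = trans (cong (concat (map row σs) ++_) (sym (List.++-identityʳ (row σ))))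
    (trans (List.concat-++ (map row σs) (row σ ∷ [])) (cong concat (sym (List.map-++ row σs (σ ∷ [])))))

  -- The walks put only jobs that do not need the resource outside the block, and the block has
  -- length `e`. That bounds `er τ`; equality comes later, from the strict improvement.
  emitted-sequence : ∀ {front back a e ks M c} → order ≡ front ++ back → c ≡ combined front back a e → a + e ≤ P →
    (E : Emitted front back a e ks M) →
    ∃[ τ ] jobs τ ≡ arrange (Emitted.class E) order × ∑wC τ ≤ c × er τ ≤ e
  emitted-sequence {front} {back} {a} {e} {c = c} order≡ c≡ a+e≤P E = τ , refl , τ-cost , τ-er
    where
    open Emitted E using (class; optimal-front; optimal-back)

    okay-front : All (Okay rent 0 class) front
    okay-front = Perm.All-resp-↭ (Perm.↭-reverse front) (Optimal.okay optimal-front)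

    optimum = combined-optimal {front} {back} {class} okay-front (Optimal.okay optimal-back)
      (trans (cong (total p) (sym order≡)) total-order) {a} {e} (≤-trans (m≤m+n a e) a+e≤P) optimal-front optimal-back

    Fine : Fin n → Set
    Fine j = class j ≤ 2 × (class j ≡ 1 ⊎ rent j ≡ 0)

    fine : ∀ {c} → c ≤ 2 → ∀ {j} → Okay rent c class j → Fine j
    fine c≤2 (inj₁ eq)       = ≤-trans (≤-reflexive eq) (s≤s z≤n) , inj₁ eq
    fine c≤2 (inj₂ (eq , z)) = ≤-trans (≤-reflexive eq) c≤2 , inj₂ z

    all-fine : All Fine order
    all-fine = subst (All Fine) (sym order≡)
      (All.++⁺ (All.map (fine z≤n) okay-front) (All.map (fine ≤-refl) (Optimal.okay optimal-back)))

    free : ∀ c → c ≢ 1 → Free (select class c order)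
    free c c≢1 = All.tabulate λ {j} j∈ →
      let j∈order , eq = ∈-filter⁻ (λ j → class j ≟ c) {xs = order} j∈ in
      [ (λ e → contradiction (trans (sym eq) e) c≢1) , id ]′ (proj₂ (All.lookup all-fine j∈order))

    τ : Sequence
    τ = arrange class order , ↭-trans (arrange-↭ class (All.map proj₁ all-fine)) order-↭

    τ-cost : ∑wC τ ≤ c
    τ-cost = ≤-reflexive (trans (∑wC-cost τ) (trans (cong (λ js → cost 0 (arrange class js)) order≡)
      (trans (proj₂ optimum) (trans (sym (combined-unpenalised front back a e a+e≤P)) (sym c≡)))))

    τ-er : er τ ≤ e
    τ-er = ≤-trans (er-≤ τ (select class 0 order) (select class 1 order) (select class 2 order) refl
        (free 0 (λ ())) (free 2 (λ ())))
      (≤-reflexive (trans (cong (λ js → total p (select class 1 js)) order≡) (proj₁ optimum)))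

  output-correct : ∀ {e m M σs best} → M ≡ run output m → Prepared m → m eᴬ 0 ≡ e → Attained e m →
    Frontier e best σs → (∀ σ → er σ ≡ e → m currentᴬ 0 ≤ ∑wC σ) → m currentᴬ 0 < best → best ≤ ∞ →
    Written m (concat (map row σs)) → m bestᴬ 0 ≡ m currentᴬ 0 → m countᴬ 0 ≡ length σs + 1 →
    Progress (suc e) M
  output-correct {e} {m} {M} {σs} {best} M≡ ready e≡ attained frontier lower current< best≤ written best≡ count≡ =
    conclude (emitted-sequence order≡ current≡ a+e≤P emission′)
    where
    kept : ∀ b → writes b output ≡ false → M b 0 ≡ m b 0
    kept b h = trans (cong (λ X → X b 0) M≡) (frame output {b} m h 0)

    M-best : M bestᴬ 0 ≡ m currentᴬ 0
    M-best = trans (kept bestᴬ refl) best≡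

    current<∞ : m currentᴬ 0 < ∞
    current<∞ = <-≤-trans current< best≤

    open Attained attained

    a : ℕ
    a = m startᴬ 0

    combined<∞ : combined front back a e < ∞
    combined<∞ = subst (_< ∞) current≡ current<∞

    -- A cost below `∞` cannot contain the penalty for ending the renting period after `P`.
    a+e≤P : a + e ≤ P
    a+e≤P = m∸n≡0⇒m≤n (no-penalty {table backward (reverse front) (P ∸ total p front) (P ∸ a)
      + table forward back (total p front) (clamp (a + e))} combined<∞)

    cost₁ cost₂ : ℕ
    cost₁ = table backward (reverse front) (P ∸ total p front) (P ∸ a)
    cost₂ = table forward back (total p front) (a + e)

    tables<∞ : cost₁ + cost₂ < ∞
    tables<∞ = subst (_< ∞) (combined-unpenalised front back a e a+e≤P) combined<∞

    emission′ : Emitted front back a e (concat (map row σs)) M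
    emission′ = subst (Emitted front back a e (concat (map row σs))) (sym M≡)
      (emitted {m} {front} {back} {a} {e} {concat (map row σs)} ready order≡ split≡ refl e≡ a+e≤P
        (≤-<-trans (m≤m+n cost₁ cost₂) tables<∞) (≤-<-trans (m≤n+m cost₂ cost₁) tables<∞) written)

    conclude : (∃[ τ ] jobs τ ≡ arrange (Emitted.class emission′) order × ∑wC τ ≤ m currentᴬ 0 × er τ ≤ e) →
      Progress (suc e) M
    conclude (τ , τ≡ , τ-cost , τ-er) = progress
      (subst (λ b → Frontier (suc e) b (σs ∷ʳ τ)) (sym M-best)
        (frontier-improve frontier lower current< τ τ-cost τ-er))
      (≤-trans (≤-reflexive M-best) (<⇒≤ current<∞))
      (trans (Emitted.written emission′) (trans (cong (λ js → concat (map row σs) ++ map toℕ js) (sym τ≡))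
        (concat-∷ʳ σs τ)))
      (trans (kept countᴬ refl) (trans count≡ (sym (List.length-++ σs))))

run-seq : ∀ {o} a b m → o ≡ (a ⨟ b) → run o m ≡ run b (run a m)
run-seq a b m refl = refl

run-seq₄ : ∀ {o} a b c d m m₁ m₂ → o ≡ (a ⨟ b ⨟ c ⨟ d) → m₁ ≡ run a m → m₂ ≡ run b m₁ →
  run o m ≡ run d (run c m₂)
run-seq₄ a b c d m m₁ m₂ refl refl refl = refl

run-if-true : ∀ {o} b c d m → o ≡ (IF b THEN c ELSE d) → ⟦ b ⟧ᵗ m ≡ true → run o m ≡ run c m
run-if-true b c d m refl eq rewrite eq = refl

run-if-false : ∀ {o} b c m → o ≡ (IF b THEN c ELSE skip) → ⟦ b ⟧ᵗ m ≡ false → run o m ≡ m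
run-if-false b c m refl eq rewrite eq = refl

kept : ∀ c m m′ → m′ ≡ run c m → ∀ a → writes a c ≡ false → ∀ k → m′ a k ≡ m a k
kept c m m′ eq a h k = trans (cong (λ M → M a k) eq) (frame c {a} m h k)

kept-agrees : ∀ as c m m′ → m′ ≡ run c m → avoids as c ≡ true → Agrees as m m′
kept-agrees as c m m′ eq h a a∈ = kept c m m′ eq a (avoids-∈ c h a a∈)

resultArrays : List ArrayName
resultArrays = bestᴬ ∷ countᴬ ∷ sequencesᴬ ∷ positionᴬ ∷ []

-- The outer loop over the lengths of the renting period

module Solving (I : Instance) where

  open Instance I
  open Sequences I
  open RatioOrder I
  open Frontiers I
  open TableFilling I
  open Outputting I
  open Searching I

  progress-agrees : ∀ {e} m m′ → Agrees resultArrays m m′ → Progress e m → Progress e m′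
  progress-agrees {e} m m′ ag (progress {σs} frontier best≤ written count≡) = progress
    (subst (λ b → Frontier e b σs) (sym best≡) frontier)
    (≤-trans (≤-reflexive best≡) best≤)
    (trans (cong (applyUpTo (m′ sequencesᴬ)) (ag positionᴬ (there (there (there (here refl)))) 0))
      (trans (applyUpTo-cong (m positionᴬ 0) (λ k _ → ag sequencesᴬ (there (there (here refl))) k)) written))
    (trans (ag countᴬ (there (here refl)) 0) count≡)
    where
    best≡ : m′ bestᴬ 0 ≡ m bestᴬ 0
    best≡ = ag bestᴬ (here refl) 0

  attained-agrees : ∀ {e} m m′ → Agrees (currentᴬ ∷ splitᴬ ∷ startᴬ ∷ []) m m′ → Attained e m → Attained e m′
  attained-agrees {e} m m′ ag at = record
    { front = front ; back = back ; order≡ = order≡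
    ; split≡   = trans (ag splitᴬ (there (here refl)) 0) split≡
    ; start≤P  = ≤-trans (≤-reflexive start≡) start≤P
    ; current≡ = trans (ag currentᴬ (here refl) 0)
        (trans current≡ (cong (λ a → combined front back a e) (sym start≡))) }
    where
    open Attained at
    open Combination p w rent P ∞ using (combined)
    start≡ : m′ startᴬ 0 ≡ m startᴬ 0
    start≡ = ag startᴬ (there (there (here refl))) 0

  improve-correct : ∀ {e} m m′ M → m′ ≡ run improvement m → M ≡ run output m′ → Prepared m → m eᴬ 0 ≡ e →
    Chosen e (suc n) 0 m → Progress e m → m currentᴬ 0 < m bestᴬ 0 → Progress (suc e) M
  improve-correct {e} m m′ M m′≡ M≡ ready e≡ ch (progress {σs} frontier best≤ written count≡) current< =
    output-correct {e} {m′} {M} {σs} {m bestᴬ 0} M≡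
      (subst Prepared (sym m′≡) (prepared-agrees (run-agrees improvement m refl) ready))
      (trans (at m′≡) e≡)
      (attained-agrees m m′ (subst (Agrees (currentᴬ ∷ splitᴬ ∷ startᴬ ∷ []) m) (sym m′≡) (run-agrees improvement m refl))
        (Chosen.attained ch (<-≤-trans current< best≤)))
      frontier
      (λ σ er≡ → ≤-trans (≤-reflexive (at m′≡)) (chosen-lower {e} {m} ch σ er≡))
      (≤-<-trans (≤-reflexive (at m′≡)) current<)
      best≤
      (trans (cong (λ X → applyUpTo (X sequencesᴬ) (X positionᴬ 0)) m′≡) written)
      (trans (at m′≡) (sym (at m′≡)))
      (trans (at m′≡) (cong (_+ 1) count≡))

  decide-correct : ∀ {e} m M → M ≡ run decide m → Prepared m → m eᴬ 0 ≡ e →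
    Chosen e (suc n) 0 m → Progress e m → Progress (suc e) M
  decide-correct {e} m M M≡ ready e≡ ch pr = go (<ᵇ-cases (m currentᴬ 0) (m bestᴬ 0))
    where
    improved : ⟦ ! currentᴬ <ᵗ ! bestᴬ ⟧ᵗ m ≡ true → M ≡ run output (run improvement m)
    improved t = trans M≡ (trans
      (run-if-true {decide} (! currentᴬ <ᵗ ! bestᴬ) (improvement ⨟ output) skip m refl t)
      (run-seq {improvement ⨟ output} improvement output m refl))

    go : ((m currentᴬ 0 <ᵇ m bestᴬ 0) ≡ true × m currentᴬ 0 < m bestᴬ 0)
       ⊎ ((m currentᴬ 0 <ᵇ m bestᴬ 0) ≡ false × m bestᴬ 0 ≤ m currentᴬ 0) → Progress (suc e) M
    go (inj₁ (t , current<)) = improve-correct {e} m (run improvement m) M refl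
      (improved t) ready e≡ ch pr current<
    go (inj₂ (t , best≤current)) = subst (Progress (suc e))
      (sym (trans M≡ (run-if-false {decide} (! currentᴬ <ᵗ ! bestᴬ) (improvement ⨟ output) m refl t)))
      (progress (frontier-skip (Progress.frontier pr) (chosen-lower {e} {m} ch) best≤current)
        (Progress.best≤ pr) (Progress.written pr) (Progress.count≡ pr))

  body-correct : ∀ {e} m m₁ m₂ M → m₁ ≡ run (currentᴬ ≔ ! bigᴬ) m → m₂ ≡ run choose m₁ → M ≡ run decide m₂ →
    Prepared m → m eᴬ 0 ≡ e → Progress e m → Progress (suc e) M
  body-correct {e} m m₁ m₂ M m₁≡ m₂≡ M≡ ready e≡ pr = decide-correct {e} m₂ M M≡ prep₂
    (trans (kept choose m₁ m₂ m₂≡ eᴬ refl 0) e₁≡)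
    (subst (Chosen e (suc n) 0) (sym m₂≡) (choose-correct {e} {m₁} prep₁ e₁≡
      (trans (at m₁≡) (Basic.big≡ (Setup.basics (Prepared.isSetup ready))))))
    (progress-agrees m₁ m₂ (kept-agrees resultArrays choose m₁ m₂ m₂≡ refl)
      (progress-agrees m m₁ (kept-agrees resultArrays (currentᴬ ≔ ! bigᴬ) m m₁ m₁≡ refl) pr))
    where
    prep₁ : Prepared m₁
    prep₁ = prepared-agrees {m} {m₁} (kept-agrees preparedArrays (currentᴬ ≔ ! bigᴬ) m m₁ m₁≡ refl) ready
    prep₂ : Prepared m₂
    prep₂ = prepared-agrees {m₁} {m₂} (kept-agrees preparedArrays choose m₁ m₂ m₂≡ refl) prep₁
    e₁≡ : m₁ eᴬ 0 ≡ e
    e₁≡ = trans (at m₁≡) e≡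

  progress-next : ∀ {e} M → Progress e M → Progress e (next eᴬ M)
  progress-next M (progress frontier best≤ written count≡) = progress frontier best≤ written count≡

  restart-correct : ∀ m → Prepared m → Progress 0 (run restart m)
  restart-correct m ready = progress {found = []}
    (subst (λ b → Frontier 0 b []) (sym big≡) frontier-start) (≤-reflexive big≡) refl refl
    where
    big≡ : m bigᴬ 0 ≡ ∞
    big≡ = Basic.big≡ (Setup.basics (Prepared.isSetup ready))

  search-correct : ∀ m m₁ M → m₁ ≡ run restart m → M ≡ run (UP eachTime eᴬ body) m₁ → Prepared m →
    Progress (suc P) M
  search-correct m m₁ M m₁≡ M≡ ready = subst (Progress (suc P)) (sym M≡)
    (loop-invariant eachTime eᴬ body m₁ (λ e → Progress e) refl
      (trans (cong (_+ 1) (Basic.total≡ (Setup.basics (Prepared.isSetup prep₁)))) (+-comm P 1)) (at m₁≡) z≤n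
      (subst (Progress 0) (sym m₁≡) (restart-correct m ready)) step)
    where
    prep₁ : Prepared m₁
    prep₁ = prepared-agrees {m} {m₁} (kept-agrees preparedArrays restart m m₁ m₁≡ refl) ready
    step : ∀ e m′ → e < suc P → m′ eᴬ 0 ≡ e → Keeps (UP eachTime eᴬ body) m₁ m′ → Progress e m′ →
      Progress (suc e) (next eᴬ (run body m′))
    step e m′ e< e≡ keeps pr = progress-next (run body m′)
      (body-correct m′ (run (currentᴬ ≔ ! bigᴬ) m′) (run choose (run (currentᴬ ≔ ! bigᴬ) m′)) (run body m′)
        refl refl body≡ (prepared-agrees (keeps-agrees (UP eachTime eᴬ body) refl keeps) prep₁) e≡ pr)
      where
      body≡ = trans (run-seq {body} (currentᴬ ≔ ! bigᴬ) (choose ⨟ decide) m′ refl)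
        (run-seq {choose ⨟ decide} choose decide (run (currentᴬ ≔ ! bigᴬ) m′) refl)

  fills-correct : ∀ m m₁ m₂ → m₁ ≡ run (fill forward) m → m₂ ≡ run (fill backward) m₁ → Setup m → Prepared m₂
  fills-correct m m₁ m₂ m₁≡ m₂≡ s = prepared setup₂
    λ { forward  xs ys eq {x} {y} x≤ y≤ →
          trans (kept (fill backward) m₁ m₂ m₂≡ forwardᴬ refl (index (length xs) x y)) (filled₁ xs ys eq x≤ y≤)
      ; backward → subst (Filled backward) (sym m₂≡) (proj₂ (fill-correct backward m₁ setup₁)) }
    where
    open Verification I using (index)
    setup₁ : Setup m₁
    setup₁ = subst Setup (sym m₁≡) (proj₁ (fill-correct forward m s))
    setup₂ : Setup m₂
    setup₂ = subst Setup (sym m₂≡) (proj₁ (fill-correct backward m₁ setup₁))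
    filled₁ : Filled forward m₁
    filled₁ = subst (Filled forward) (sym m₁≡) (proj₂ (fill-correct forward m s))

  solving-correct : ∀ m → Setup m → Progress (suc P) (run solving m)
  solving-correct m s = go (run (fill forward) m) (run (fill backward) (run (fill forward) m)) refl refl
    where
    go : ∀ m₁ m₂ → m₁ ≡ run (fill forward) m → m₂ ≡ run (fill backward) m₁ → Progress (suc P) (run solving m)
    go m₁ m₂ m₁≡ m₂≡ = search-correct m₂ (run restart m₂) (run solving m) refl
      (run-seq₄ {solving} (fill forward) (fill backward) restart (UP eachTime eᴬ body) m m₁ m₂ refl m₁≡ m₂≡)
      (fills-correct m m₁ m₂ m₁≡ m₂≡ s)

  finished : ∀ {m} → Progress (suc P) m → ∃[ σs ] IsParetoFront I σs × Outputs I m σs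
  finished {m} (progress {σs} frontier best≤ written count≡) = σs , frontier-finish frontier ,
    trans (cong (applyUpTo (λ k → applyUpTo (λ i → m sequencesᴬ (k * n + i)) n))
        (trans count≡ (sym (List.length-map row σs))))
      (rows-concat n (map row σs) (All.map⁺ (All.universal length-row σs)) written)
    where
    length-row : ∀ σ → length (row σ) ≡ n
    length-row (js , perm) = trans (List.length-map toℕ js) (trans (Perm.↭-length perm) (List.length-tabulate id))

-- The whole program and its time bound

program : Program
program = compile sums ⨾ totalᴬ [ lit 0 ]:= ! uᴬ ⨾ compile preparation ⨾ compile solving

-- Bounding `suc n` by `2 * n` and `suc P` by `2 * P` costs 2, 4 and 8 in budgets of degree one, two
-- and three. The summand 4 is the cost of the assignment to `totalᴬ`.
factor : ℕ → ℕ → ℕ → ℕ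
factor k₁ k₂ k₃ = 2 * k₁ + 4 + 4 * k₂ + 8 * k₃

time-bound : ∀ k₁ k₂ k₃ b₁ b₂ b₃ n P → 1 ≤ n → n ≤ P →
  b₁ ≡ suc n ^ 1 * suc P ^ 0 → b₂ ≡ suc n ^ 2 * suc P ^ 0 → b₃ ≡ suc n ^ 1 * suc P ^ 2 →
  k₁ * b₁ + (4 + (k₂ * b₂ + k₃ * b₃)) ≤ factor k₁ k₂ k₃ * (n * P ^ 2)
time-bound k₁ k₂ k₃ _ _ _ n P 1≤n n≤P refl refl refl = begin
  k₁ * (suc n ^ 1 * suc P ^ 0) + (4 + (k₂ * (suc n ^ 2 * suc P ^ 0) + k₃ * (suc n ^ 1 * suc P ^ 2)))
    ≤⟨ +-mono-≤ (*-monoʳ-≤ k₁ linear) (+-mono-≤ constant (+-mono-≤ (*-monoʳ-≤ k₂ quadratic) (*-monoʳ-≤ k₃ cubic))) ⟩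
  k₁ * (2 * X) + (4 * X + (k₂ * (4 * X) + k₃ * (8 * X)))
    ≡⟨ collect k₁ k₂ k₃ X ⟩
  factor k₁ k₂ k₃ * X ∎
  where
  open ≤-Reasoning
  X : ℕ
  X = n * P ^ 2

  1≤P : 1 ≤ P
  1≤P = ≤-trans 1≤n n≤P

  collect : ∀ a b c x → a * (2 * x) + (4 * x + (b * (4 * x) + c * (8 * x))) ≡ (2 * a + 4 + 4 * b + 8 * c) * x
  collect = solve-∀

  1≤P² : 1 ≤ P ^ 2
  1≤P² = *-mono-≤ 1≤P (*-mono-≤ 1≤P (≤-refl {1}))

  P≤P² : P ≤ P ^ 2
  P≤P² = ≤-trans (≤-reflexive (sym (*-identityʳ P))) (*-monoʳ-≤ P (≤-trans 1≤P (≤-reflexive (sym (*-identityʳ P)))))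

  double : ∀ {x} → 1 ≤ x → suc x ≤ 2 * x
  double {x} 1≤x = ≤-trans (+-monoˡ-≤ x 1≤x) (+-monoʳ-≤ x (≤-reflexive (sym (+-identityʳ x))))

  constant : 4 ≤ 4 * X
  constant = *-monoʳ-≤ 4 (*-mono-≤ 1≤n 1≤P²)

  n≤X : n ≤ X
  n≤X = ≤-trans (≤-reflexive (sym (*-identityʳ n))) (*-monoʳ-≤ n 1≤P²)

  linear : suc n ^ 1 * suc P ^ 0 ≤ 2 * X
  linear = ≤-trans (≤-reflexive (trans (*-identityʳ _) (*-identityʳ _))) (≤-trans (double 1≤n) (*-monoʳ-≤ 2 n≤X))

  -- The time for sorting is absorbed because `n` is at most `P`, all processing times being
  -- positive.
  quadratic : suc n ^ 2 * suc P ^ 0 ≤ 4 * X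
  quadratic = ≤-trans (≤-reflexive (*-identityʳ _)) (≤-trans (^-monoˡ-≤ 2 (double 1≤n))
    (≤-trans (≤-reflexive (square n)) (*-monoʳ-≤ 4 (*-monoʳ-≤ n (≤-trans n≤P P≤P²)))))
    where
    square : ∀ x → (2 * x) * ((2 * x) * 1) ≡ 4 * (x * x)
    square = solve-∀

  cubic : suc n ^ 1 * suc P ^ 2 ≤ 8 * X
  cubic = ≤-trans (*-mono-≤ (^-monoˡ-≤ 1 (double 1≤n)) (^-monoˡ-≤ 2 (double 1≤P))) (≤-reflexive (cube n P))
    where
    cube : ∀ x y → (2 * x) * 1 * ((2 * y) * ((2 * y) * 1)) ≡ 8 * (x * (y * (y * 1)))
    cube = solve-∀

module Conclusion (I : Instance) where

  open Instance I
  open Sequences I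
  open TableFilling I
  open SettingUp I
  open Solving I
  open Timing (suc n) (suc P) (s≤s z≤n) (s≤s z≤n)

  1≤n : 1 ≤ n
  1≤n = ≤-trans (s≤s z≤n) (Fin.toℕ<n (proj₁ rJobs-nonempty))

  length≤total : ∀ js → length js ≤ total p js
  length≤total []       = z≤n
  length≤total (j ∷ js) = +-mono-≤ (p-positive j) (length≤total js)

  n≤P : n ≤ P
  n≤P = subst (_≤ P) length-allFin (length≤total (allFin n))

  initialise : Code
  initialise = bigᴬ ≔ lit 1 ⊕ ! vᴬ ⊗ ! totalᴬ

  prepared-setup : ∀ m → Basic (run initialise m) → Setup (run preparation m)
  prepared-setup m b = subst Setup (sym preparation≡) (prepare-setup (run initialise m) b)
    where
    preparation≡ = run-seq {preparation} initialise (sorting ⨟ prefixes) m refl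

  timed : ∀ c₁ c₂ c₃ m₀ m₁ m₂ →
    wellFormed c₁ ≡ true → wellFormed c₂ ≡ true → wellFormed c₃ ≡ true →
    Small m₀ → Small m₂ → m₁ ≡ run c₁ m₀ → m₂ ≡ (m₁ [ totalᴬ ][ 0 ]≔ m₁ uᴬ 0) →
    budget c₁ ≡ suc n ^ 1 * suc P ^ 0 → budget c₂ ≡ suc n ^ 2 * suc P ^ 0 → budget c₃ ≡ suc n ^ 1 * suc P ^ 2 →
    ∃[ t ] ((compile c₁ ⨾ totalᴬ [ lit 0 ]:= ! uᴬ ⨾ compile c₂ ⨾ compile c₃) ∶ m₀ ⇓[ t ] run c₃ (run c₂ m₂))
      × t ≤ factor (coefficient c₁) (coefficient c₂) (coefficient c₃) * (n * P ^ 2)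
  timed c₁ c₂ c₃ m₀ m₁ m₂ wf₁ wf₂ wf₃ small₀ small₂ refl refl b₁ b₂ b₃ =
    let t₁ , ⇓₁ , t₁≤ = sound c₁ m₀ wf₁ small₀
        t₂ , ⇓₂ , t₂≤ = sound c₂ m₂ wf₂ small₂
        t₃ , ⇓₃ , t₃≤ = sound c₃ (run c₂ m₂) wf₃ (Small-run c₂ m₂ wf₂ small₂)
    in t₁ + (4 + (t₂ + t₃)) , ⇓-seq ⇓₁ (⇓-seq ⇓-assign (⇓-seq ⇓₂ ⇓₃)) ,
       ≤-trans (+-mono-≤ t₁≤ (+-monoʳ-≤ 4 (+-mono-≤ t₂≤ t₃≤)))
         (time-bound (coefficient c₁) (coefficient c₂) (coefficient c₃) _ _ _ n P 1≤n n≤P b₁ b₂ b₃)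

  solved : ∃[ t ] ∃[ m ] ∃[ σs ] (program ∶ input I ⇓[ t ] m)
    × t ≤ factor (coefficient sums) (coefficient preparation) (coefficient solving) * (n * P ^ 2)
    × IsParetoFront I σs × Outputs I m σs
  solved =
    let t , ⇓ , t≤ = timed sums preparation solving (input I) summed launched refl refl refl
                       small₀ small₂ refl refl refl refl refl
        σs , front , outputs = finished {run solving (run preparation launched)}
          (solving-correct (run preparation launched) (prepared-setup launched started-basic))
    in t , run solving (run preparation launched) , σs , ⇓ , t≤ , front , outputs
    where
    launched : Memory
    launched = summed [ totalᴬ ][ 0 ]≔ summed uᴬ 0
    -- At this stage `totalᴬ` is still 0; `sums` contains no loop over times.
    small₀ : Small (input I)
    small₀ = ≤-refl , s≤s z≤n
    small₁ : Small summed
    small₁ = Small-run sums (input I) refl small₀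
    small₂ : Small launched
    small₂ = proj₁ small₁ , s≤s (≤-reflexive (proj₁ sums-correct))

theorem12 : ∃[ prog ] ∃[ c ] ((I : Instance) →
    ∃[ t ] ∃[ m ] ∃[ σs ]
    (prog ∶ input I ⇓[ t ] m)
    × t ≤ c * (Instance.n I * Instance.P I ^ 2)
    × IsParetoFront I σs
    × Outputs I m σs)
theorem12 = program , factor (coefficient sums) (coefficient preparation) (coefficient solving) , Conclusion.solved
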